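{- Let $n\geq 5$ and let $\pi=(d_1,d_2,\dots,d_n)$ be a graphic sequence with $d_1\geq d_2\geq\cdots\geq d_n\geq 1$. Then $\pi$ is potentially $(K_5-P_4)$-graphic if and only if all of the following hold: (1) $d_2\geq 3$; (2) $d_5\geq 2$; (3) $\pi\neq (n-1,k,2^t,1^{n-2-t})$ for every pair of integers $k,t\in\{3,4,\dots,n-2\}$ such that $k$ and $t$ have different parities; (4) $\pi\neq (n-k,k+i,2^i,1^{n-i-2})$ for every pair of integers $i,k$ with $k\in\{1,2,\dots,\lfloor\frac{n-1}{2}\rfloor-1\}$ and $i\in\{3,4,\dots,n-2k\}$; (5) if $n\in\{6,7\}$, then $\pi\neq(3^2,2^{n-2})$.
   Context: All graphs are finite and simple. A nonincreasing sequence of nonnegative integers is graphic if it is the degree sequence of some simple graph (a realization). A graphic sequence $\pi$ is potentially $H$-graphic if it has a realization containing $H$ as a (not necessarily induced) subgraph. In a sequence, $r^t$ denotes $t$ consecutive terms equal to $r$. $P_4$ denotes the path with $5$ vertices and $4$ edges, and $K_5-P_4$ is the graph obtained from $K_5$ by deleting the edge set of a copy of $P_4$ spanning its 5 vertices (so $K_5-P_4$ has 6 edges and degree sequence $(3,3,2,2,2)$). $\lfloor x\rfloor$ is the largest integer $\leq x$. -}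

module Defs where

open import Data.Nat using (ℕ; zero; suc; _+_; _≡ᵇ_)
open import Data.Bool using (Bool; true; false; not; _∧_; if_then_else_)
open import Data.Fin using (Fin; zero; suc; toℕ; _≤_)
open import Data.List using (List; map; allFin)
open import Data.Nat.ListAction using (sum)
open import Data.Vec using (Vec; lookup)
open import Data.Product using (Σ; _×_)
open import Function.Definitions using (Injective)
open import Relation.Binary.PropositionalEquality using (_≡_; refl)

record Graph (n : ℕ) : Set where
  field
    adj    : Fin n → Fin n → Bool
    adj-sym : ∀ i j → adj i j ≡ adj j i
    irrefl : ∀ i → adj i i ≡ false
open Graph public

degree : ∀ {n} → Graph n → Fin n → ℕ
degree {n} G i = sum (map (λ j → if adj G i j then 1 else 0) (allFin n))

Nonincreasing : ∀ {n} → Vec ℕ n → Set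
Nonincreasing {n} π = ∀ (i j : Fin n) → i ≤ j → lookup π j Data.Nat.≤ lookup π i

IsRealization : ∀ {n} → Vec ℕ n → Graph n → Set
IsRealization {n} π G = ∀ (i : Fin n) → degree G i ≡ lookup π i

Graphic : ∀ {n} → Vec ℕ n → Set
Graphic {n} π = Σ (Graph n) (λ G → IsRealization π G)

_⊆G_ : ∀ {k n} → Graph k → Graph n → Set
_⊆G_ {k} {n} H G =
  Σ (Fin k → Fin n) (λ f → Injective _≡_ _≡_ f ×
     (∀ a b → adj H a b ≡ true → adj G (f a) (f b) ≡ true))

PotentiallyGraphic : ∀ {k n} → Graph k → Vec ℕ n → Set
PotentiallyGraphic {k} {n} H π =
  Σ (Graph n) (λ G → IsRealization π G × (H ⊆G G))

-- K5 - P4: vertices 0..4, remove the path 0-1-2-3-4; a,b adjacent iff |a-b| ≥ 2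
K5P4-adj : Fin 5 → Fin 5 → Bool
K5P4-adj a b =
  not (toℕ a ≡ᵇ toℕ b) ∧ not (toℕ a ≡ᵇ suc (toℕ b)) ∧ not (suc (toℕ a) ≡ᵇ toℕ b)

K5P4-adj-sym : ∀ a b → K5P4-adj a b ≡ K5P4-adj b a
K5P4-adj-sym zero zero = refl
K5P4-adj-sym zero (suc zero) = refl
K5P4-adj-sym zero (suc (suc zero)) = refl
K5P4-adj-sym zero (suc (suc (suc zero))) = refl
K5P4-adj-sym zero (suc (suc (suc (suc zero)))) = refl
K5P4-adj-sym (suc zero) zero = refl
K5P4-adj-sym (suc zero) (suc zero) = refl
K5P4-adj-sym (suc zero) (suc (suc zero)) = refl
K5P4-adj-sym (suc zero) (suc (suc (suc zero))) = refl
K5P4-adj-sym (suc zero) (suc (suc (suc (suc zero)))) = refl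
K5P4-adj-sym (suc (suc zero)) zero = refl
K5P4-adj-sym (suc (suc zero)) (suc zero) = refl
K5P4-adj-sym (suc (suc zero)) (suc (suc zero)) = refl
K5P4-adj-sym (suc (suc zero)) (suc (suc (suc zero))) = refl
K5P4-adj-sym (suc (suc zero)) (suc (suc (suc (suc zero)))) = refl
K5P4-adj-sym (suc (suc (suc zero))) zero = refl
K5P4-adj-sym (suc (suc (suc zero))) (suc zero) = refl
K5P4-adj-sym (suc (suc (suc zero))) (suc (suc zero)) = refl
K5P4-adj-sym (suc (suc (suc zero))) (suc (suc (suc zero))) = refl
K5P4-adj-sym (suc (suc (suc zero))) (suc (suc (suc (suc zero)))) = refl
K5P4-adj-sym (suc (suc (suc (suc zero)))) zero = refl
K5P4-adj-sym (suc (suc (suc (suc zero)))) (suc zero) = refl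
K5P4-adj-sym (suc (suc (suc (suc zero)))) (suc (suc zero)) = refl
K5P4-adj-sym (suc (suc (suc (suc zero)))) (suc (suc (suc zero))) = refl
K5P4-adj-sym (suc (suc (suc (suc zero)))) (suc (suc (suc (suc zero)))) = refl

K5P4-irrefl : ∀ a → K5P4-adj a a ≡ false
K5P4-irrefl zero = refl
K5P4-irrefl (suc zero) = refl
K5P4-irrefl (suc (suc zero)) = refl
K5P4-irrefl (suc (suc (suc zero))) = refl
K5P4-irrefl (suc (suc (suc (suc zero)))) = refl

K5-P4 : Graph 5
K5-P4 = record { adj = K5P4-adj ; adj-sym = K5P4-adj-sym ; irrefl = K5P4-irrefl }

-- K₅ − P₄ is the house: an edge uv, a common neighbour w, and a path u x y v.
--
-- Sufficiency when d₃ ≥ 3 is by induction on the number of non-isolated vertices. Let z have minimum positive degree.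
-- By switching, we may assume that z is joined to vertices of largest degree. Unless the sequence is (3³,2ˢ,1ʳ),
-- (3⁴,2ˢ), (d₁,3²,2ˢ) or (3⁶), isolating z leaves three vertices of degree ≥ 3 and five of degree ≥ 2, so the remaining
-- degrees are realized with a house, which avoids z, and the edges at z can be put back. The exceptional families are
-- built by hand, and graphs on five vertices are checked exhaustively.
--
-- When d₃ ≤ 2 the sequence is (a,b,2ˢ,1ʳ). In any realization, counting edges between the two large vertices and the
-- rest gives a + b ≤ 2s + r + 2, with equality exactly in (4) by parity; a = n − 1 is (3); otherwise the residual
-- sequence (a−3,b−3,2ˢ⁻³,1ʳ) is attached to a house greedily, which only fails in (5).
--
-- Necessity of (3) to (5): the edge xy avoids both large vertices, which makes that count strict; if d₁ = n − 1 then x or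
-- y gets a third neighbour; and in (5) the house is a component, so the other n − 5 ≤ 2 vertices cannot have degree 2.
module Submission where

open import Defs
open import Data.Bool using (Bool; true; false; not; _∧_; _∨_; _xor_; if_then_else_; T)
import Data.Bool as Bool
open import Data.Bool.Properties using (∨-comm; ∧-comm; ∨-identityʳ; ∧-zeroʳ; ∨-zeroʳ; ∧-identityʳ; xor-identityʳ)
open import Data.Empty using (⊥; ⊥-elim)
open import Data.Fin using (Fin; zero; suc; toℕ; _≟_; #_; fromℕ<)
open import Data.Fin.Properties using (any?; pigeonhole; toℕ-injective; fromℕ<-injective)
import Data.Fin as Fin
import Data.Nat as ℕ
open import Data.Nat.DivMod using (m≡m%n+[m/n]*n; m*n/n≡m; /-monoˡ-≤)
open import Data.List using (List; []; _∷_; _++_; replicate; map; tabulate; length)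
open import Data.List.Properties using (length-++; length-replicate; length-map; map-tabulate; ∷-injective)
open import Data.Nat using (ℕ; zero; suc; _+_; _*_; _∸_; _≤_; _<_; _/_; _%_; z≤n; s≤s; _≤?_)
open import Data.Nat.Properties hiding (_≟_)
open import Algebra.Properties.CommutativeMonoid.Sum +-0-commutativeMonoid using (sum-cong-≗; ∑-distrib-+) renaming (sum to ∑)
open import Data.Nat.ListAction using (sum)
open import Data.Nat.Tactic.RingSolver using (solve; solve-∀)
open import Data.Product using (Σ; ∃; _×_; _,_; proj₁; proj₂)
open import Data.Sum using (_⊎_; inj₁; inj₂)
open import Data.List.Relation.Unary.All as All using (All)
import Data.List.Relation.Unary.AllPairs as AllPairs
open import Data.List.Relation.Unary.Unique.Propositional using (Unique)
import Data.Vec as Vec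
import Data.Vec.Relation.Unary.Unique.Propositional.Properties as VecUnique
import Data.Vec.Relation.Unary.All as VecAll
import Data.Vec.Relation.Unary.AllPairs as VecPairs
open import Data.Vec using (Vec; lookup; toList)
open import Function.Base using (_∘_)
open import Function.Bundles using (_⇔_; mk⇔)
open import Relation.Binary.PropositionalEquality using (_≡_; _≢_; refl; sym; trans; cong; cong₂; subst; subst₂; module ≡-Reasoning)
open import Relation.Nullary using (¬_; Dec; yes; no; does; contradiction)
open import Relation.Nullary.Decidable using (dec-true; dec-false; _×-dec_; ¬?)

-- The house need not lie in the given realization, only in some graph with the same degrees.
-- Degrees are therefore carried as functions on a fixed vertex set, and a vertex is isolated rather
-- than deleted.
--
-- Let p and q count the degrees at least 3 and at least 4, and let z have degree δ. Isolating z
-- costs a place in p only for neighbours of degree exactly 3, and for z itself if δ = 3. If such a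
-- neighbour exists, all q larger vertices are neighbours of z as well, so at most δ - q places are
-- lost in this way. Three places survive once p + q is at least 3 + δ, plus 1 if δ = 3. These are
-- the thresholds 4, 5, 7 for δ = 1, 2, 3, and on at least six vertices the exceptional families are
-- the sequences below them.
--
-- The obstacle in extending a house is a surplus of vertices of degree 2. They can subdivide an
-- edge outside the house, but a bare house has no such edge, and one or two vertices do not make a
-- triangle of their own: this is (5). The flag of `Housed` records whether such an edge is at hand.

-- Sums over Fin n and multisets of vertices

-- Certificate form of linear arithmetic over ℕ: `X ≤ Y` is the sum of the hypotheses used, built
-- with `_⊹_`, `k` is the slack, and the ring solver checks the identity that remains.
lin : ∀ {p q X Y} k → X ≤ Y → p + Y + k ≡ q + X → p ≤ q
lin {p} {q} {X} {Y} k h e =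
  +-cancelʳ-≤ Y p q (≤-trans (≤-trans (m≤m+n (p + Y) k) (≤-reflexive e)) (+-monoʳ-≤ q h))

infixr 5 _⊹_
_⊹_ : ∀ {a b c d} → a ≤ b → c ≤ d → a + c ≤ b + d
_⊹_ = +-mono-≤

𝟙 : Bool → ℕ
𝟙 b = if b then 1 else 0

infix 4 _==_
_==_ : ∀ {n} → Fin n → Fin n → Bool
i == j = does (i ≟ j)

==-refl : ∀ {n} (i : Fin n) → (i == i) ≡ true
==-refl i = dec-true (i ≟ i) refl

==-≢ : ∀ {n} {i j : Fin n} → i ≢ j → (i == j) ≡ false
==-≢ {i = i} {j} = dec-false (i ≟ j)

δ : ∀ {n} → Fin n → Fin n → ℕ
δ i j = 𝟙 (i == j)

δ-refl : ∀ {n} (i : Fin n) → δ i i ≡ 1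
δ-refl i = cong 𝟙 (==-refl i)

δ-≢ : ∀ {n} {i j : Fin n} → i ≢ j → δ i j ≡ 0
δ-≢ p = cong 𝟙 (==-≢ p)

∑-mono : ∀ {n} {f g : Fin n → ℕ} → (∀ i → f i ≤ g i) → ∑ f ≤ ∑ g
∑-mono {zero} h = z≤n
∑-mono {suc n} h = +-mono-≤ (h zero) (∑-mono (h ∘ suc))

∑-0 : ∀ {n} {f : Fin n → ℕ} → (∀ i → f i ≡ 0) → ∑ f ≡ 0
∑-0 {zero} h = refl
∑-0 {suc n} h = cong₂ _+_ (h zero) (∑-0 (h ∘ suc))

∑-δ* : ∀ {n} (i : Fin n) (f : Fin n → ℕ) → ∑ (λ j → δ i j * f j) ≡ f i
∑-δ* zero f = trans (cong₂ _+_ (+-identityʳ (f zero)) (∑-0 {f = λ j → δ zero (suc j) * f (suc j)} λ _ → refl)) (+-identityʳ (f zero))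
∑-δ* (suc i) f = ∑-δ* i (f ∘ suc)

∑-δ : ∀ {n} (i : Fin n) → ∑ (δ i) ≡ 1
∑-δ i = trans (sum-cong-≗ λ j → sym (*-identityʳ (δ i j))) (∑-δ* i (λ _ → 1))

∑-*ˡ : ∀ {n} c (f : Fin n → ℕ) → ∑ (λ j → c * f j) ≡ c * ∑ f
∑-*ˡ {zero} c f = sym (*-zeroʳ c)
∑-*ˡ {suc n} c f = trans (cong (c * f zero +_) (∑-*ˡ c (f ∘ suc))) (sym (*-distribˡ-+ c (f zero) _))

∑-*ʳ : ∀ {n} c (f : Fin n → ℕ) → ∑ (λ j → f j * c) ≡ ∑ f * c
∑-*ʳ c f = trans (sum-cong-≗ λ j → *-comm (f j) c) (trans (∑-*ˡ c f) (*-comm c (∑ f)))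

≤-∑ : ∀ {n} (f : Fin n → ℕ) i → f i ≤ ∑ f
≤-∑ f zero = m≤m+n _ _
≤-∑ f (suc i) = ≤-trans (≤-∑ (f ∘ suc) i) (m≤n+m _ _)

∑>0⇒∃ : ∀ {n} (f : Fin n → ℕ) → 1 ≤ ∑ f → ∃ λ i → 1 ≤ f i
∑>0⇒∃ {suc n} f h with f zero in eq
... | suc k = zero , subst (1 ≤_) (sym eq) (s≤s z≤n)
... | zero with ∑>0⇒∃ (f ∘ suc) h
...   | i , p = suc i , p

∑-+≤ : ∀ {n} {f g h : Fin n → ℕ} → (∀ i → f i + g i ≤ h i) → ∑ f + ∑ g ≤ ∑ h
∑-+≤ {f = f} {g} p = subst (_≤ _) (∑-distrib-+ f g) (∑-mono p)

∑-≤+ : ∀ {n} {f g h : Fin n → ℕ} → (∀ i → h i ≤ f i + g i) → ∑ h ≤ ∑ f + ∑ g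
∑-≤+ {f = f} {g} p = subst (_ ≤_) (∑-distrib-+ f g) (∑-mono p)

∑-≡+ : ∀ {n} {f g h : Fin n → ℕ} → (∀ i → h i ≡ f i + g i) → ∑ h ≡ ∑ f + ∑ g
∑-≡+ {f = f} {g} p = trans (sum-cong-≗ p) (∑-distrib-+ f g)

-- Bounding a multiplicity function by 1 expresses that a list is duplicate-free; bounding a sum of
-- such functions by 1 expresses that the lists are disjoint as well.
cnt : ∀ {n} → List (Fin n) → Fin n → ℕ
cnt [] x = 0
cnt (l ∷ L) x = δ l x + cnt L x

cnt-map-suc : ∀ {n} (L : List (Fin n)) x → cnt (map suc L) (suc x) ≡ cnt L x
cnt-map-suc [] x = refl
cnt-map-suc (l ∷ L) x = cong (δ l x +_) (cnt-map-suc L x)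

cnt-map-suc-zero : ∀ {n} (L : List (Fin n)) → cnt (map suc L) zero ≡ 0
cnt-map-suc-zero [] = refl
cnt-map-suc-zero (l ∷ L) = cnt-map-suc-zero L

private
  prepend : ∀ {n} k (L : List (Fin (suc n))) → List (Fin (suc n))
  prepend k L = replicate k zero ++ L

  cnt-prepend-zero : ∀ {n} k (L : List (Fin (suc n))) → cnt (prepend k L) zero ≡ k + cnt L zero
  cnt-prepend-zero zero L = refl
  cnt-prepend-zero (suc k) L = cong suc (cnt-prepend-zero k L)

  cnt-prepend-suc : ∀ {n} k (L : List (Fin (suc n))) x → cnt (prepend k L) (suc x) ≡ cnt L (suc x)
  cnt-prepend-suc zero L x = refl
  cnt-prepend-suc (suc k) L x = cnt-prepend-suc k L x

-- Turns a counting function into named vertices: for the indicator of a degree it lists the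
-- vertices of that degree, so that a known count can be pattern matched.
listing : ∀ {n} (e : Fin n → ℕ) → Σ (List (Fin n)) λ L → (∀ x → cnt L x ≡ e x) × length L ≡ ∑ e
listing {zero} e = [] , (λ ()) , refl
listing {suc n} e with listing (e ∘ suc)
... | L , c , l = prepend (e zero) (map suc L) , mult ,
    trans (length-++ (replicate (e zero) zero)) (cong₂ _+_ (length-replicate (e zero)) (trans (length-map suc L) l))
  where
  mult : ∀ x → cnt (prepend (e zero) (map suc L)) x ≡ e x
  mult zero = trans (cnt-prepend-zero (e zero) (map suc L)) (trans (cong (e zero +_) (cnt-map-suc-zero L)) (+-identityʳ _))
  mult (suc x) = trans (cnt-prepend-suc (e zero) (map suc L) x) (trans (cnt-map-suc L x) (c x))

data Even : ℕ → Set where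
  even-0 : Even 0
  even-2+ : ∀ {n} → Even n → Even (2 + n)

even-+ : ∀ {a b} → Even a → Even b → Even (a + b)
even-+ even-0 e = e
even-+ (even-2+ p) e = even-2+ (even-+ p e)

even-dbl : ∀ m → Even (m + m)
even-dbl zero = even-0
even-dbl (suc m) = subst Even (cong suc (sym (+-suc m m))) (even-2+ (even-dbl m))

-- Degree sums are brought to the form `m + m + k`, so that the handshake lemma yields the parity of
-- the part `k` of interest.
even-cancel : ∀ m {k} → Even (m + m + k) → Even k
even-cancel zero e = e
even-cancel (suc m) {k} e rewrite +-suc m m with e
... | even-2+ e′ = even-cancel m e′

¬even-suc : ∀ {m} → Even m → ¬ Even (suc m)
¬even-suc (even-2+ e) (even-2+ e′) = ¬even-suc e e′

even-pred² : ∀ {m} → Even (2 + m) → Even m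
even-pred² (even-2+ e) = e

even-≡ : ∀ {m k} → Even m → m ≡ k → Even k
even-≡ e refl = e

-- Operations on graphs

sum-tabulate : ∀ {n} (h : Fin n → ℕ) → sum (tabulate h) ≡ ∑ h
sum-tabulate {zero} h = refl
sum-tabulate {suc n} h = cong (h zero +_) (sum-tabulate (h ∘ suc))

row : ∀ {n} → Graph n → Fin n → Fin n → ℕ
row G i j = 𝟙 (adj G i j)

deg : ∀ {n} → Graph n → Fin n → ℕ
deg G i = ∑ (row G i)

degree≡deg : ∀ {n} (G : Graph n) i → degree G i ≡ deg G i
degree≡deg G i = trans (cong sum (map-tabulate (λ j → j) (row G i))) (sum-tabulate (row G i))

row-sym : ∀ {n} (G : Graph n) i j → row G i j ≡ row G j i
row-sym G i j = cong 𝟙 (adj-sym G i j)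

row-irrefl : ∀ {n} (G : Graph n) i → row G i i ≡ 0
row-irrefl G i = cong 𝟙 (irrefl G i)

𝟙≤1 : ∀ b → 𝟙 b ≤ 1
𝟙≤1 true = ≤-refl
𝟙≤1 false = z≤n

𝟙>0 : ∀ {b} → 1 ≤ 𝟙 b → b ≡ true
𝟙>0 {true} _ = refl

𝟙≡0 : ∀ {b} → 𝟙 b ≡ 0 → b ≡ false
𝟙≡0 {false} _ = refl

adj⇒≢ : ∀ {n} (G : Graph n) {i j} → adj G i j ≡ true → i ≢ j
adj⇒≢ G {i} a refl with trans (sym a) (irrefl G i)
... | ()

adj⇒deg>0 : ∀ {n} (G : Graph n) {i j} → adj G i j ≡ true → 1 ≤ deg G i
adj⇒deg>0 G {i} {j} a = ≤-trans (≤-reflexive (sym (cong 𝟙 a))) (≤-∑ (row G i) j)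

isolated : ∀ {n} (G : Graph n) {z} → deg G z ≡ 0 → ∀ x → adj G z x ≡ false
isolated G {z} e x = 𝟙≡0 (n≤0⇒n≡0 (≤-trans (≤-∑ (row G z) x) (≤-reflexive e)))

-- Removing the first row and column of a symmetric matrix with zero diagonal removes `r` twice and
-- leaves a smaller matrix of the same kind.
symmetric-sum-even : ∀ {n} (M : Fin n → Fin n → ℕ) → (∀ i j → M i j ≡ M j i) → (∀ i → M i i ≡ 0) →
  Even (∑ λ i → ∑ (M i))
symmetric-sum-even {zero} M s d = even-0
symmetric-sum-even {suc n} M s d =
  even-≡ (even-+ (even-dbl r) (symmetric-sum-even (λ i j → M (suc i) (suc j)) (λ i j → s (suc i) (suc j)) (d ∘ suc))) (sym eq)
  where
  r = ∑ (λ j → M zero (suc j))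
  R = ∑ (λ i → ∑ (λ j → M (suc i) (suc j)))
  eq : ∑ (λ i → ∑ (M i)) ≡ r + r + R
  eq = begin
    M zero zero + r + ∑ (λ i → M (suc i) zero + ∑ (λ j → M (suc i) (suc j)))
      ≡⟨ cong₂ _+_ (cong (_+ r) (d zero)) (∑-≡+ {f = λ i → M zero (suc i)} λ i → cong (_+ ∑ (λ j → M (suc i) (suc j))) (s (suc i) zero)) ⟩
    r + (r + R) ≡⟨ sym (+-assoc r r R) ⟩
    r + r + R ∎
    where open ≡-Reasoning

handshake : ∀ {n} (G : Graph n) → Even (∑ (deg G))
handshake G = symmetric-sum-even (row G) (row-sym G) (row-irrefl G)

join : ∀ {n} (G : Graph n) (z : Fin n) (S : Fin n → Bool) → S z ≡ false → Graph n
adj (join G z S _) i j = adj G i j ∨ ((z == i) ∧ S j) ∨ ((z == j) ∧ S i)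
adj-sym (join G z S _) i j = cong₂ _∨_ (adj-sym G i j) (∨-comm ((z == i) ∧ S j) _)
irrefl (join G z S Sz) i with z ≟ i
... | no _ rewrite irrefl G i = refl
... | yes refl rewrite irrefl G i | Sz = refl

module _ {n} (G : Graph n) (z : Fin n) (S : Fin n → Bool) (Sz : S z ≡ false) where
  join-mono : ∀ {i j} → adj G i j ≡ true → adj (join G z S Sz) i j ≡ true
  join-mono {i} {j} a rewrite a = refl

  join-new : ∀ {x} → S x ≡ true → adj (join G z S Sz) z x ≡ true
  join-new {x} Sx rewrite ==-refl z | Sx = ∨-zeroʳ (adj G z x)

  join-new′ : ∀ {x} → S x ≡ true → adj (join G z S Sz) x z ≡ true
  join-new′ {x} Sx = trans (adj-sym (join G z S Sz) x z) (join-new Sx)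

  -- Since `z` is isolated beforehand, the disjunction in `join` never meets an existing edge and
  -- the increments are exact; the product term is the new degree of `z` itself.
  deg-join : deg G z ≡ 0 → ∀ j → deg (join G z S Sz) j ≡ deg G j + 𝟙 (S j) + δ z j * ∑ (𝟙 ∘ S)
  deg-join dz j with z ≟ j
  ... | yes refl rewrite dz | Sz = trans (sum-cong-≗ pt) (sym (+-identityʳ (∑ (𝟙 ∘ S))))
    where
    pt : ∀ x → 𝟙 (adj G z x ∨ S x ∨ ((z == x) ∧ false)) ≡ 𝟙 (S x)
    pt x rewrite isolated G dz x | ∧-zeroʳ (z == x) = cong 𝟙 (∨-identityʳ (S x))
  ... | no _ = trans (∑-≡+ {f = row G j} {g = λ x → δ z x * 𝟙 (S j)} pt)
                 (trans (cong (deg G j +_) (trans (∑-*ʳ (𝟙 (S j)) (δ z)) (trans (cong (_* 𝟙 (S j)) (∑-δ z)) (+-identityʳ _))))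
                        (sym (+-identityʳ _)))
    where
    pt : ∀ x → 𝟙 (adj G j x ∨ ((z == x) ∧ S j)) ≡ row G j x + δ z x * 𝟙 (S j)
    pt x with z ≟ x
    ... | yes refl rewrite trans (adj-sym G j z) (isolated G dz j) = sym (+-identityʳ _)
    ... | no _ = trans (cong 𝟙 (∨-identityʳ (adj G j x))) (sym (+-identityʳ _))

-- The vertex stays in `Fin n`, so the degree functions before and after have the same type and
-- `join` can put the edges back.
isolate : ∀ {n} → Graph n → Fin n → Graph n
adj (isolate G z) i j = adj G i j ∧ (not (z == i) ∧ not (z == j))
adj-sym (isolate G z) i j = cong₂ _∧_ (adj-sym G i j) (∧-comm (not (z == i)) _)
irrefl (isolate G z) i rewrite irrefl G i = refl

deg-isolate-self : ∀ {n} (G : Graph n) z → deg (isolate G z) z ≡ 0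
deg-isolate-self G z = ∑-0 λ x → cong 𝟙 (trans (cong (λ b → adj G z x ∧ (not b ∧ not (z == x))) (==-refl z)) (∧-zeroʳ (adj G z x)))

deg-isolate : ∀ {n} (G : Graph n) z {j} → z ≢ j → deg G j ≡ deg (isolate G z) j + row G z j
deg-isolate G z {j} z≢j =
  trans (∑-≡+ {f = row (isolate G z) j} {g = λ x → δ z x * row G z j} pt)
        (cong (deg (isolate G z) j +_) (trans (∑-*ʳ (row G z j) (δ z)) (trans (cong (_* row G z j) (∑-δ z)) (+-identityʳ _))))
  where
  pt : ∀ x → row G j x ≡ 𝟙 (adj G j x ∧ (not (z == j) ∧ not (z == x))) + δ z x * row G z j
  pt x rewrite ==-≢ z≢j with z ≟ x
  ... | yes refl rewrite ∧-zeroʳ (adj G j z) = trans (row-sym G j z) (sym (+-identityʳ _))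
  ... | no _ rewrite ∧-identityʳ (adj G j x) = sym (+-identityʳ _)

isPair : ∀ {n} → Fin n → Fin n → Fin n → Fin n → Bool
isPair p q i j = ((p == i) ∧ (q == j)) ∨ ((q == i) ∧ (p == j))

-- Exclusive or makes one operation serve for adding and removing an edge: toggling twice is the
-- identity, so the facts about removal follow from those about addition.
toggle : ∀ {n} → Graph n → (p q : Fin n) → p ≢ q → Graph n
adj (toggle G p q _) i j = adj G i j xor isPair p q i j
adj-sym (toggle G p q _) i j = cong₂ _xor_ (adj-sym G i j)
  (trans (∨-comm ((p == i) ∧ (q == j)) _) (cong₂ _∨_ (∧-comm (q == i) _) (∧-comm (p == i) _)))
irrefl (toggle G p q p≢q) i rewrite irrefl G i with p ≟ i | q ≟ i
... | yes refl | yes refl = ⊥-elim (p≢q refl)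
... | yes _ | no _ = refl
... | no _ | yes _ = refl
... | no _ | no _ = refl

module _ {n} (G : Graph n) {p q : Fin n} (p≢q : p ≢ q) where
  private G′ = toggle G p q p≢q

  toggle-other : ∀ {i j} → isPair p q i j ≡ false → adj G′ i j ≡ adj G i j
  toggle-other {i} {j} e rewrite e with adj G i j
  ... | true = refl
  ... | false = refl

  isPair-self : isPair p q p q ≡ true
  isPair-self rewrite ==-refl p | ==-refl q = refl

  isPair⇒ : ∀ i j → isPair p q i j ≡ true → (p ≡ i × q ≡ j) ⊎ (q ≡ i × p ≡ j)
  isPair⇒ i j e with p ≟ i | q ≟ j | q ≟ i | p ≟ j
  ... | yes a | yes b | _ | _ = inj₁ (a , b)
  ... | yes _ | no _ | yes a | yes b = inj₂ (a , b)
  ... | no _ | _ | yes a | yes b = inj₂ (a , b)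
  ... | yes _ | no _ | yes _ | no _ = contradiction e λ ()
  ... | yes _ | no _ | no _ | _ = contradiction e λ ()
  ... | no _ | _ | yes _ | no _ = contradiction e λ ()
  ... | no _ | _ | no _ | _ = contradiction e λ ()

  row-add : adj G p q ≡ false → ∀ i j → row G′ i j ≡ row G i j + (δ p i * δ q j + δ q i * δ p j)
  row-add e i j with p ≟ i | q ≟ j | q ≟ i | p ≟ j
  ... | yes refl | _ | yes refl | _ = ⊥-elim (p≢q refl)
  ... | _ | yes refl | _ | yes refl = ⊥-elim (p≢q refl)
  ... | yes refl | yes refl | no _ | no _ rewrite e = refl
  ... | yes refl | no _ | no _ | _ rewrite +-identityʳ (𝟙 (adj G p j)) = cong 𝟙 (xor-identityʳ (adj G p j))
  ... | no _ | _ | yes refl | yes refl rewrite trans (adj-sym G q p) e = refl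
  ... | no _ | _ | yes refl | no _ rewrite +-identityʳ (𝟙 (adj G q j)) = cong 𝟙 (xor-identityʳ (adj G q j))
  ... | no _ | _ | no _ | _ rewrite +-identityʳ (𝟙 (adj G i j)) = cong 𝟙 (xor-identityʳ (adj G i j))

  deg-add : adj G p q ≡ false → ∀ i → deg G′ i ≡ deg G i + (δ p i + δ q i)
  deg-add e i = trans (∑-≡+ (row-add e i)) (cong (deg G i +_)
    (trans (∑-≡+ {f = λ j → δ p i * δ q j} {g = λ j → δ q i * δ p j} (λ _ → refl)) (cong₂ _+_ (once (δ p i) q) (once (δ q i) p))))
    where
    once : ∀ c x → ∑ (λ j → c * δ x j) ≡ c
    once c x = trans (∑-*ˡ c (δ x)) (trans (cong (c *_) (∑-δ x)) (*-identityʳ c))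

toggle² : ∀ {n} (G : Graph n) {p q} (p≢q : p ≢ q) i j → adj (toggle (toggle G p q p≢q) p q p≢q) i j ≡ adj G i j
toggle² G {p} {q} p≢q i j with adj G i j | isPair p q i j
... | true | true = refl
... | true | false = refl
... | false | true = refl
... | false | false = refl

module _ {n} (G : Graph n) {p q : Fin n} (p≢q : p ≢ q) (e : adj G p q ≡ true) where
  private
    G′ = toggle G p q p≢q

    removed : adj G′ p q ≡ false
    removed rewrite e | isPair-self G p≢q = refl

  row-remove : ∀ i j → row G i j ≡ row G′ i j + (δ p i * δ q j + δ q i * δ p j)
  row-remove i j = trans (cong 𝟙 (sym (toggle² G p≢q i j))) (row-add G′ p≢q removed i j)

  deg-remove : ∀ i → deg G i ≡ deg G′ i + (δ p i + δ q i)
  deg-remove i = trans (sum-cong-≗ λ j → cong 𝟙 (sym (toggle² G p≢q i j))) (deg-add G′ p≢q removed i)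

-- Switching towards neighbours of large degree

isPair-≢ : ∀ {n} {p q i j : Fin n} → p ≢ i ⊎ q ≢ j → q ≢ i ⊎ p ≢ j → isPair p q i j ≡ false
isPair-≢ s t = cong₂ _∨_ (part s) (part t)
  where
  part : ∀ {n} {p q i j : Fin n} → p ≢ i ⊎ q ≢ j → ((p == i) ∧ (q == j)) ≡ false
  part (inj₁ h) rewrite ==-≢ h = refl
  part {p = p} {i = i} (inj₂ h) rewrite ==-≢ h = ∧-zeroʳ (p == i)

-- The 2-switch that replaces the edges `zb` and `ac` by `za` and `bc`. All degrees stay, and in the
-- neighbourhood of `z` the vertex `b` gives way to `a`.
module Switch {n} (G : Graph n) {z b a c : Fin n} (zb : adj G z b ≡ true) (ac : adj G a c ≡ true)
  (za : adj G z a ≡ false) (bc : adj G b c ≡ false) (z≢a : z ≢ a) (b≢c : b ≢ c) where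

  private
    z≢b = adj⇒≢ G zb
    a≢c = adj⇒≢ G ac

    b≢a : b ≢ a
    b≢a refl = contradiction (trans (sym zb) za) λ ()

    z≢c : z ≢ c
    z≢c refl = contradiction (trans (sym ac) (trans (adj-sym G a c) za)) λ ()

    G₁ = toggle G z b z≢b
    G₂ = toggle G₁ a c a≢c
    G₃ = toggle G₂ z a z≢a

    e₂ : adj G₁ a c ≡ true
    e₂ = trans (toggle-other G z≢b (isPair-≢ (inj₁ z≢a) (inj₁ b≢a))) ac

    e₃ : adj G₂ z a ≡ false
    e₃ = trans (toggle-other G₁ a≢c (isPair-≢ (inj₁ (z≢a ∘ sym)) (inj₁ (z≢c ∘ sym))))
           (trans (toggle-other G z≢b (isPair-≢ {p = z} (inj₂ b≢a) (inj₁ (z≢b ∘ sym)))) za)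

    e₄ : adj G₃ b c ≡ false
    e₄ = trans (toggle-other G₂ z≢a (isPair-≢ (inj₁ z≢b) (inj₁ (b≢a ∘ sym))))
           (trans (toggle-other G₁ a≢c (isPair-≢ (inj₁ (b≢a ∘ sym)) (inj₁ (b≢c ∘ sym))))
             (trans (toggle-other G z≢b (isPair-≢ {q = b} (inj₁ z≢b) (inj₂ z≢c))) bc))

  switched : Graph n
  switched = toggle G₃ b c b≢c

  switched-deg : ∀ i → deg switched i ≡ deg G i
  switched-deg i = trans (deg-add G₃ b≢c e₄ i) (trans (cong (_+ (δ b i + δ c i)) (deg-add G₂ z≢a e₃ i))
    (trans (shuffle (deg G₂ i) (δ z i) (δ b i) (δ a i) (δ c i))
      (sym (trans (deg-remove G z≢b zb i) (cong (_+ (δ z i + δ b i)) (deg-remove G₁ a≢c e₂ i))))))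
    where
    shuffle : ∀ d x y u v → d + (x + u) + (y + v) ≡ d + (u + v) + (x + y)
    shuffle = solve-∀

  switched-row : ∀ x → row switched z x + δ b x ≡ row G z x + δ a x
  switched-row x = begin
    row switched z x + δ b x ≡⟨ cong (_+ δ b x) (unaffected {p = b} {c} (row-add G₃ b≢c e₄ z x) (z≢b ∘ sym) (z≢c ∘ sym)) ⟩
    row G₃ z x + δ b x ≡⟨ cong (_+ δ b x) (affected {q = a} (row-add G₂ z≢a e₃ z x) (z≢a ∘ sym)) ⟩
    row G₂ z x + δ a x + δ b x ≡⟨ swap (row G₂ z x) (δ a x) (δ b x) ⟩
    row G₂ z x + δ b x + δ a x ≡⟨ cong (λ r → r + δ b x + δ a x) (sym (unaffected {p = a} {c} (row-remove G₁ a≢c e₂ z x) (z≢a ∘ sym) (z≢c ∘ sym))) ⟩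
    row G₁ z x + δ b x + δ a x ≡⟨ cong (_+ δ a x) (sym (affected {q = b} (row-remove G z≢b zb z x) (z≢b ∘ sym))) ⟩
    row G z x + δ a x ∎
    where
    open ≡-Reasoning
    swap : ∀ r s t → r + s + t ≡ r + t + s
    swap = solve-∀
    unaffected : ∀ {r s p q} → r ≡ s + (δ p z * δ q x + δ q z * δ p x) → p ≢ z → q ≢ z → r ≡ s
    unaffected {s = s} e p≢ q≢ rewrite δ-≢ p≢ | δ-≢ q≢ = trans e (+-identityʳ s)
    affected : ∀ {r s q} → r ≡ s + (δ z z * δ q x + δ q z * δ z x) → q ≢ z → r ≡ s + δ q x
    affected {s = s} {q} e q≢ rewrite δ-≢ q≢ | δ-refl z | +-identityʳ (δ q x) = trans e (cong (s +_) (+-identityʳ (δ q x)))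

TopClosed : ∀ {n} → Graph n → Fin n → Set
TopClosed G z = ∀ a b → adj G z b ≡ true → adj G z a ≡ false → z ≢ a → deg G a ≤ deg G b

-- Otherwise N(a) would lie in N(b) together with `b`; since `z` is in N(b) but not in N(a),
-- counting would give deg a ≤ deg b.
private-neighbour : ∀ {n} (G : Graph n) {z b a} → adj G z b ≡ true → adj G z a ≡ false → deg G b < deg G a →
  ∃ λ c → adj G a c ≡ true × adj G b c ≡ false × b ≢ c
private-neighbour G {z} {b} {a} zb za lt with any? (λ c → (adj G a c Bool.≟ true) ×-dec (adj G b c Bool.≟ false) ×-dec ¬? (b ≟ c))
... | yes found = found
... | no none = contradiction lt (≤⇒≯ (+-cancelʳ-≤ 1 _ _ bound))
  where
  pt : ∀ x → row G a x + δ z x ≤ row G b x + δ b x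
  pt x with z ≟ x
  ... | yes refl rewrite adj-sym G a z | za | adj-sym G b z | zb = s≤s z≤n
  ... | no _ with adj G a x in ax
  ...   | false = z≤n
  ...   | true with adj G b x in bx
  ...     | true = s≤s z≤n
  ...     | false with b ≟ x
  ...       | yes _ = ≤-refl
  ...       | no b≢x = ⊥-elim (none (x , ax , bx , b≢x))
  bound : deg G a + 1 ≤ deg G b + 1
  bound = subst₂ (λ s t → deg G a + s ≤ deg G b + t) (∑-δ z) (∑-δ b)
    (≤-trans (∑-+≤ pt) (≤-reflexive (∑-distrib-+ (row G b) (δ b))))

-- Each switch towards a vertex of larger degree increases the degree sum over the neighbourhood of z.
topClosed-realization : ∀ {n} (G : Graph n) z → Σ (Graph n) λ G′ → (∀ i → deg G′ i ≡ deg G i) × TopClosed G′ z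
topClosed-realization {n} G₀ z = go (∑ d) G₀ (λ _ → refl) (m≤m+n _ _)
  where
  d = deg G₀
  weight : Graph n → ℕ
  weight G = ∑ λ x → row G z x * d x
  weight≤ : ∀ G → weight G ≤ ∑ d
  weight≤ G = ∑-mono λ x → ≤-trans (*-monoˡ-≤ (d x) (𝟙≤1 (adj G z x))) (≤-reflexive (+-identityʳ (d x)))
  go : ∀ k G → (∀ i → deg G i ≡ d i) → ∑ d ≤ k + weight G → Σ (Graph n) λ G′ → (∀ i → deg G′ i ≡ d i) × TopClosed G′ z
  go k G same h with any? (λ a → any? (λ b → (adj G z b Bool.≟ true) ×-dec (adj G z a Bool.≟ false) ×-dec ¬? (z ≟ a) ×-dec (suc (deg G b) ≤? deg G a)))
  ... | no none = G , same , λ a b zb za z≢a → ≮⇒≥ λ lt → none (a , b , zb , za , z≢a , lt)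
  ... | yes (a , b , zb , za , z≢a , lt) with private-neighbour G zb za lt
  ...   | c , ac , bc , b≢c = next k h
    where
    open Switch G zb ac za bc z≢a b≢c
    heavier : weight switched + d b ≡ weight G + d a
    heavier = begin
      weight switched + d b ≡⟨ cong (weight switched +_) (sym (∑-δ* b d)) ⟩
      weight switched + ∑ (λ x → δ b x * d x) ≡⟨ sym (∑-distrib-+ (λ x → row switched z x * d x) (λ x → δ b x * d x)) ⟩
      ∑ (λ x → row switched z x * d x + δ b x * d x) ≡⟨ sum-cong-≗ (λ x → trans (sym (*-distribʳ-+ (d x) (row switched z x) (δ b x)))
          (trans (cong (_* d x) (switched-row x)) (*-distribʳ-+ (d x) (row G z x) (δ a x)))) ⟩
      ∑ (λ x → row G z x * d x + δ a x * d x) ≡⟨ ∑-distrib-+ (λ x → row G z x * d x) (λ x → δ a x * d x) ⟩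
      weight G + ∑ (λ x → δ a x * d x) ≡⟨ cong (weight G +_) (∑-δ* a d) ⟩
      weight G + d a ∎
      where open ≡-Reasoning
    increase : suc (weight G) ≤ weight switched
    increase = arith (weight G) (weight switched) (d a) (d b) heavier (subst₂ (λ s t → suc s ≤ t) (same b) (same a) lt)
      where
      arith : ∀ w w′ x y → w′ + y ≡ w + x → suc y ≤ x → suc w ≤ w′
      arith w w′ x y e l = lin 0 (l ⊹ ≤-reflexive (sym e)) (solve (w ∷ w′ ∷ x ∷ y ∷ []))
    next : ∀ k → ∑ d ≤ k + weight G → Σ (Graph n) λ G′ → (∀ i → deg G′ i ≡ d i) × TopClosed G′ z
    -- With no fuel left the weight is already at its upper bound `∑ d`, which the switch would
    -- exceed.
    next zero h = contradiction (weight≤ switched) (<⇒≱ (≤-trans (s≤s h) increase))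
    next (suc k) h = go k switched (λ i → trans (switched-deg i) (same i))
      (≤-trans h (≤-trans (≤-reflexive (sym (+-suc k (weight G)))) (+-monoʳ-≤ k increase)))

-- The house and realizations that contain it

Unique₅ : ∀ {n} → Fin n → Fin n → Fin n → Fin n → Fin n → Set
Unique₅ u v w x y = Unique (u ∷ v ∷ w ∷ x ∷ y ∷ [])

module _ where
  open import Data.List.Relation.Unary.All using ([]; _∷_)
  open import Data.List.Relation.Unary.AllPairs using ([]; _∷_)
  open import Data.Vec using ([]; _∷_)
  open import Data.Vec.Relation.Unary.All using ([]; _∷_)
  open import Data.Vec.Relation.Unary.AllPairs using ([]; _∷_)

  cnt≡0⇒All≢ : ∀ {n} {l : Fin n} L → cnt L l ≡ 0 → All (l ≢_) L
  cnt≡0⇒All≢ [] _ = []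
  cnt≡0⇒All≢ {l = l} (k ∷ L) e = (λ l≡k → contradiction (trans (sym (δ-refl l)) (trans (cong (λ i → δ i l) l≡k) (m+n≡0⇒m≡0 (δ k l) e))) λ ())
    ∷ cnt≡0⇒All≢ L (m+n≡0⇒n≡0 (δ k l) e)

  cnt≤1⇒Unique : ∀ {n} (L : List (Fin n)) → (∀ j → cnt L j ≤ 1) → Unique L
  cnt≤1⇒Unique [] _ = []
  cnt≤1⇒Unique (l ∷ L) h =
    cnt≡0⇒All≢ L (n≤0⇒n≡0 (≤-pred (subst (λ k → k + cnt L l ≤ 1) (δ-refl l) (h l)))) ∷
    cnt≤1⇒Unique L λ j → ≤-trans (m≤n+m _ (δ l j)) (h j)

  -- Read from 0 to 4, the list is the deleted path `u y w x v`; what remains are the edges uv, uw,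
  -- vw, ux, xy and yv.
  houseVertices : ∀ {n} (u v w x y : Fin n) → Fin 5 → Fin n
  houseVertices u v w x y = Vec.lookup (u ∷ y ∷ w ∷ x ∷ v ∷ [])

  house : ∀ {n} (G : Graph n) {u v w x y} → Unique₅ u v w x y →
    adj G u v ≡ true → adj G u w ≡ true → adj G v w ≡ true → adj G u x ≡ true → adj G v y ≡ true → adj G x y ≡ true →
    K5-P4 ⊆G G
  house {n} G {u} {v} {w} {x} {y}
    ((u≢v ∷ u≢w ∷ u≢x ∷ u≢y ∷ []) ∷ (v≢w ∷ v≢x ∷ v≢y ∷ []) ∷ (w≢x ∷ w≢y ∷ []) ∷ (x≢y ∷ []) ∷ [] ∷ []) uv uw vw ux vy xy =
    f , (λ {i} {j} → VecUnique.lookup-injective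
      ((u≢y ∷ u≢w ∷ u≢x ∷ u≢v ∷ []) ∷ ((w≢y ∘ sym) ∷ (x≢y ∘ sym) ∷ (v≢y ∘ sym) ∷ []) ∷ (w≢x ∷ (v≢w ∘ sym) ∷ []) ∷ ((v≢x ∘ sym) ∷ []) ∷ [] ∷ []) i j) , edge
    where
    f = houseVertices u v w x y
    flip : ∀ {i j} → adj G i j ≡ true → adj G j i ≡ true
    flip {i} {j} a = trans (adj-sym G j i) a
    edge : ∀ a b → adj K5-P4 a b ≡ true → adj G (f a) (f b) ≡ true
    edge zero (suc (suc zero)) _ = uw
    edge zero (suc (suc (suc zero))) _ = ux
    edge zero (suc (suc (suc (suc zero)))) _ = uv
    edge (suc zero) (suc (suc (suc zero))) _ = flip xy
    edge (suc zero) (suc (suc (suc (suc zero)))) _ = flip vy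
    edge (suc (suc zero)) zero _ = flip uw
    edge (suc (suc zero)) (suc (suc (suc (suc zero)))) _ = flip vw
    edge (suc (suc (suc zero))) zero _ = flip ux
    edge (suc (suc (suc zero))) (suc zero) _ = xy
    edge (suc (suc (suc zero))) (suc (suc zero)) ()
    edge (suc (suc (suc zero))) (suc (suc (suc zero))) ()
    edge (suc (suc (suc zero))) (suc (suc (suc (suc zero)))) ()
    edge (suc (suc (suc (suc zero)))) zero _ = flip uv
    edge (suc (suc (suc (suc zero)))) (suc zero) _ = vy
    edge (suc (suc (suc (suc zero)))) (suc (suc zero)) _ = vw
    edge (suc (suc (suc (suc zero)))) (suc (suc (suc zero))) ()
    edge (suc (suc (suc (suc zero)))) (suc (suc (suc (suc zero)))) ()

-- An edge outside the chosen copy of the house. One orientation is tested; the symmetry of `K5-P4`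
-- gives the other.
record FreeEdge {n} (G : Graph n) (f : Fin 5 → Fin n) : Set where
  constructor freeEdge
  field
    {end₁ end₂} : Fin n
    joined : adj G end₁ end₂ ≡ true
    unused : ∀ a b → adj K5-P4 a b ≡ true → f a ≡ end₁ → f b ≡ end₂ → ⊥

-- `d` is a target that any graph may meet, so realizations can be exchanged. With the flag `true`
-- some edge avoids the house and is available for subdivision.
record Housed {n} (free : Bool) (d : Fin n → ℕ) : Set where
  constructor housed
  field
    graph : Graph n
    degs : ∀ i → deg graph i ≡ d i
    subgraph : K5-P4 ⊆G graph
    spare : T free → FreeEdge graph (proj₁ subgraph)

resp : ∀ {n e} {d d′ : Fin n → ℕ} → (∀ x → d x ≡ d′ x) → Housed e d → Housed e d′
resp h (housed G D H F) = housed G (λ i → trans (D i) (h i)) H F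

forget : ∀ {n e} {d : Fin n → ℕ} → Housed e d → Housed false d
forget (housed G D H F) = housed G D H λ ()

house-neighbour : ∀ a → ∃ λ b → adj K5-P4 a b ≡ true
house-neighbour zero = suc (suc zero) , refl
house-neighbour (suc zero) = suc (suc (suc zero)) , refl
house-neighbour (suc (suc zero)) = zero , refl
house-neighbour (suc (suc (suc zero))) = zero , refl
house-neighbour (suc (suc (suc (suc zero)))) = zero , refl

fresh : ∀ {n} {G : Graph n} (H : K5-P4 ⊆G G) {z} → deg G z ≡ 0 → ∀ a → proj₁ H a ≢ z
fresh {G = G} (f , _ , edge) dz a refl with house-neighbour a
... | b , ab = contradiction (trans (sym (edge a b ab)) (isolated G dz (f b))) λ ()

-- The new edges are free because `z` was isolated and no house vertex is.
grow : ∀ {n e} {d : Fin n → ℕ} → Housed e d → ∀ z → d z ≡ 0 → (S : Fin n → Bool) → S z ≡ false → (∃ λ x → S x ≡ true) →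
  Housed true (λ j → d j + 𝟙 (S j) + δ z j * ∑ (𝟙 ∘ S))
grow (housed G D H@(f , inj , edge) F) z dz S Sz (x , Sx) = housed (join G z S Sz)
  (λ j → trans (deg-join G z S Sz Gz j) (cong (λ k → k + 𝟙 (S j) + δ z j * ∑ (𝟙 ∘ S)) (D j)))
  (f , inj , λ a b ab → join-mono G z S Sz (edge a b ab))
  (λ _ → freeEdge (join-new G z S Sz Sx) λ a _ _ fa _ → fresh {G = G} H Gz a fa)
  where Gz = trans (D z) dz

only : ∀ {n} → Fin n → Fin n → Bool
only p j = p == j

both : ∀ {n} → Fin n → Fin n → Fin n → Bool
both p q j = (p == j) ∨ (q == j)

𝟙-both : ∀ {n} {p q : Fin n} → p ≢ q → ∀ j → 𝟙 (both p q j) ≡ δ p j + δ q j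
𝟙-both {p = p} {q} p≢q j with p ≟ j | q ≟ j
... | yes refl | yes refl = ⊥-elim (p≢q refl)
... | yes _ | no _ = refl
... | no _ | _ = refl

∑-both : ∀ {n} {p q : Fin n} → p ≢ q → ∑ (𝟙 ∘ both p q) ≡ 2
∑-both {p = p} {q} p≢q = trans (∑-≡+ (𝟙-both p≢q)) (cong₂ _+_ (∑-δ p) (∑-δ q))

both-∉ : ∀ {n} {p q z : Fin n} → p ≢ z → q ≢ z → both p q z ≡ false
both-∉ p≢ q≢ = cong₂ _∨_ (==-≢ p≢) (==-≢ q≢)

both-∋ˡ : ∀ {n} (p q : Fin n) → both p q p ≡ true
both-∋ˡ p q rewrite ==-refl p = refl

both-∋ʳ : ∀ {n} (p q : Fin n) → both p q q ≡ true
both-∋ʳ p q rewrite ==-refl q = ∨-zeroʳ (p == q)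

pendant : ∀ {n e} {d : Fin n → ℕ} → Housed e d → ∀ {p z} → p ≢ z → d z ≡ 0 → Housed true (λ j → d j + δ p j + δ z j)
pendant {d = d} X {p} {z} p≢z dz = resp (λ j → cong (λ k → d j + δ p j + k) (trans (cong (δ z j *_) (∑-δ p)) (*-identityʳ _)))
  (grow X z dz (only p) (==-≢ p≢z) (p , ==-refl p))

cherry : ∀ {n e} {d : Fin n → ℕ} → Housed e d → ∀ {p q z} → p ≢ q → p ≢ z → q ≢ z → d z ≡ 0 →
  Housed true (λ j → d j + (δ p j + δ q j) + δ z j * 2)
cherry {d = d} X {p} {q} {z} p≢q p≢z q≢z dz =
  resp (λ j → cong₂ (λ s t → d j + s + δ z j * t) (𝟙-both p≢q j) (∑-both p≢q))
  (grow X z dz (both p q) (both-∉ p≢z q≢z) (p , both-∋ˡ p q))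

-- The free edge `pq` gives way to the path through `z`: the degrees of `p` and `q` are unchanged,
-- the house does not use `pq`, and the new edges are free again, so the step can be repeated.
subdivide : ∀ {n} {d : Fin n → ℕ} → Housed true d → ∀ {z} → d z ≡ 0 → Housed true (λ j → d j + δ z j * 2)
subdivide {d = d} (housed G D H@(f , inj , edge) F) {z} dz = resp
  (λ j → cong (_+ δ z j * 2) (trans (sym (deg-remove G p≢q pq j)) (D j)))
  (cherry {e = false} {d = deg G′} (housed G′ (λ _ → refl) (f , inj , edge′) λ ()) p≢q (endpoint pq) (endpoint (trans (adj-sym G q p) pq)) G′z)
  where
  open FreeEdge (F _) renaming (end₁ to p; end₂ to q; joined to pq)
  p≢q = adj⇒≢ G pq
  G′ = toggle G p q p≢q
  Gz = trans (D z) dz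
  endpoint : ∀ {i j} → adj G i j ≡ true → i ≢ z
  endpoint {j = j} ij refl = contradiction (trans (sym ij) (isolated G Gz j)) λ ()
  G′z : deg G′ z ≡ 0
  G′z = m+n≡0⇒m≡0 (deg G′ z) (trans (sym (deg-remove G p≢q pq z)) Gz)
  edge′ : ∀ a b → adj K5-P4 a b ≡ true → adj G′ (f a) (f b) ≡ true
  edge′ a b ab with isPair p q (f a) (f b) in e
  ... | false rewrite edge a b ab = refl
  ... | true with isPair⇒ G p≢q (f a) (f b) e
  ...   | inj₁ (fa , fb) = ⊥-elim (unused a b ab (sym fa) (sym fb))
  ...   | inj₂ (fa , fb) = ⊥-elim (unused b a (trans (adj-sym K5-P4 b a) ab) (sym fb) (sym fa))

edgeless : ∀ {n} → Graph n
adj edgeless _ _ = false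
adj-sym edgeless _ _ = refl
irrefl edgeless _ = refl

deg-edgeless : ∀ {n} (j : Fin n) → deg edgeless j ≡ 0
deg-edgeless j = ∑-0 {f = row edgeless j} λ _ → refl

-- Counterparts of `pendant` and, below, of `cherry` for graphs without a house; they build the
-- first one.
module Attach {n} (G : Graph n) {p z : Fin n} (p≢z : p ≢ z) (Gz : deg G z ≡ 0) where
  attach : Graph n
  attach = join G z (only p) (==-≢ p≢z)

  attach-deg : ∀ j → deg attach j ≡ deg G j + δ p j + δ z j
  attach-deg j = trans (deg-join G z (only p) (==-≢ p≢z) Gz j)
    (cong (deg G j + δ p j +_) (trans (cong (δ z j *_) (∑-δ p)) (*-identityʳ _)))

  attach-0 : ∀ {j} → deg G j ≡ 0 → p ≢ j → z ≢ j → deg attach j ≡ 0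
  attach-0 {j} e p≢ z≢ = trans (attach-deg j) (cong₂ _+_ (cong₂ _+_ e (δ-≢ p≢)) (δ-≢ z≢))

  attach-mono : ∀ {i j} → adj G i j ≡ true → adj attach i j ≡ true
  attach-mono = join-mono G z (only p) (==-≢ p≢z)

  attach-new : adj attach p z ≡ true
  attach-new = join-new′ G z (only p) (==-≢ p≢z) (==-refl p)

module Attach₂ {n} (G : Graph n) {p q z : Fin n} (p≢q : p ≢ q) (p≢z : p ≢ z) (q≢z : q ≢ z) (Gz : deg G z ≡ 0) where
  attach : Graph n
  attach = join G z (both p q) (both-∉ p≢z q≢z)

  attach-deg : ∀ j → deg attach j ≡ deg G j + (δ p j + δ q j) + δ z j * 2
  attach-deg j = trans (deg-join G z (both p q) (both-∉ p≢z q≢z) Gz j)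
    (cong₂ (λ s t → deg G j + s + δ z j * t) (𝟙-both p≢q j) (∑-both p≢q))

  attach-0 : ∀ {j} → deg G j ≡ 0 → p ≢ j → q ≢ j → z ≢ j → deg attach j ≡ 0
  attach-0 {j} e p≢ q≢ z≢ = trans (attach-deg j)
    (cong₂ _+_ (cong₂ _+_ e (cong₂ _+_ (δ-≢ p≢) (δ-≢ q≢))) (cong (_* 2) (δ-≢ z≢)))

  attach-mono : ∀ {i j} → adj G i j ≡ true → adj attach i j ≡ true
  attach-mono = join-mono G z (both p q) (both-∉ p≢z q≢z)

  attach-newˡ : adj attach p z ≡ true
  attach-newˡ = join-new′ G z (both p q) (both-∉ p≢z q≢z) (both-∋ˡ p q)

  attach-newʳ : adj attach q z ≡ true
  attach-newʳ = join-new′ G z (both p q) (both-∉ p≢z q≢z) (both-∋ʳ p q)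

module _ where
  open import Data.List.Relation.Unary.All using ([]; _∷_)
  open import Data.List.Relation.Unary.AllPairs using ([]; _∷_)

  bareHouse : ∀ {n} {u v w x y : Fin n} → Unique₅ u v w x y →
    Housed false (λ j → 3 * δ u j + 3 * δ v j + 2 * δ w j + 2 * δ x j + 2 * δ y j)
  bareHouse {u = u} {v} {w} {x} {y}
    distinct@((u≢v ∷ u≢w ∷ u≢x ∷ u≢y ∷ []) ∷ (v≢w ∷ v≢x ∷ v≢y ∷ []) ∷ (w≢x ∷ w≢y ∷ []) ∷ (x≢y ∷ []) ∷ [] ∷ []) =
    housed A₄.attach degrees
      (house A₄.attach distinct (A₄.attach-mono (A₃.attach-mono (A₂.attach-mono A₁.attach-new)))
        (A₄.attach-mono (A₃.attach-mono A₂.attach-newˡ)) (A₄.attach-mono (A₃.attach-mono A₂.attach-newʳ))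
        (A₄.attach-mono A₃.attach-new) A₄.attach-newʳ A₄.attach-newˡ)
      λ ()
    where
    -- The house arises vertex by vertex: the edge `uv`, then `w` joined to `u` and `v`, `x` to `u`,
    -- and `y` to `x` and `v`.
    module A₁ = Attach edgeless u≢v (deg-edgeless v)
    module A₂ = Attach₂ A₁.attach u≢v u≢w v≢w (A₁.attach-0 (deg-edgeless w) u≢w v≢w)
    module A₃ = Attach A₂.attach u≢x (A₂.attach-0 (A₁.attach-0 (deg-edgeless x) u≢x v≢x) u≢x v≢x w≢x)
    module A₄ = Attach₂ A₃.attach (v≢x ∘ sym) x≢y v≢y
      (A₃.attach-0 (A₂.attach-0 (A₁.attach-0 (deg-edgeless y) u≢y v≢y) u≢y v≢y w≢y) u≢y x≢y)
    collect : ∀ u v w x y → 0 + u + v + (u + v) + w * 2 + u + x + (x + v) + y * 2 ≡ 3 * u + 3 * v + 2 * w + 2 * x + 2 * y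
    collect = solve-∀
    degrees : ∀ j → deg A₄.attach j ≡ 3 * δ u j + 3 * δ v j + 2 * δ w j + 2 * δ x j + 2 * δ y j
    degrees j rewrite A₄.attach-deg j | A₃.attach-deg j | A₂.attach-deg j | A₁.attach-deg j | deg-edgeless j =
      collect (δ u j) (δ v j) (δ w j) (δ x j) (δ y j)

  -- `r` is a house vertex other than `x` and not adjacent to it, that is `v` or `w`; the chord `rx`
  -- is the free edge that a bare house lacks. The choice `w` gives degrees (3⁴,2), the choice `v`
  -- gives (4,3²,2²).
  chordedHouse : ∀ {n} {u v w x y : Fin n} → Unique₅ u v w x y → ∀ k → adj K5-P4 k (suc (suc (suc zero))) ≡ false →
    let r = houseVertices u v w x y k in u ≢ r → r ≢ x → r ≢ y →
    Housed true (λ j → 3 * δ u j + 3 * δ v j + 2 * δ w j + 2 * δ x j + 2 * δ y j + (δ r j + δ x j))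
  chordedHouse {u = u} {v} {w} {x} {y}
    distinct@((u≢v ∷ u≢w ∷ u≢x ∷ u≢y ∷ []) ∷ (v≢w ∷ v≢x ∷ v≢y ∷ []) ∷ (w≢x ∷ w≢y ∷ []) ∷ (x≢y ∷ []) ∷ [] ∷ [])
    k non u≢r r≢x r≢y =
    housed A₄.attach degrees inside (λ _ → freeEdge (A₄.attach-mono A₃.attach-newʳ) chord-free)
    where
    r = houseVertices u v w x y k
    module A₁ = Attach edgeless u≢v (deg-edgeless v)
    module A₂ = Attach₂ A₁.attach u≢v u≢w v≢w (A₁.attach-0 (deg-edgeless w) u≢w v≢w)
    module A₃ = Attach₂ A₂.attach u≢r u≢x r≢x (A₂.attach-0 (A₁.attach-0 (deg-edgeless x) u≢x v≢x) u≢x v≢x w≢x)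
    module A₄ = Attach₂ A₃.attach (v≢x ∘ sym) x≢y v≢y
      (A₃.attach-0 (A₂.attach-0 (A₁.attach-0 (deg-edgeless y) u≢y v≢y) u≢y v≢y w≢y) u≢y r≢y x≢y)
    collect : ∀ u v w x y r → 0 + u + v + (u + v) + w * 2 + (u + r) + x * 2 + (x + v) + y * 2 ≡
      3 * u + 3 * v + 2 * w + 2 * x + 2 * y + (r + x)
    collect = solve-∀
    degrees : ∀ j → deg A₄.attach j ≡ 3 * δ u j + 3 * δ v j + 2 * δ w j + 2 * δ x j + 2 * δ y j + (δ r j + δ x j)
    degrees j rewrite A₄.attach-deg j | A₃.attach-deg j | A₂.attach-deg j | A₁.attach-deg j | deg-edgeless j =
      collect (δ u j) (δ v j) (δ w j) (δ x j) (δ y j) (δ r j)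
    inside : K5-P4 ⊆G A₄.attach
    inside = house A₄.attach distinct (A₄.attach-mono (A₃.attach-mono (A₂.attach-mono A₁.attach-new)))
      (A₄.attach-mono (A₃.attach-mono A₂.attach-newˡ)) (A₄.attach-mono (A₃.attach-mono A₂.attach-newʳ))
      (A₄.attach-mono A₃.attach-newˡ) A₄.attach-newʳ A₄.attach-newˡ
    chord-free : ∀ a b → adj K5-P4 a b ≡ true → houseVertices u v w x y a ≡ r → houseVertices u v w x y b ≡ x → ⊥
    chord-free a b ab fa fb with proj₁ (proj₂ inside) {a} {k} fa | proj₁ (proj₂ inside) {b} {suc (suc (suc zero))} fb
    ... | refl | refl = contradiction (trans (sym ab) non) λ ()

-- Adding vertices of degree 1 and 2 to a graph that contains a house

-- Deriv e A B S R: hubs u and v can absorb A and B further edges to S new vertices of degree 2 and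
-- R new vertices of degree 1; e records whether some edge outside the base house is available.
data Deriv : Bool → ℕ → ℕ → ℕ → ℕ → Set where
  nil   : Deriv false 0 0 0 0
  pendL : ∀ {e A B S R} → Deriv e A B S R → Deriv true (1 + A) B S (1 + R)
  pendR : ∀ {e A B S R} → Deriv e A B S R → Deriv true A (1 + B) S (1 + R)
  pair  : ∀ {e A B S R} → Deriv e A B S R → Deriv true A B S (2 + R)
  link  : ∀ {e A B S R} → Deriv e A B S R → Deriv true (1 + A) (1 + B) (1 + S) R
  triL  : ∀ {e A B S R} → Deriv e A B S R → Deriv true (2 + A) B (2 + S) R
  triR  : ∀ {e A B S R} → Deriv e A B S R → Deriv true A (2 + B) (2 + S) R
  tri   : ∀ {e A B S R} → Deriv e A B S R → Deriv true A B (3 + S) R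
  sub   : ∀ {A B S R} → Deriv true A B S R → Deriv true A B (1 + S) R

-- One or two further vertices of degree 2 and no other demand: there is no free edge to subdivide,
-- and a triangle takes three. Together with the house these are (3²,2⁴) and (3²,2⁵).
data Stuck : ℕ → ℕ → ℕ → ℕ → Set where
  stuck₁ : Stuck 0 0 1 0
  stuck₂ : Stuck 0 0 2 0

Derivable : ℕ → ℕ → ℕ → ℕ → Set
Derivable A B S R = (∃ λ e → Deriv e A B S R) ⊎ Stuck A B S R

mirror : ∀ {e A B S R} → Deriv e A B S R → Deriv e B A S R
mirror nil = nil
mirror (pendL D) = pendR (mirror D)
mirror (pendR D) = pendL (mirror D)
mirror (pair D) = pair (mirror D)
mirror (link D) = link (mirror D)
mirror (triL D) = triR (mirror D)
mirror (triR D) = triL (mirror D)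
mirror (tri D) = tri (mirror D)
mirror (sub D) = sub (mirror D)

subs : ∀ {A B R} S → Deriv true A B 0 R → Deriv true A B S R
subs zero D = D
subs (suc S) D = sub (subs S D)

-- Leaves are matched in pairs. Without leaves, three vertices of degree 2 form a triangle, which
-- the others subdivide.
derive₀ : ∀ S R → Even R → Derivable 0 0 S R
derive₀ 0 _ even-0 = inj₁ (_ , nil)
derive₀ 1 _ even-0 = inj₂ stuck₁
derive₀ 2 _ even-0 = inj₂ stuck₂
derive₀ (suc (suc (suc S))) _ even-0 = inj₁ (_ , triS S)
  where
  triS : ∀ S → Deriv true 0 0 (3 + S) 0
  triS zero = tri nil
  triS (suc S) = sub (triS S)
derive₀ S _ (even-2+ e) with derive₀ S _ e
... | inj₁ (_ , D) = inj₁ (_ , pair D)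
... | inj₂ stuck₁ = inj₁ (_ , subs 1 (pair nil))
... | inj₂ stuck₂ = inj₁ (_ , subs 2 (pair nil))

-- A leaf absorbs one edge of the hub; a triangle through the hub absorbs two and uses two vertices
-- of degree 2. Leaves are spent first, and once they are gone `A` is even.
derive₁ : ∀ A S R → A ≤ S + R → Even (A + R) → Derivable A 0 S R
derive₁ zero S R _ e = derive₀ S R e
derive₁ (suc A) S (suc R) h e with derive₁ A S R (≤-pred (≤-trans h (≤-reflexive (+-suc S R)))) (even-pred² (even-≡ e (cong suc (+-suc A R))))
... | inj₁ (_ , D) = inj₁ (_ , pendL D)
-- When the rest is stuck, the present move is performed first: its edge is free, and the leftover
-- vertices of degree 2 subdivide it.
... | inj₂ stuck₁ = inj₁ (_ , subs 1 (pendL nil))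
... | inj₂ stuck₂ = inj₁ (_ , subs 2 (pendL nil))
derive₁ (suc zero) S zero _ ()
derive₁ (suc (suc A)) (suc (suc S)) zero (s≤s (s≤s h)) (even-2+ e) with derive₁ A S zero h e
... | inj₁ (_ , D) = inj₁ (_ , triL D)
... | inj₂ stuck₁ = inj₁ (_ , sub (triL nil))
... | inj₂ stuck₂ = inj₁ (_ , sub (sub (triL nil)))
derive₁ (suc (suc A)) (suc zero) zero (s≤s ())

-- The bounds say that a new vertex takes at most one edge from each hub, and a leaf at most one in
-- all. A vertex joined to both hubs lowers both sides of every bound equally, so `link` is used
-- while it applies; with `S = 0` the third bound yields the first two for the next call.
derive : ∀ A B S R → A ≤ S + R → B ≤ S + R → A + B ≤ S + S + R → Even (A + B + R) → Derivable A B S R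
derive A zero S R a _ _ e = derive₁ A S R a (even-≡ e (cong (_+ R) (+-identityʳ A)))
derive zero (suc B) S R _ b _ e with derive₁ (suc B) S R b e
... | inj₁ (_ , D) = inj₁ (_ , mirror D)
derive (suc A) (suc B) zero (suc R) _ _ (s≤s ab) e
  with derive A (suc B) zero R (≤-trans (m≤m+n A (suc B)) ab) (≤-trans (m≤n+m (suc B) A) ab) ab (even-pred² (even-≡ e (cong suc (+-suc (A + suc B) R))))
... | inj₁ (_ , D) = inj₁ (_ , pendL D)
derive (suc A) (suc B) (suc S) R (s≤s a) (s≤s b) ab e
  with derive A B S R a b (drop ab) (even-pred² (even-≡ e (cong (λ k → suc (k + R)) (+-suc A B))))
  where
  drop : suc A + suc B ≤ suc S + suc S + R → A + B ≤ S + S + R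
  drop h = lin 0 h (solve (A ∷ B ∷ S ∷ R ∷ []))
... | inj₁ (_ , D) = inj₁ (_ , link D)
... | inj₂ stuck₁ = inj₁ (_ , sub (link nil))
... | inj₂ stuck₂ = inj₁ (_ , sub (sub (link nil)))

module Realize {n} {u v : Fin n} (u≢v : u ≢ v) (d β : Fin n → ℕ) (base : Housed false d)
  (βu : 1 ≤ β u) (βv : 1 ≤ β v) (support : ∀ x → β x ≡ 0 → d x ≡ 0) where

  -- One inequality says that both lists are duplicate-free, disjoint from each other, and disjoint
  -- from the support of `β`, which marks the vertices of the base.
  Fresh : List (Fin n) → List (Fin n) → Set
  Fresh L₂ L₁ = ∀ x → β x + cnt L₂ x + cnt L₁ x ≤ 1

  target : ℕ → ℕ → List (Fin n) → List (Fin n) → Fin n → ℕ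
  target A B L₂ L₁ x = d x + A * δ u x + B * δ v x + 2 * cnt L₂ x + cnt L₁ x

  private
    Free : List (Fin n) → List (Fin n) → Fin n → Set
    Free L₂ L₁ z = β z + cnt L₂ z + cnt L₁ z ≡ 0

    drop₂ : ∀ {z L₂ L₁} → Fresh (z ∷ L₂) L₁ → Fresh L₂ L₁
    drop₂ {z} {L₂} {L₁} F x = ≤-trans (+-monoˡ-≤ (cnt L₁ x) (+-monoʳ-≤ (β x) (m≤n+m (cnt L₂ x) (δ z x)))) (F x)

    drop₁ : ∀ {z L₂ L₁} → Fresh L₂ (z ∷ L₁) → Fresh L₂ L₁
    drop₁ {z} {L₂} {L₁} F x = ≤-trans (+-monoʳ-≤ (β x + cnt L₂ x) (m≤n+m (cnt L₁ x) (δ z x))) (F x)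

    head₂ : ∀ {z L₂ L₁} → Fresh (z ∷ L₂) L₁ → Free L₂ L₁ z
    head₂ {z} {L₂} {L₁} F = n≤0⇒n≡0 (strip (β z) (cnt L₂ z) (cnt L₁ z) (subst (λ k → β z + (k + cnt L₂ z) + cnt L₁ z ≤ 1) (δ-refl z) (F z)))
      where
      strip : ∀ b s t → b + (1 + s) + t ≤ 1 → b + s + t ≤ 0
      strip b s t h = lin 0 h (solve (b ∷ s ∷ t ∷ []))

    head₁ : ∀ {z L₂ L₁} → Fresh L₂ (z ∷ L₁) → Free L₂ L₁ z
    head₁ {z} {L₂} {L₁} F = n≤0⇒n≡0 (strip (β z) (cnt L₂ z) (cnt L₁ z) (subst (λ k → β z + cnt L₂ z + (k + cnt L₁ z) ≤ 1) (δ-refl z) (F z)))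
      where
      strip : ∀ b s t → b + s + (1 + t) ≤ 1 → b + s + t ≤ 0
      strip b s t h = lin 0 h (solve (b ∷ s ∷ t ∷ []))

    hub≢ : ∀ {L₂ L₁ h z} → 1 ≤ β h → Free L₂ L₁ z → h ≢ z
    hub≢ {L₂} {L₁} {h} βh F refl = contradiction
      (≤-trans βh (≤-reflexive (m+n≡0⇒m≡0 (β h) (m+n≡0⇒m≡0 (β h + cnt L₂ h) F)))) λ ()

    δ≡0⇒≢ : ∀ {i j : Fin n} → δ i j ≡ 0 → i ≢ j
    δ≡0⇒≢ {i} e refl = contradiction (trans (sym (δ-refl i)) e) λ ()

    second₂≢ : ∀ {q L₂ L₁ z} → Free (q ∷ L₂) L₁ z → q ≢ z
    second₂≢ {q} {L₂} {L₁} {z} F = δ≡0⇒≢ (m+n≡0⇒m≡0 (δ q z) (m+n≡0⇒n≡0 (β z) (m+n≡0⇒m≡0 (β z + cnt (q ∷ L₂) z) F)))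

    third₂≢ : ∀ {q r L₂ L₁ z} → Free (q ∷ r ∷ L₂) L₁ z → r ≢ z
    third₂≢ {q} {r} {L₂} {L₁} {z} F =
      δ≡0⇒≢ (m+n≡0⇒m≡0 (δ r z) (m+n≡0⇒n≡0 (δ q z) (m+n≡0⇒n≡0 (β z) (m+n≡0⇒m≡0 (β z + cnt (q ∷ r ∷ L₂) z) F))))

    second₁≢ : ∀ {q L₂ L₁ z} → Free L₂ (q ∷ L₁) z → q ≢ z
    second₁≢ {q} {L₂} {L₁} {z} F = δ≡0⇒≢ (m+n≡0⇒m≡0 (δ q z) (m+n≡0⇒n≡0 (β z + cnt L₂ z) F))

    target-0 : ∀ A B L₂ L₁ {z} → Free L₂ L₁ z → target A B L₂ L₁ z ≡ 0
    target-0 A B L₂ L₁ {z} F rewrite support z (m+n≡0⇒m≡0 (β z) (m+n≡0⇒m≡0 (β z + cnt L₂ z) F))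
      | δ-≢ (hub≢ {L₂} {L₁} βu F) | δ-≢ (hub≢ {L₂} {L₁} βv F) | m+n≡0⇒n≡0 (β z) (m+n≡0⇒m≡0 (β z + cnt L₂ z) F)
      | m+n≡0⇒n≡0 (β z + cnt L₂ z) F | *-zeroʳ A | *-zeroʳ B = refl

    still-0 : ∀ {k i j} {z : Fin n} → k ≡ 0 → i ≢ z → j ≢ z → k + δ i z + δ j z ≡ 0
    still-0 e i≢ j≢ = cong₂ _+_ (cong₂ _+_ e (δ-≢ i≢)) (δ-≢ j≢)

    pendL-eq : ∀ d A a B b s t z → d + A * a + B * b + 2 * s + t + a + z ≡ d + (1 + A) * a + B * b + 2 * s + (z + t)
    pendL-eq = solve-∀
    pendR-eq : ∀ d A a B b s t z → d + A * a + B * b + 2 * s + t + b + z ≡ d + A * a + (1 + B) * b + 2 * s + (z + t)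
    pendR-eq = solve-∀
    pair-eq : ∀ d A a B b s t p q → d + A * a + B * b + 2 * s + t + p + q ≡ d + A * a + B * b + 2 * s + (p + (q + t))
    pair-eq = solve-∀
    link-eq : ∀ d A a B b s t z → d + A * a + B * b + 2 * s + t + (a + b) + z * 2 ≡ d + (1 + A) * a + (1 + B) * b + 2 * (z + s) + t
    link-eq = solve-∀
    triL-eq : ∀ d A a B b s t p q → d + A * a + B * b + 2 * s + t + a + p + (a + p) + q * 2 ≡ d + (2 + A) * a + B * b + 2 * (p + (q + s)) + t
    triL-eq = solve-∀
    triR-eq : ∀ d A a B b s t p q → d + A * a + B * b + 2 * s + t + b + p + (b + p) + q * 2 ≡ d + A * a + (2 + B) * b + 2 * (p + (q + s)) + t
    triR-eq = solve-∀
    tri-eq : ∀ d A a B b s t p q r → d + A * a + B * b + 2 * s + t + p + q + (p + q) + r * 2 ≡ d + A * a + B * b + 2 * (p + (q + (r + s))) + t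
    tri-eq = solve-∀
    sub-eq : ∀ d A a B b s t z → d + A * a + B * b + 2 * s + t + z * 2 ≡ d + A * a + B * b + 2 * (z + s) + t
    sub-eq = solve-∀

  -- Each constructor is one construction: `pendL` and `pendR` hang a leaf on a hub, `pair` adds a
  -- separate edge, `link` joins a vertex to both hubs, `triL` and `triR` add a triangle through a
  -- hub, `tri` a separate triangle, and `sub` subdivides the free edge.
  realize : ∀ {e A B S R} → Deriv e A B S R → ∀ L₂ L₁ → length L₂ ≡ S → length L₁ ≡ R → Fresh L₂ L₁ → Housed e (target A B L₂ L₁)
  realize nil [] [] _ _ _ = resp (λ x → tidy (d x)) base
    where
    tidy : ∀ d → d ≡ d + 0 + 0 + 2 * 0 + 0
    tidy = solve-∀
  realize (pendL {A = A} {B} D) L₂ (z ∷ L₁) l₂ refl F =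
    resp (λ x → pendL-eq (d x) A (δ u x) B (δ v x) (cnt L₂ x) (cnt L₁ x) (δ z x))
      (pendant (realize D L₂ L₁ l₂ refl (drop₁ {z} {L₂} {L₁} F)) (hub≢ {L₂} {L₁} βu free) (target-0 A B L₂ L₁ free))
    where free = head₁ {z} {L₂} {L₁} F
  realize (pendR {A = A} {B} D) L₂ (z ∷ L₁) l₂ refl F =
    resp (λ x → pendR-eq (d x) A (δ u x) B (δ v x) (cnt L₂ x) (cnt L₁ x) (δ z x))
      (pendant (realize D L₂ L₁ l₂ refl (drop₁ {z} {L₂} {L₁} F)) (hub≢ {L₂} {L₁} βv free) (target-0 A B L₂ L₁ free))
    where free = head₁ {z} {L₂} {L₁} F
  realize (pair {A = A} {B} D) L₂ (p ∷ q ∷ L₁) l₂ refl F =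
    resp (λ x → pair-eq (d x) A (δ u x) B (δ v x) (cnt L₂ x) (cnt L₁ x) (δ p x) (δ q x))
      (pendant (realize D L₂ L₁ l₂ refl (drop₁ {q} {L₂} {L₁} F′)) (second₁≢ {q} {L₂} {L₁} (head₁ {p} {L₂} {q ∷ L₁} F) ∘ sym)
        (target-0 A B L₂ L₁ (head₁ {q} {L₂} {L₁} F′)))
    where F′ = drop₁ {p} {L₂} {q ∷ L₁} F
  realize (link {A = A} {B} D) (z ∷ L₂) L₁ refl l₁ F =
    resp (λ x → link-eq (d x) A (δ u x) B (δ v x) (cnt L₂ x) (cnt L₁ x) (δ z x))
      (cherry (realize D L₂ L₁ refl l₁ (drop₂ {z} {L₂} {L₁} F)) u≢v (hub≢ {L₂} {L₁} βu free) (hub≢ {L₂} {L₁} βv free) (target-0 A B L₂ L₁ free))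
    where free = head₂ {z} {L₂} {L₁} F
  realize (triL {A = A} {B} D) (p ∷ q ∷ L₂) L₁ refl l₁ F =
    resp (λ x → triL-eq (d x) A (δ u x) B (δ v x) (cnt L₂ x) (cnt L₁ x) (δ p x) (δ q x))
      (cherry (pendant (realize D L₂ L₁ refl l₁ (drop₂ {q} {L₂} {L₁} F′)) u≢p p-0) u≢p u≢q p≢q (still-0 (target-0 A B L₂ L₁ (head₂ {q} {L₂} {L₁} F′)) u≢q p≢q))
    where
    F′ = drop₂ {p} {q ∷ L₂} {L₁} F
    p-free = head₂ {p} {q ∷ L₂} {L₁} F
    u≢p = hub≢ {q ∷ L₂} {L₁} βu p-free
    u≢q = hub≢ {L₂} {L₁} βu (head₂ {q} {L₂} {L₁} F′)
    p≢q = second₂≢ {q} {L₂} {L₁} p-free ∘ sym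
    -- `p` is attached before `q`, so it must be fresh for a graph with neither of them: here the
    -- second entry of the list is dropped.
    p-0 = target-0 A B L₂ L₁ (head₂ {p} {L₂} {L₁} λ x → ≤-trans (+-monoˡ-≤ (cnt L₁ x) (+-monoʳ-≤ (β x) (+-monoʳ-≤ (δ p x) (m≤n+m (cnt L₂ x) (δ q x))))) (F x))
  realize (triR {A = A} {B} D) (p ∷ q ∷ L₂) L₁ refl l₁ F =
    resp (λ x → triR-eq (d x) A (δ u x) B (δ v x) (cnt L₂ x) (cnt L₁ x) (δ p x) (δ q x))
      (cherry (pendant (realize D L₂ L₁ refl l₁ (drop₂ {q} {L₂} {L₁} F′)) v≢p p-0) v≢p v≢q p≢q (still-0 (target-0 A B L₂ L₁ (head₂ {q} {L₂} {L₁} F′)) v≢q p≢q))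
    where
    F′ = drop₂ {p} {q ∷ L₂} {L₁} F
    p-free = head₂ {p} {q ∷ L₂} {L₁} F
    v≢p = hub≢ {q ∷ L₂} {L₁} βv p-free
    v≢q = hub≢ {L₂} {L₁} βv (head₂ {q} {L₂} {L₁} F′)
    p≢q = second₂≢ {q} {L₂} {L₁} p-free ∘ sym
    p-0 = target-0 A B L₂ L₁ (head₂ {p} {L₂} {L₁} λ x → ≤-trans (+-monoˡ-≤ (cnt L₁ x) (+-monoʳ-≤ (β x) (+-monoʳ-≤ (δ p x) (m≤n+m (cnt L₂ x) (δ q x))))) (F x))
  realize (tri {A = A} {B} D) (p ∷ q ∷ r ∷ L₂) L₁ refl l₁ F =
    resp (λ x → tri-eq (d x) A (δ u x) B (δ v x) (cnt L₂ x) (cnt L₁ x) (δ p x) (δ q x) (δ r x))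
      (cherry (pendant (realize D L₂ L₁ refl l₁ (drop₂ {r} {L₂} {L₁} F″)) p≢q q-0) p≢q p≢r q≢r (still-0 (target-0 A B L₂ L₁ (head₂ {r} {L₂} {L₁} F″)) p≢r q≢r))
    where
    F′ = drop₂ {p} {q ∷ r ∷ L₂} {L₁} F
    F″ = drop₂ {q} {r ∷ L₂} {L₁} F′
    p≢q = second₂≢ {q} {r ∷ L₂} {L₁} (head₂ {p} {q ∷ r ∷ L₂} {L₁} F) ∘ sym
    p≢r = third₂≢ {q} {r} {L₂} {L₁} (head₂ {p} {q ∷ r ∷ L₂} {L₁} F) ∘ sym
    q≢r = second₂≢ {r} {L₂} {L₁} (head₂ {q} {r ∷ L₂} {L₁} F′) ∘ sym
    q-0 = target-0 A B L₂ L₁ (head₂ {q} {L₂} {L₁} λ x → ≤-trans (+-monoˡ-≤ (cnt L₁ x) (+-monoʳ-≤ (β x) (+-monoʳ-≤ (δ q x) (m≤n+m (cnt L₂ x) (δ r x))))) (F′ x))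
  realize (sub {A} {B} D) (z ∷ L₂) L₁ refl l₁ F =
    resp (λ x → sub-eq (d x) A (δ u x) B (δ v x) (cnt L₂ x) (cnt L₁ x) (δ z x))
      (subdivide (realize D L₂ L₁ refl l₁ (drop₂ {z} {L₂} {L₁} F)) (target-0 A B L₂ L₁ (head₂ {z} {L₂} {L₁} F)))

-- Sequences with at least three terms ≥ 3

-- Indicators, here of `k ≤ m` and below of `m = k`, with values in ℕ so that they can be summed,
-- and recursive so that they compute on numerals.
ge : ℕ → ℕ → ℕ
ge zero _ = 1
ge (suc k) zero = 0
ge (suc k) (suc m) = ge k m

is : ℕ → ℕ → ℕ
is zero zero = 1
is zero (suc _) = 0
is (suc k) zero = 0
is (suc k) (suc m) = is k m

≤⇒ge : ∀ {k m} → k ≤ m → ge k m ≡ 1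
≤⇒ge z≤n = refl
≤⇒ge (s≤s h) = ≤⇒ge h

ge⇒≤ : ∀ k m → 1 ≤ ge k m → k ≤ m
ge⇒≤ zero m _ = z≤n
ge⇒≤ (suc k) (suc m) h = s≤s (ge⇒≤ k m h)

ge≤1 : ∀ k m → ge k m ≤ 1
ge≤1 zero m = ≤-refl
ge≤1 (suc k) zero = z≤n
ge≤1 (suc k) (suc m) = ge≤1 k m

<⇒ge≡0 : ∀ {k m} → m < k → ge k m ≡ 0
<⇒ge≡0 {suc k} {zero} _ = refl
<⇒ge≡0 {suc k} {suc m} (s≤s h) = <⇒ge≡0 h

ge≡0⇒< : ∀ k m → ge k m ≡ 0 → m < k
ge≡0⇒< (suc k) zero _ = s≤s z≤n
ge≡0⇒< (suc k) (suc m) h = s≤s (ge≡0⇒< k m h)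

ge-anti : ∀ k m → ge (suc k) m ≤ ge k m
ge-anti zero zero = z≤n
ge-anti zero (suc m) = ≤-refl
ge-anti (suc k) zero = z≤n
ge-anti (suc k) (suc m) = ge-anti k m

is-refl : ∀ k → is k k ≡ 1
is-refl zero = refl
is-refl (suc k) = is-refl k

is⇒≡ : ∀ k m → 1 ≤ is k m → m ≡ k
is⇒≡ zero zero _ = refl
is⇒≡ (suc k) (suc m) h = cong suc (is⇒≡ k m h)

ge-split : ∀ k m → ge k m ≡ is k m + ge (suc k) m
ge-split zero zero = refl
ge-split zero (suc m) = refl
ge-split (suc k) zero = refl
ge-split (suc k) (suc m) = ge-split k m

#≥ #≡ : ∀ {n} → ℕ → (Fin n → ℕ) → ℕ
#≥ k d = ∑ λ x → ge k (d x)
#≡ k d = ∑ λ x → is k (d x)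

#≥-split : ∀ {n} k (d : Fin n → ℕ) → #≥ k d ≡ #≡ k d + #≥ (suc k) d
#≥-split k d = ∑-≡+ λ x → ge-split k (d x)

∑≡0⇒ : ∀ {n} (f : Fin n → ℕ) → ∑ f ≡ 0 → ∀ x → f x ≡ 0
∑≡0⇒ f e x = n≤0⇒n≡0 (≤-trans (≤-∑ f x) (≤-reflexive e))

-- `v` and its neighbours are all non-isolated.
deg<#≥1 : ∀ {n} (G : Graph n) v → 1 ≤ deg G v → suc (deg G v) ≤ #≥ 1 (deg G)
deg<#≥1 G v dv = ≤-trans (≤-reflexive (trans (+-comm 1 _) (cong (deg G v +_) (sym (∑-δ v))))) (∑-+≤ pt)
  where
  pt : ∀ x → row G v x + δ v x ≤ ge 1 (deg G x)
  pt x with v ≟ x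
  ... | yes refl rewrite irrefl G v | ≤⇒ge dv = ≤-refl
  ... | no _ with adj G v x in e
  ...   | false = z≤n
  ...   | true rewrite ≤⇒ge (adj⇒deg>0 G (trans (adj-sym G x v) e)) = ≤-refl

cnt-self : ∀ {n} (l : Fin n) L → 1 ≤ cnt (l ∷ L) l
cnt-self l L rewrite δ-refl l = s≤s z≤n

subdivideAll : ∀ {n} (d β : Fin n → ℕ) → Housed true d → (∀ x → β x ≡ 0 → d x ≡ 0) →
  ∀ L → (∀ x → β x + cnt L x ≤ 1) → Housed true (λ x → d x + 2 * cnt L x)
subdivideAll d β X support [] F = resp (λ x → sym (+-identityʳ (d x))) X
subdivideAll d β X support (z ∷ L) F =
  resp (λ x → regroup (d x) (cnt L x) (δ z x)) (subdivide (subdivideAll d β X support L (λ x → ≤-trans (+-monoʳ-≤ (β x) (m≤n+m _ (δ z x))) (F x)))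
    (cong₂ (λ s t → s + 2 * t) (support z (m+n≡0⇒m≡0 (β z) free)) (m+n≡0⇒n≡0 (β z) free)))
  where
  regroup : ∀ d c z → d + 2 * c + z * 2 ≡ d + 2 * (z + c)
  regroup = solve-∀
  strip : ∀ b c → b + (1 + c) ≤ 1 → b + c ≤ 0
  strip b c h = lin 0 h (solve (b ∷ c ∷ []))
  free : β z + cnt L z ≡ 0
  free = n≤0⇒n≡0 (strip (β z) (cnt L z) (subst (λ k → β z + (k + cnt L z) ≤ 1) (δ-refl z) (F z)))

module Five {n} (u v w x y : Fin n) where
  five : List (Fin n)
  five = u ∷ v ∷ w ∷ x ∷ y ∷ []

  five-support : ∀ (d : Fin n → ℕ) (a b c e f : ℕ) → (∀ j → d j ≡ a * δ u j + b * δ v j + c * δ w j + e * δ x j + f * δ y j) →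
    ∀ j → cnt five j ≡ 0 → d j ≡ 0
  five-support d a b c e f h j z
    rewrite h j | m+n≡0⇒m≡0 (δ u j) z with m+n≡0⇒n≡0 (δ u j) z
  ... | z₁ rewrite m+n≡0⇒m≡0 (δ v j) z₁ with m+n≡0⇒n≡0 (δ v j) z₁
  ... | z₂ rewrite m+n≡0⇒m≡0 (δ w j) z₂ with m+n≡0⇒n≡0 (δ w j) z₂
  ... | z₃ rewrite m+n≡0⇒m≡0 (δ x j) z₃ with m+n≡0⇒n≡0 (δ x j) z₃
  ... | z₄ rewrite m+n≡0⇒m≡0 (δ y j) z₄ | *-zeroʳ a | *-zeroʳ b | *-zeroʳ c | *-zeroʳ e | *-zeroʳ f = refl

-- The exceptional families

module Families {n} (G : Graph n) where
  d : Fin n → ℕ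
  d = deg G

  -- (3³, 2ˢ, 1ʳ): a house whose vertex x gets one further edge.
  three-3s : #≥ 4 d ≡ 0 → #≥ 3 d ≡ 3 → 5 ≤ #≥ 2 d → Housed false d
  three-3s q p w with listing (is 3 ∘ d) | listing (is 2 ∘ d) | listing (is 1 ∘ d)
  ... | L₃ , c₃ , l₃ | L₂ , c₂ , l₂ | L₁ , c₁ , l₁ =
    build L₃ L₂ c₃ c₂ (trans l₃ n3) l₂ (≤-trans (two (#≡ 2 d) (≤-trans w (≤-reflexive (trans (#≥-split 2 d) (cong (#≡ 2 d +_) p))))) (≤-reflexive (sym l₂)))
    where
    n3 : #≡ 3 d ≡ 3
    n3 = trans (sym (+-identityʳ _)) (trans (cong (#≡ 3 d +_) (sym q)) (trans (sym (#≥-split 3 d)) p))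
    two : ∀ a → 5 ≤ a + 3 → 2 ≤ a
    two a h = lin 0 h (solve (a ∷ []))
    small : ∀ m → m < 4 → m ≡ 3 * is 3 m + 2 * is 2 m + is 1 m × is 3 m + is 2 m + is 1 m ≤ 1
    small 0 _ = refl , z≤n
    small 1 _ = refl , ≤-refl
    small 2 _ = refl , ≤-refl
    small 3 _ = refl , ≤-refl
    small (suc (suc (suc (suc _)))) (s≤s (s≤s (s≤s (s≤s ()))))
    d≤3 : ∀ j → d j < 4
    d≤3 j = ge≡0⇒< 4 (d j) (∑≡0⇒ (λ x → ge 4 (d x)) q j)
    total : ∑ d ≡ 3 * #≡ 3 d + 2 * #≡ 2 d + #≡ 1 d
    total = trans (∑-≡+ {f = λ j → 3 * is 3 (d j) + 2 * is 2 (d j)} λ j → proj₁ (small (d j) (d≤3 j)))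
      (cong (_+ #≡ 1 d) (trans (∑-≡+ {f = λ j → 3 * is 3 (d j)} {g = λ j → 2 * is 2 (d j)} λ _ → refl)
        (cong₂ _+_ (∑-*ˡ 3 (is 3 ∘ d)) (∑-*ˡ 2 (is 2 ∘ d)))))
    -- The degree sum 9 + 2s + r is even, so r is odd, and there is a leaf for the extra edge of
    -- `x`.
    parity : Even (1 + #≡ 1 d)
    parity = even-cancel (4 + #≡ 2 d) (even-≡ (handshake G) (trans total (trans (cong (λ k → 3 * k + 2 * #≡ 2 d + #≡ 1 d) n3) (regroup (#≡ 2 d) (#≡ 1 d)))))
      where
      regroup : ∀ a b → 3 * 3 + 2 * a + b ≡ 4 + a + (4 + a) + (1 + b)
      regroup = solve-∀
    positive : ∀ {r} → Even (1 + r) → 1 ≤ r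
    positive {suc r} _ = s≤s z≤n
    build : ∀ L₃ L₂ → (∀ j → cnt L₃ j ≡ is 3 (d j)) → (∀ j → cnt L₂ j ≡ is 2 (d j)) → length L₃ ≡ 3 → length L₂ ≡ #≡ 2 d → 2 ≤ length L₂ → Housed false d
    build (u ∷ v ∷ x ∷ []) (w ∷ y ∷ L₂) c₃ c₂ _ l₂ _ with derive₁ 1 (length L₂) (length L₁) (≤-trans (subst (1 ≤_) (sym l₁) (positive parity)) (m≤n+m _ (length L₂))) (subst (λ r → Even (1 + r)) (sym l₁) parity)
    ... | inj₁ (_ , D) = forget (resp eq (R.realize D L₂ L₁ refl refl R-fresh))
      where
      open Five u v w x y
      counted : ∀ j → cnt (u ∷ v ∷ x ∷ []) j + cnt (w ∷ y ∷ L₂) j + cnt L₁ j ≤ 1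
      counted j rewrite c₃ j | c₂ j | c₁ j = proj₂ (small (d j) (d≤3 j))
      R-fresh : ∀ j → cnt five j + cnt L₂ j + cnt L₁ j ≤ 1
      R-fresh j = ≤-trans (≤-reflexive (perm (δ u j) (δ v j) (δ w j) (δ x j) (δ y j) (cnt L₂ j) (cnt L₁ j))) (counted j)
        where
        perm : ∀ u v w x y s t → u + (v + (w + (x + (y + 0)))) + s + t ≡ u + (v + (x + 0)) + (w + (y + s)) + t
        perm = solve-∀
      distinct : Unique₅ u v w x y
      distinct = cnt≤1⇒Unique five λ j → ≤-trans (≤-trans (m≤m+n _ (cnt L₂ j)) (m≤m+n _ (cnt L₁ j))) (R-fresh j)
      u≢x : u ≢ x
      u≢x with distinct
      ... | (_ All.∷ _ All.∷ u≢x All.∷ _) AllPairs.∷ _ = u≢x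
      base = bareHouse distinct
      -- The active hub is `x`, of degree 2 in the house and 3 in the sequence; `u` is a second hub
      -- with residual demand 0.
      module R = Realize {u = x} {u} (u≢x ∘ sym) _ (cnt five) base
        (≤-trans (cnt-self x (y ∷ [])) (≤-trans (m≤n+m _ (δ w x)) (≤-trans (m≤n+m _ (δ v x)) (m≤n+m _ (δ u x)))))
        (cnt-self u (v ∷ w ∷ x ∷ y ∷ []))
        (five-support _ 3 3 2 2 2 λ _ → refl)
      eq : ∀ j → R.target 1 0 L₂ L₁ j ≡ d j
      eq j = trans (collect (δ u j) (δ v j) (δ w j) (δ x j) (δ y j) (cnt L₂ j) (cnt L₁ j))
        (trans (cong₂ (λ s t → 3 * s + 2 * t + cnt L₁ j) (c₃ j) (c₂ j)) (trans (cong (3 * is 3 (d j) + 2 * is 2 (d j) +_) (c₁ j)) (sym (proj₁ (small (d j) (d≤3 j))))))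
        where
        collect : ∀ u v w x y s t → 3 * u + 3 * v + 2 * w + 2 * x + 2 * y + 1 * x + 0 * u + 2 * s + t ≡
          3 * (u + (v + (x + 0))) + 2 * (w + (y + s)) + t
        collect = solve-∀
    build (_ ∷ _ ∷ _ ∷ []) [] _ _ _ _ ()
    build (_ ∷ _ ∷ _ ∷ []) (_ ∷ []) _ _ _ _ (s≤s ())
    build [] _ _ _ () _ _
    build (_ ∷ []) _ _ _ () _ _
    build (_ ∷ _ ∷ []) _ _ _ () _ _
    build (_ ∷ _ ∷ _ ∷ _ ∷ _) _ _ _ () _ _

decompose : ∀ m → m ≡ ge 4 m * m + (3 * is 3 m + 2 * is 2 m + is 1 m)
decompose 0 = refl
decompose 1 = refl
decompose 2 = refl
decompose 3 = refl
decompose (suc (suc (suc (suc m)))) = sym (trans (+-identityʳ _) (+-identityʳ _))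

exclusive : ∀ m → ge 4 m + is 3 m + is 2 m ≤ 1
exclusive 0 = z≤n
exclusive 1 = z≤n
exclusive 2 = ≤-refl
exclusive 3 = ≤-refl
exclusive (suc (suc (suc (suc m)))) = ≤-refl

module Families₂ {n} (G : Graph n) (none-1 : #≡ 1 (deg G) ≡ 0) where
  d : Fin n → ℕ
  d = deg G

  private
    no-1 : ∀ j → is 1 (d j) ≡ 0
    no-1 = ∑≡0⇒ (is 1 ∘ d) none-1

    d-form : ∀ j → d j ≡ ge 4 (d j) * d j + 3 * is 3 (d j) + 2 * is 2 (d j)
    d-form j = trans (decompose (d j)) (trans (cong (λ k → ge 4 (d j) * d j + (3 * is 3 (d j) + 2 * is 2 (d j) + k)) (no-1 j))
      (drop (ge 4 (d j) * d j) (3 * is 3 (d j)) (2 * is 2 (d j))))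
      where
      drop : ∀ a b c → a + (b + c + 0) ≡ a + b + c
      drop = solve-∀

    count-3 : ∀ {q p} → #≥ 4 d ≡ q → #≥ 3 d ≡ p → p ≡ #≡ 3 d + q
    count-3 refl refl = #≥-split 3 d

    count-2 : ∀ {p} → #≥ 3 d ≡ p → 5 ≤ #≥ 2 d → 5 ≤ #≡ 2 d + p
    count-2 refl h = subst (5 ≤_) (#≥-split 2 d) h

  -- The chord `wx` turns the house into (3⁴,2); lying outside the house, it is subdivided by all
  -- further vertices of degree 2.
  four-3s : #≥ 4 d ≡ 0 → #≥ 3 d ≡ 4 → 5 ≤ #≥ 2 d → Housed false d
  four-3s q p w with listing (is 3 ∘ d) | listing (is 2 ∘ d)
  ... | L₃ , c₃ , l₃ | L₂ , c₂ , l₂ = build L₃ L₂ c₃ c₂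
      (trans l₃ (trans (sym (+-identityʳ _)) (sym (count-3 q p)))) (≤-trans (one (#≡ 2 d) (count-2 p w)) (≤-reflexive (sym l₂)))
    where
    one : ∀ a → 5 ≤ a + 4 → 1 ≤ a
    one a h = lin 0 h (solve (a ∷ []))
    build : ∀ L₃ L₂ → (∀ j → cnt L₃ j ≡ is 3 (d j)) → (∀ j → cnt L₂ j ≡ is 2 (d j)) → length L₃ ≡ 4 → 1 ≤ length L₂ → Housed false d
    build (u ∷ v ∷ w ∷ x ∷ []) (y ∷ L₂) c₃ c₂ _ _ = forget (resp eq (subdivideAll _ (cnt five) base
        (five-support _ 3 3 3 3 2 λ j → regroup (δ u j) (δ v j) (δ w j) (δ x j) (δ y j)) L₂ L₂-fresh))
      where
      open Five u v w x y
      regroup : ∀ u v w x y → 3 * u + 3 * v + 2 * w + 2 * x + 2 * y + (w + x) ≡ 3 * u + 3 * v + 3 * w + 3 * x + 2 * y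
      regroup = solve-∀
      counted : ∀ j → cnt (u ∷ v ∷ w ∷ x ∷ []) j + cnt (y ∷ L₂) j ≤ 1
      counted j rewrite c₃ j | c₂ j = ≤-trans (+-monoˡ-≤ (is 2 (d j)) (m≤n+m _ (ge 4 (d j)))) (exclusive (d j))
      L₂-fresh : ∀ j → cnt five j + cnt L₂ j ≤ 1
      L₂-fresh j = ≤-trans (≤-reflexive (perm (δ u j) (δ v j) (δ w j) (δ x j) (δ y j) (cnt L₂ j))) (counted j)
        where
        perm : ∀ u v w x y s → u + (v + (w + (x + (y + 0)))) + s ≡ u + (v + (w + (x + 0))) + (y + s)
        perm = solve-∀
      distinct : Unique₅ u v w x y
      distinct = cnt≤1⇒Unique five λ j → ≤-trans (m≤m+n _ (cnt L₂ j)) (L₂-fresh j)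
      base : Housed true (λ j → 3 * δ u j + 3 * δ v j + 2 * δ w j + 2 * δ x j + 2 * δ y j + (δ w j + δ x j))
      base with distinct
      ... | (_ All.∷ u≢w All.∷ _) AllPairs.∷ _ AllPairs.∷ (w≢x All.∷ w≢y All.∷ _) AllPairs.∷ _ =
        chordedHouse distinct (suc (suc zero)) refl u≢w w≢x w≢y
      eq : ∀ j → 3 * δ u j + 3 * δ v j + 2 * δ w j + 2 * δ x j + 2 * δ y j + (δ w j + δ x j) + 2 * cnt L₂ j ≡ d j
      eq j = trans (collect (δ u j) (δ v j) (δ w j) (δ x j) (δ y j) (cnt L₂ j) (d j))
        (trans (cong₂ (λ s t → s * d j + 3 * t + 2 * (δ y j + cnt L₂ j)) (sym (∑≡0⇒ (λ i → ge 4 (d i)) q j)) (c₃ j))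
          (trans (cong (λ t → ge 4 (d j) * d j + 3 * is 3 (d j) + 2 * t) (c₂ j)) (sym (d-form j))))
        where
        collect : ∀ u v w x y s e → 3 * u + 3 * v + 2 * w + 2 * x + 2 * y + (w + x) + 2 * s ≡
          0 * e + 3 * (u + (v + (w + (x + 0)))) + 2 * (y + s)
        collect = solve-∀
    build (_ ∷ _ ∷ _ ∷ _ ∷ []) [] _ _ _ ()
    build [] _ _ _ () _
    build (_ ∷ []) _ _ _ () _
    build (_ ∷ _ ∷ []) _ _ _ () _
    build (_ ∷ _ ∷ _ ∷ []) _ _ _ () _
    build (_ ∷ _ ∷ _ ∷ _ ∷ _ ∷ _) _ _ _ () _

  -- The sixth vertex is joined to the three house vertices of degree 2.
  six-3s : #≥ 4 d ≡ 0 → #≥ 3 d ≡ 6 → #≥ 1 d ≡ 6 → Housed false d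
  six-3s q p N with listing (is 3 ∘ d)
  ... | L₃ , c₃ , l₃ = build L₃ c₃ (trans l₃ (trans (sym (+-identityʳ _)) (sym (count-3 q p))))
    where
    no-2 : ∀ j → is 2 (d j) ≡ 0
    no-2 = ∑≡0⇒ (is 2 ∘ d) (+-cancelʳ-≡ 6 (#≡ 2 d) 0 (trans (cong (#≡ 2 d +_) (sym p)) (trans (sym (#≥-split 2 d))
      (trans (sym (cong (_+ #≥ 2 d) none-1)) (trans (sym (#≥-split 1 d)) N)))))
    build : ∀ L₃ → (∀ j → cnt L₃ j ≡ is 3 (d j)) → length L₃ ≡ 6 → Housed false d
    build (u ∷ v ∷ w ∷ x ∷ y ∷ t ∷ []) c₃ _ = forget (resp eq
        (grow (bareHouse distinct) t (five-support _ 3 3 2 2 2 (λ _ → refl) t t-fresh) S St (w , S-w)))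
      where
      open Five u v w x y
      counted : ∀ j → cnt (u ∷ v ∷ w ∷ x ∷ y ∷ t ∷ []) j ≤ 1
      counted j rewrite c₃ j = ≤-trans (≤-trans (m≤n+m _ (ge 4 (d j))) (m≤m+n _ (is 2 (d j)))) (exclusive (d j))
      perm : ∀ u v w x y t → u + (v + (w + (x + (y + (t + 0))))) ≡ u + (v + (w + (x + (y + 0)))) + t
      perm = solve-∀
      split : ∀ j → cnt five j + δ t j ≤ 1
      split j = ≤-trans (≤-reflexive (sym (perm (δ u j) (δ v j) (δ w j) (δ x j) (δ y j) (δ t j)))) (counted j)
      distinct : Unique₅ u v w x y
      distinct = cnt≤1⇒Unique five λ j → ≤-trans (m≤m+n _ (δ t j)) (split j)
      t-fresh : cnt five t ≡ 0
      t-fresh = n≤0⇒n≡0 (+-cancelʳ-≤ 1 _ _ (subst (λ k → cnt five t + k ≤ 1) (δ-refl t) (split t)))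
      S : Fin n → Bool
      S j = (w == j) ∨ both x y j
      S-w : S w ≡ true
      S-w rewrite ==-refl w = refl
      𝟙S : ∀ j → 𝟙 (S j) ≡ δ w j + (δ x j + δ y j)
      𝟙S j with distinct
      ... | _ AllPairs.∷ _ AllPairs.∷ (w≢x All.∷ w≢y All.∷ _) AllPairs.∷ (x≢y All.∷ _) AllPairs.∷ _ with w ≟ j
      ...   | yes refl rewrite δ-≢ (w≢x ∘ sym) | δ-≢ (w≢y ∘ sym) = refl
      ...   | no _ = 𝟙-both x≢y j
      ∑S : ∑ (𝟙 ∘ S) ≡ 3
      ∑S = trans (∑-≡+ 𝟙S) (cong₂ _+_ (∑-δ w) (trans (∑-distrib-+ (δ x) (δ y)) (cong₂ _+_ (∑-δ x) (∑-δ y))))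
      St : S t ≡ false
      St = 𝟙≡0 (trans (𝟙S t) (n≤0⇒n≡0 (≤-trans (tail≤ (δ u t) (δ v t) (δ w t) (δ x t) (δ y t)) (≤-reflexive t-fresh))))
        where
        tail≤ : ∀ u v w x y → w + (x + y) ≤ u + (v + (w + (x + (y + 0))))
        tail≤ u v w x y = lin (u + v) (z≤n {0}) (solve (u ∷ v ∷ w ∷ x ∷ y ∷ []))
      eq : ∀ j → 3 * δ u j + 3 * δ v j + 2 * δ w j + 2 * δ x j + 2 * δ y j + 𝟙 (S j) + δ t j * ∑ (𝟙 ∘ S) ≡ d j
      eq j = trans (cong₂ (λ s k → 3 * δ u j + 3 * δ v j + 2 * δ w j + 2 * δ x j + 2 * δ y j + s + δ t j * k) (𝟙S j) ∑S)
        (trans (collect (δ u j) (δ v j) (δ w j) (δ x j) (δ y j) (δ t j) (d j))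
          (trans (cong₂ (λ s k → s * d j + 3 * k + 2 * 0) (sym (∑≡0⇒ (λ i → ge 4 (d i)) q j)) (c₃ j))
            (trans (cong (λ k → ge 4 (d j) * d j + 3 * is 3 (d j) + 2 * k) (sym (no-2 j))) (sym (d-form j)))))
        where
        collect : ∀ u v w x y t e → 3 * u + 3 * v + 2 * w + 2 * x + 2 * y + (w + (x + y)) + t * 3 ≡
          0 * e + 3 * (u + (v + (w + (x + (y + (t + 0)))))) + 2 * 0
        collect = solve-∀
    build [] _ ()
    build (_ ∷ []) _ ()
    build (_ ∷ _ ∷ []) _ ()
    build (_ ∷ _ ∷ _ ∷ []) _ ()
    build (_ ∷ _ ∷ _ ∷ _ ∷ []) _ ()
    build (_ ∷ _ ∷ _ ∷ _ ∷ _ ∷ []) _ ()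
    build (_ ∷ _ ∷ _ ∷ _ ∷ _ ∷ _ ∷ _ ∷ _) _ ()

  -- The chord `vx` gives degrees (4,3²,2²) with `v` the large vertex. The excess of `v` over 4 is
  -- even by the handshake lemma and at most the number of vertices left, so triangles through `v`
  -- absorb it.
  big-and-two-3s : #≥ 4 d ≡ 1 → #≥ 3 d ≡ 3 → 5 ≤ #≥ 2 d → Housed false d
  big-and-two-3s q p w with listing (λ j → ge 4 (d j)) | listing (is 3 ∘ d) | listing (is 2 ∘ d)
  ... | L₄ , c₄ , l₄ | L₃ , c₃ , l₃ | L₂ , c₂ , l₂ = build L₄ L₃ L₂ c₄ c₃ c₂ (trans l₄ q) (trans l₃ n3) l₂
      (≤-trans (two (#≡ 2 d) (count-2 p w)) (≤-reflexive (sym l₂)))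
    where
    two : ∀ a → 5 ≤ a + 3 → 2 ≤ a
    two a h = lin 0 h (solve (a ∷ []))
    n3 : #≡ 3 d ≡ 2
    n3 = +-cancelʳ-≡ 1 (#≡ 3 d) 2 (sym (count-3 q p))
    build : ∀ L₄ L₃ L₂ → (∀ j → cnt L₄ j ≡ ge 4 (d j)) → (∀ j → cnt L₃ j ≡ is 3 (d j)) → (∀ j → cnt L₂ j ≡ is 2 (d j)) →
      length L₄ ≡ 1 → length L₃ ≡ 2 → length L₂ ≡ #≡ 2 d → 2 ≤ length L₂ → Housed false d
    build (v ∷ []) (u ∷ x ∷ []) (w ∷ y ∷ L₂) c₄ c₃ c₂ _ _ l₂ _ = finish (d v) refl big
      where
      open Five u v w x y
      counted : ∀ j → cnt (v ∷ []) j + cnt (u ∷ x ∷ []) j + cnt (w ∷ y ∷ L₂) j ≤ 1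
      counted j rewrite c₄ j | c₃ j | c₂ j = exclusive (d j)
      L₂-fresh : ∀ j → cnt five j + cnt L₂ j ≤ 1
      L₂-fresh j = ≤-trans (≤-reflexive (perm (δ u j) (δ v j) (δ w j) (δ x j) (δ y j) (cnt L₂ j))) (counted j)
        where
        perm : ∀ u v w x y s → u + (v + (w + (x + (y + 0)))) + s ≡ v + 0 + (u + (x + 0)) + (w + (y + s))
        perm = solve-∀
      distinct : Unique₅ u v w x y
      distinct = cnt≤1⇒Unique five λ j → ≤-trans (m≤m+n _ (cnt L₂ j)) (L₂-fresh j)
      d₀ : Fin n → ℕ
      d₀ j = 3 * δ u j + 3 * δ v j + 2 * δ w j + 2 * δ x j + 2 * δ y j + (δ v j + δ x j)
      base : Housed true d₀
      base with distinct
      ... | (u≢v All.∷ _) AllPairs.∷ (_ All.∷ v≢x All.∷ v≢y All.∷ _) AllPairs.∷ _ =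
        chordedHouse distinct (suc (suc (suc (suc zero)))) refl u≢v v≢x v≢y
      support : ∀ j → cnt five j ≡ 0 → d₀ j ≡ 0
      support = five-support _ 3 4 2 3 2 λ j → regroup (δ u j) (δ v j) (δ w j) (δ x j) (δ y j)
        where
        regroup : ∀ u v w x y → 3 * u + 3 * v + 2 * w + 2 * x + 2 * y + (v + x) ≡ 3 * u + 4 * v + 2 * w + 3 * x + 2 * y
        regroup = solve-∀
      big : 4 ≤ d v
      big = ge⇒≤ 4 (d v) (≤-trans (cnt-self v []) (≤-reflexive (c₄ v)))
      hub-form : ∀ j → ge 4 (d j) * d j ≡ δ v j * d v
      hub-form j with v ≟ j | c₄ j
      ... | yes refl | e = cong (_* d v) (sym e)
      ... | no _ | e = cong (_* d j) (sym e)
      n2 : 2 + length L₂ ≡ #≡ 2 d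
      n2 = l₂
      total : ∑ d ≡ d v + 3 * 2 + 2 * #≡ 2 d
      total = trans (∑-≡+ {f = λ j → ge 4 (d j) * d j + 3 * is 3 (d j)} d-form) (cong₂ _+_
        (trans (∑-≡+ {f = λ j → ge 4 (d j) * d j} {g = λ j → 3 * is 3 (d j)} λ _ → refl)
          (cong₂ _+_ (trans (sum-cong-≗ hub-form) (∑-δ* v (λ _ → d v))) (trans (∑-*ˡ 3 (is 3 ∘ d)) (cong (3 *_) n3))))
        (∑-*ˡ 2 (is 2 ∘ d)))
      even : Even (d v)
      even = even-cancel (3 + #≡ 2 d) (even-≡ (handshake G) (trans total (regroup (d v) (#≡ 2 d))))
        where
        regroup : ∀ a b → a + 3 * 2 + 2 * b ≡ 3 + b + (3 + b) + a
        regroup = solve-∀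
      bound : d v ≤ 4 + length L₂
      bound = ≤-pred (≤-trans (deg<#≥1 G v (≤-trans (s≤s z≤n) big)) (≤-reflexive (trans (#≥-split 1 d)
        (trans (cong₂ _+_ none-1 (trans (#≥-split 2 d) (cong₂ _+_ (sym n2) p))) (+-comm (2 + length L₂) 3)))))
      eq : ∀ A → d v ≡ 4 + A → ∀ j → d₀ j + A * δ v j + 2 * cnt L₂ j ≡ d j
      eq A e j = trans (collect (δ u j) (δ v j) (δ w j) (δ x j) (δ y j) (cnt L₂ j) A)
        (trans (cong₂ (λ s t → s + 3 * t + 2 * (δ w j + (δ y j + cnt L₂ j))) (trans (cong (δ v j *_) (sym e)) (sym (hub-form j))) (c₃ j))
          (trans (cong (λ t → ge 4 (d j) * d j + 3 * is 3 (d j) + 2 * t) (c₂ j)) (sym (d-form j))))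
        where
        collect : ∀ u v w x y s A → 3 * u + 3 * v + 2 * w + 2 * x + 2 * y + (v + x) + A * v + 2 * s ≡
          v * (4 + A) + 3 * (u + (x + 0)) + 2 * (w + (y + s))
        collect = solve-∀
      finish : ∀ m → d v ≡ m → 4 ≤ m → Housed false d
      -- Without excess the remaining vertices subdivide the chord; a derivation, which starts with
      -- no free edge, could be stuck here.
      finish (suc (suc (suc (suc zero)))) e _ =
        forget (resp (λ j → trans (cong (_+ 2 * cnt L₂ j) (sym (+-identityʳ (d₀ j)))) (eq 0 e j)) (subdivideAll d₀ (cnt five) base support L₂ L₂-fresh))
      finish (suc (suc (suc (suc (suc A))))) e _
        with derive₁ (suc A) (length L₂) 0 (subst (suc A ≤_) (sym (+-identityʳ _)) (≤-pred (≤-pred (≤-pred (≤-pred (subst (_≤ 4 + length L₂) e bound))))))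
          (even-≡ (even-cancel 2 (even-≡ even e)) (sym (+-identityʳ (suc A))))
      ... | inj₁ (_ , D) = forget (resp (λ j → trans (tidy (d₀ j) (suc A * δ v j) (cnt L₂ j)) (eq (suc A) e j))
            (R.realize D L₂ [] refl refl λ j → ≤-trans (≤-reflexive (+-identityʳ _)) (L₂-fresh j)))
        where
        tidy : ∀ d a s → d + a + 0 + 2 * s + 0 ≡ d + a + 2 * s
        tidy = solve-∀
        v≢u : v ≢ u
        v≢u with distinct
        ... | (u≢v All.∷ _) AllPairs.∷ _ = u≢v ∘ sym
        module R = Realize {u = v} {u} v≢u d₀ (cnt five) (forget base)
          (≤-trans (cnt-self v (w ∷ x ∷ y ∷ [])) (m≤n+m _ (δ u v))) (cnt-self u (v ∷ w ∷ x ∷ y ∷ [])) support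
      finish 0 _ ()
      finish 1 _ (s≤s ())
      finish 2 _ (s≤s (s≤s ()))
      finish 3 _ (s≤s (s≤s (s≤s ())))
    build (_ ∷ []) (_ ∷ _ ∷ []) [] _ _ _ _ _ _ ()
    build (_ ∷ []) (_ ∷ _ ∷ []) (_ ∷ []) _ _ _ _ _ _ (s≤s ())
    build [] _ _ _ _ _ () _ _ _
    build (_ ∷ _ ∷ _) _ _ _ _ _ () _ _ _
    build (_ ∷ []) [] _ _ _ _ _ () _ _
    build (_ ∷ []) (_ ∷ []) _ _ _ _ _ () _ _
    build (_ ∷ []) (_ ∷ _ ∷ _ ∷ _) _ _ _ _ _ () _ _

-- Every graph on five vertices with minimum degree 2 and three vertices of degree ≥ 3 contains a house; this is
-- decided by evaluating a search on all 2¹⁰ adjacency matrices.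
module FiveVertices where
  ∧-true : ∀ {a b} → a ∧ b ≡ true → a ≡ true × b ≡ true
  ∧-true {true} {true} _ = refl , refl

  allBools : ∀ n → (Vec Bool n → Bool) → Bool
  allBools zero P = P Vec.[]
  allBools (suc n) P = allBools n (λ v → P (true Vec.∷ v)) ∧ allBools n (λ v → P (false Vec.∷ v))

  allBools-sound : ∀ {n} {P : Vec Bool n → Bool} → allBools n P ≡ true → ∀ v → P v ≡ true
  allBools-sound h Vec.[] = h
  allBools-sound {P = P} h (true Vec.∷ v) = allBools-sound {P = λ v → P (true Vec.∷ v)} (proj₁ (∧-true h)) v
  allBools-sound {P = P} h (false Vec.∷ v) = allBools-sound {P = λ v → P (false Vec.∷ v)} (proj₂ (∧-true h)) v

  matrix : Vec Bool 10 → Fin 5 → Fin 5 → Bool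
  matrix (b₀₁ Vec.∷ b₀₂ Vec.∷ b₀₃ Vec.∷ b₀₄ Vec.∷ b₁₂ Vec.∷ b₁₃ Vec.∷ b₁₄ Vec.∷ b₂₃ Vec.∷ b₂₄ Vec.∷ b₃₄ Vec.∷ Vec.[]) i j = Vec.lookup (Vec.lookup rows i) j
    where
    rows : Vec (Vec Bool 5) 5
    rows =
      (false Vec.∷ b₀₁ Vec.∷ b₀₂ Vec.∷ b₀₃ Vec.∷ b₀₄ Vec.∷ Vec.[]) Vec.∷
      (b₀₁ Vec.∷ false Vec.∷ b₁₂ Vec.∷ b₁₃ Vec.∷ b₁₄ Vec.∷ Vec.[]) Vec.∷
      (b₀₂ Vec.∷ b₁₂ Vec.∷ false Vec.∷ b₂₃ Vec.∷ b₂₄ Vec.∷ Vec.[]) Vec.∷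
      (b₀₃ Vec.∷ b₁₃ Vec.∷ b₂₃ Vec.∷ false Vec.∷ b₃₄ Vec.∷ Vec.[]) Vec.∷
      (b₀₄ Vec.∷ b₁₄ Vec.∷ b₂₄ Vec.∷ b₃₄ Vec.∷ false Vec.∷ Vec.[]) Vec.∷ Vec.[]

  -- Opaque, so that the search is only evaluated on concrete matrices.
  opaque
    anyFin : ∀ {n} → (Fin n → Bool) → Bool
    anyFin {zero} P = false
    anyFin {suc n} P = P zero ∨ anyFin (P ∘ suc)

    anyFin-sound : ∀ {n} {P : Fin n → Bool} → anyFin P ≡ true → ∃ λ i → P i ≡ true
    anyFin-sound {suc n} {P} h with P zero in e
    ... | true = zero , e
    ... | false with anyFin-sound {P = P ∘ suc} h
    ...   | i , p = suc i , p

    allFin′ : ∀ {n} → (Fin n → Bool) → Bool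
    allFin′ {zero} P = true
    allFin′ {suc n} P = P zero ∧ allFin′ (P ∘ suc)

    allFin′-complete : ∀ {n} {P : Fin n → Bool} → (∀ i → P i ≡ true) → allFin′ P ≡ true
    allFin′-complete {zero} h = refl
    allFin′-complete {suc n} h = cong₂ _∧_ (h zero) (allFin′-complete (h ∘ suc))

  atLeast : ℕ → ℕ → Bool
  atLeast zero _ = true
  atLeast (suc k) zero = false
  atLeast (suc k) (suc m) = atLeast k m

  ≤⇒atLeast : ∀ {k m} → k ≤ m → atLeast k m ≡ true
  ≤⇒atLeast z≤n = refl
  ≤⇒atLeast (s≤s h) = ≤⇒atLeast h

  module _ (A : Fin 5 → Fin 5 → Bool) where
    degreeOf : Fin 5 → ℕ
    degreeOf i = ∑ (λ j → 𝟙 (A i j))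

    dense : Bool
    dense = allFin′ (λ i → atLeast 2 (degreeOf i)) ∧ atLeast 3 (#≥ 3 degreeOf)

    -- Here and in `stage₃` the four non-adjacent pairs of the house are tested for distinctness;
    -- the other six pairs are edges, hence distinct. Every test is made as soon as its vertices are
    -- chosen, which prunes the search.
    stage₄ : Fin 5 → Fin 5 → Fin 5 → Fin 5 → Fin 5 → Bool
    stage₄ u v w x y = A v y ∧ A x y ∧ not (u == y) ∧ not (w == y)

    stage₃ : Fin 5 → Fin 5 → Fin 5 → Fin 5 → Bool
    stage₃ u v w x = A u x ∧ not (v == x) ∧ not (w == x) ∧ anyFin (stage₄ u v w x)

    stage₂ : Fin 5 → Fin 5 → Fin 5 → Bool
    stage₂ u v w = A u w ∧ A v w ∧ anyFin (stage₃ u v w)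

    stage₁ : Fin 5 → Fin 5 → Bool
    stage₁ u v = A u v ∧ anyFin (stage₂ u v)

    search : Bool
    search = anyFin λ u → anyFin (stage₁ u)

  verdict : (Fin 5 → Fin 5 → Bool) → Bool
  verdict A = not (dense A) ∨ search A

  opaque
    unfolding anyFin allFin′

    verdicts : allBools 10 (λ v → verdict (matrix v)) ≡ true
    verdicts = refl

  not-true : ∀ {b} → not b ≡ true → b ≡ false
  not-true {false} _ = refl

  ==-false : ∀ {n} {i j : Fin n} → (i == j) ≡ false → i ≢ j
  ==-false {i = i} e refl = contradiction (trans (sym (==-refl i)) e) λ ()

  locate : (A : Fin 5 → Fin 5 → Bool) → search A ≡ true → (H : Graph 5) → (∀ i j → A i j ≡ adj H i j) → K5-P4 ⊆G H
  locate A e₀ H A≡ with anyFin-sound e₀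
  ... | u , e₁ with anyFin-sound {P = stage₁ A u} e₁
  ... | v , e₂ with ∧-true {A u v} e₂
  ... | uv , e₃ with anyFin-sound {P = stage₂ A u v} e₃
  ... | w , e₄ with ∧-true {A u w} e₄
  ... | uw , e₅ with ∧-true {A v w} e₅
  ... | vw , e₆ with anyFin-sound {P = stage₃ A u v w} e₆
  ... | x , e₇ with ∧-true {A u x} e₇
  ... | ux , e₈ with ∧-true {not (v == x)} e₈
  ... | v≠x , e₉ with ∧-true {not (w == x)} e₉
  ... | w≠x , e₁₀ with anyFin-sound {P = stage₄ A u v w x} e₁₀
  ... | y , e₁₁ with ∧-true {A v y} e₁₁
  ... | vy , e₁₂ with ∧-true {A x y} e₁₂
  ... | xy , e₁₃ with ∧-true {not (u == y)} e₁₃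
  ... | u≠y , w≠y = house H
    ((loop uv All.∷ loop uw All.∷ loop ux All.∷ distinct u≠y All.∷ All.[]) AllPairs.∷
     (loop vw All.∷ distinct v≠x All.∷ loop vy All.∷ All.[]) AllPairs.∷
     (distinct w≠x All.∷ distinct w≠y All.∷ All.[]) AllPairs.∷ (loop xy All.∷ All.[]) AllPairs.∷ All.[] AllPairs.∷ AllPairs.[])
    (in-H uv) (in-H uw) (in-H vw) (in-H ux) (in-H vy) (in-H xy)
    where
    in-H : ∀ {i j} → A i j ≡ true → adj H i j ≡ true
    in-H {i} {j} e = trans (sym (A≡ i j)) e
    loop : ∀ {i j} → A i j ≡ true → i ≢ j
    loop {i} {j} e = adj⇒≢ H (in-H {i} {j} e)
    distinct : ∀ {n} {i j : Fin n} → not (i == j) ≡ true → i ≢ j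
    distinct e = ==-false (not-true e)

  -- The matrix is a variable that agrees with `H` entry by entry: `matrix upper` and `adj H`
  -- coincide only after a case split on the indices.
  conclude : (A : Fin 5 → Fin 5 → Bool) → verdict A ≡ true → (H : Graph 5) → (∀ i j → A i j ≡ adj H i j) →
    (∀ i → 2 ≤ deg H i) → 3 ≤ #≥ 3 (deg H) → K5-P4 ⊆G H
  conclude A accepted H A≡ min₂ many = locate A (sound accepted is-dense) H A≡
    where
    sound : verdict A ≡ true → dense A ≡ true → search A ≡ true
    sound v d rewrite d = v
    degreeOf≡ : ∀ i → deg H i ≡ degreeOf A i
    degreeOf≡ i = sum-cong-≗ λ j → cong 𝟙 (sym (A≡ i j))
    is-dense : dense A ≡ true
    is-dense = cong₂ _∧_
      (allFin′-complete λ i → ≤⇒atLeast (≤-trans (min₂ i) (≤-reflexive (degreeOf≡ i))))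
      (≤⇒atLeast (≤-trans many (≤-reflexive (sum-cong-≗ λ i → cong (ge 3) (degreeOf≡ i)))))

  module _ (H : Graph 5) where
    private
      upper : Vec Bool 10
      upper = adj H (# 0) (# 1) Vec.∷ adj H (# 0) (# 2) Vec.∷ adj H (# 0) (# 3) Vec.∷ adj H (# 0) (# 4) Vec.∷ adj H (# 1) (# 2) Vec.∷
        adj H (# 1) (# 3) Vec.∷ adj H (# 1) (# 4) Vec.∷ adj H (# 2) (# 3) Vec.∷ adj H (# 2) (# 4) Vec.∷ adj H (# 3) (# 4) Vec.∷ Vec.[]

      A = matrix upper

      A≡ : ∀ i j → A i j ≡ adj H i j
      A≡ zero zero = sym (irrefl H _)
      A≡ zero (suc zero) = refl
      A≡ zero (suc (suc zero)) = refl
      A≡ zero (suc (suc (suc zero))) = refl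
      A≡ zero (suc (suc (suc (suc zero)))) = refl
      A≡ (suc zero) zero = adj-sym H _ _
      A≡ (suc zero) (suc zero) = sym (irrefl H _)
      A≡ (suc zero) (suc (suc zero)) = refl
      A≡ (suc zero) (suc (suc (suc zero))) = refl
      A≡ (suc zero) (suc (suc (suc (suc zero)))) = refl
      A≡ (suc (suc zero)) zero = adj-sym H _ _
      A≡ (suc (suc zero)) (suc zero) = adj-sym H _ _
      A≡ (suc (suc zero)) (suc (suc zero)) = sym (irrefl H _)
      A≡ (suc (suc zero)) (suc (suc (suc zero))) = refl
      A≡ (suc (suc zero)) (suc (suc (suc (suc zero)))) = refl
      A≡ (suc (suc (suc zero))) zero = adj-sym H _ _
      A≡ (suc (suc (suc zero))) (suc zero) = adj-sym H _ _
      A≡ (suc (suc (suc zero))) (suc (suc zero)) = adj-sym H _ _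
      A≡ (suc (suc (suc zero))) (suc (suc (suc zero))) = sym (irrefl H _)
      A≡ (suc (suc (suc zero))) (suc (suc (suc (suc zero)))) = refl
      A≡ (suc (suc (suc (suc zero)))) zero = adj-sym H _ _
      A≡ (suc (suc (suc (suc zero)))) (suc zero) = adj-sym H _ _
      A≡ (suc (suc (suc (suc zero)))) (suc (suc zero)) = adj-sym H _ _
      A≡ (suc (suc (suc (suc zero)))) (suc (suc (suc zero))) = adj-sym H _ _
      A≡ (suc (suc (suc (suc zero)))) (suc (suc (suc (suc zero)))) = sym (irrefl H _)

    house-on-five : (∀ i → 2 ≤ deg H i) → 3 ≤ #≥ 3 (deg H) → K5-P4 ⊆G H
    house-on-five = conclude A (allBools-sound {P = λ v → verdict (matrix v)} verdicts upper) H A≡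

∑-cnt* : ∀ {n} (g : Fin n → ℕ) L → ∑ (λ x → cnt L x * g x) ≡ sum (map g L)
∑-cnt* {n} g [] = ∑-0 {n} {λ _ → 0} λ _ → refl
∑-cnt* g (l ∷ L) = trans (∑-≡+ {f = λ x → δ l x * g x} λ x → *-distribʳ-+ (g x) (δ l x) (cnt L x))
  (cong₂ _+_ (∑-δ* l g) (∑-cnt* g L))

-- The five non-isolated vertices carry all edges, so the graph induced on them has the same
-- degrees, and the exhaustive search applies to it.
five-positive : ∀ {n} (G : Graph n) → #≥ 1 (deg G) ≡ 5 → 3 ≤ #≥ 3 (deg G) → 5 ≤ #≥ 2 (deg G) → K5-P4 ⊆G G
five-positive {n} G N p w with listing (λ x → ge 1 (deg G x))
... | L , c , len = build L c (trans len N)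
  where
  none-1 : #≡ 1 (deg G) ≡ 0
  none-1 = n≤0⇒n≡0 (bound (#≡ 1 (deg G)) (#≥ 2 (deg G)) (trans (sym (#≥-split 1 (deg G))) N) w)
    where
    bound : ∀ a b → a + b ≡ 5 → 5 ≤ b → a ≤ 0
    bound a b e h = lin 0 (h ⊹ ≤-reflexive e) (solve (a ∷ b ∷ []))
  build : ∀ L → (∀ x → cnt L x ≡ ge 1 (deg G x)) → length L ≡ 5 → K5-P4 ⊆G G
  build (a ∷ b ∷ c ∷ e ∷ f ∷ []) mult _ = compose (FiveVertices.house-on-five H min₂ many)
    where
    l : Fin 5 → Fin n
    l = Vec.lookup (a Vec.∷ b Vec.∷ c Vec.∷ e Vec.∷ f Vec.∷ Vec.[])
    H : Graph 5
    adj H i j = adj G (l i) (l j)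
    adj-sym H i j = adj-sym G (l i) (l j)
    irrefl H i = irrefl G (l i)
    over-L : ∀ g → (∀ x → deg G x ≡ 0 → g x ≡ 0) → ∑ g ≡ ∑ (g ∘ l)
    over-L g vanish = trans (sum-cong-≗ pt) (∑-cnt* g (a ∷ b ∷ c ∷ e ∷ f ∷ []))
      where
      pt : ∀ x → g x ≡ cnt (a ∷ b ∷ c ∷ e ∷ f ∷ []) x * g x
      pt x rewrite mult x with deg G x | vanish x
      ... | zero | v = v refl
      ... | suc _ | _ = sym (+-identityʳ (g x))
    deg-H : ∀ i → deg H i ≡ deg G (l i)
    deg-H i = sym (over-L (row G (l i)) λ x dx → cong 𝟙 (trans (adj-sym G (l i) x) (isolated G dx (l i))))
    positive : ∀ i → 1 ≤ ge 1 (deg G (l i))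
    positive i = ≤-trans (member i) (≤-reflexive (mult (l i)))
      where
      member : ∀ i → 1 ≤ cnt (a ∷ b ∷ c ∷ e ∷ f ∷ []) (l i)
      member zero = cnt-self a (b ∷ c ∷ e ∷ f ∷ [])
      member (suc zero) = ≤-trans (cnt-self b (c ∷ e ∷ f ∷ [])) (m≤n+m _ (δ a b))
      member (suc (suc zero)) = ≤-trans (≤-trans (cnt-self c (e ∷ f ∷ [])) (m≤n+m _ (δ b c))) (m≤n+m _ (δ a c))
      member (suc (suc (suc zero))) = ≤-trans (≤-trans (≤-trans (cnt-self e (f ∷ [])) (m≤n+m _ (δ c e))) (m≤n+m _ (δ b e))) (m≤n+m _ (δ a e))
      member (suc (suc (suc (suc zero)))) =
        ≤-trans (≤-trans (≤-trans (≤-trans (cnt-self f []) (m≤n+m _ (δ e f))) (m≤n+m _ (δ c f))) (m≤n+m _ (δ b f))) (m≤n+m _ (δ a f))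
    min₂ : ∀ i → 2 ≤ deg H i
    min₂ i = ≤-trans (ge⇒≤ 2 (deg G (l i)) (≤-trans (positive i) (≤-reflexive (trans (ge-split 1 (deg G (l i)))
      (cong (_+ ge 2 (deg G (l i))) (∑≡0⇒ (λ x → is 1 (deg G x)) none-1 (l i))))))) (≤-reflexive (sym (deg-H i)))
    many : 3 ≤ #≥ 3 (deg H)
    many = ≤-trans p (≤-reflexive (trans (over-L (λ x → ge 3 (deg G x)) (λ x dx → cong (ge 3) dx)) (sum-cong-≗ λ i → cong (ge 3) (sym (deg-H i)))))
    l-inj : ∀ {i j} → l i ≡ l j → i ≡ j
    l-inj {i} {j} with cnt≤1⇒Unique (a ∷ b ∷ c ∷ e ∷ f ∷ []) (λ x → ≤-trans (≤-reflexive (mult x)) (ge≤1 1 (deg G x)))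
    ... | (p₁ All.∷ p₂ All.∷ p₃ All.∷ p₄ All.∷ All.[]) AllPairs.∷ (p₅ All.∷ p₆ All.∷ p₇ All.∷ All.[]) AllPairs.∷
          (p₈ All.∷ p₉ All.∷ All.[]) AllPairs.∷ (p₁₀ All.∷ All.[]) AllPairs.∷ All.[] AllPairs.∷ AllPairs.[] =
      VecUnique.lookup-injective
        ((p₁ VecAll.∷ p₂ VecAll.∷ p₃ VecAll.∷ p₄ VecAll.∷ VecAll.[]) VecPairs.∷ (p₅ VecAll.∷ p₆ VecAll.∷ p₇ VecAll.∷ VecAll.[]) VecPairs.∷
         (p₈ VecAll.∷ p₉ VecAll.∷ VecAll.[]) VecPairs.∷ (p₁₀ VecAll.∷ VecAll.[]) VecPairs.∷ VecAll.[] VecPairs.∷ VecPairs.[]) i j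
    compose : K5-P4 ⊆G H → K5-P4 ⊆G G
    compose (h , h-inj , h-edge) = l ∘ h , (λ e → h-inj (l-inj e)) , h-edge
  build [] _ ()
  build (_ ∷ []) _ ()
  build (_ ∷ _ ∷ []) _ ()
  build (_ ∷ _ ∷ _ ∷ []) _ ()
  build (_ ∷ _ ∷ _ ∷ _ ∷ []) _ ()
  build (_ ∷ _ ∷ _ ∷ _ ∷ _ ∷ _ ∷ _) _ ()

-- Induction by isolating a vertex

-- The realization with a house may differ from `isolate G z`, but `z` is isolated in it too, so
-- joining `z` to its old neighbours restores all degrees.
rejoin : ∀ {n} (G : Graph n) z → 1 ≤ deg G z → Housed false (deg (isolate G z)) → Housed false (deg G)
rejoin G z dz X with ∑>0⇒∃ (row G z) dz
... | y , zy = forget (resp eq (grow X z (deg-isolate-self G z) (adj G z) (irrefl G z) (y , 𝟙>0 zy)))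
  where
  eq : ∀ j → deg (isolate G z) j + 𝟙 (adj G z j) + δ z j * deg G z ≡ deg G j
  eq j = cases (z ≟ j)
    where
    cases : Dec (z ≡ j) → deg (isolate G z) j + 𝟙 (adj G z j) + δ z j * deg G z ≡ deg G j
    cases (yes refl) rewrite deg-isolate-self G z | irrefl G z | δ-refl z = +-identityʳ (deg G z)
    cases (no z≢j) rewrite δ-≢ z≢j = trans (+-identityʳ _) (sym (deg-isolate G z z≢j))

#-nbrs : ∀ {n} → ℕ → Graph n → Fin n → ℕ
#-nbrs k G z = ∑ λ x → row G z x * is k (deg G x)

-- A vertex falls below `k` only if it is `z` or a neighbour of `z` of degree exactly `k`.
survivors : ∀ {n} k (G : Graph n) z → #≥ k (deg G) ≤ #≥ k (deg (isolate G z)) + #-nbrs k G z + ge k (deg G z)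
survivors k G z = ≤-trans (∑-≤+ pt) (≤-reflexive (cong₂ _+_ (∑-distrib-+ (λ x → ge k (deg (isolate G z) x)) (λ x → row G z x * is k (deg G x)))
    (trans (∑-*ʳ (ge k (deg G z)) (δ z)) (trans (cong (_* ge k (deg G z)) (∑-δ z)) (+-identityʳ _)))))
  where
  step : ∀ k m → ge k (suc m) ≤ ge k m + (is k (suc m) + 0)
  step zero m = s≤s z≤n
  step (suc zero) zero = ≤-refl
  step (suc (suc k)) zero = z≤n
  step (suc k) (suc m) = step k m
  pt : ∀ x → ge k (deg G x) ≤ ge k (deg (isolate G z) x) + row G z x * is k (deg G x) + δ z x * ge k (deg G z)
  pt x = cases (z ≟ x)
    where
    neighbour : ∀ m β → ge k (m + 𝟙 β) ≤ ge k m + 𝟙 β * is k (m + 𝟙 β)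
    neighbour m true rewrite +-comm m 1 = step k m
    neighbour m false rewrite +-identityʳ m = m≤m+n _ 0
    cases : Dec (z ≡ x) → ge k (deg G x) ≤ ge k (deg (isolate G z) x) + row G z x * is k (deg G x) + δ z x * ge k (deg G z)
    cases (yes refl) rewrite δ-refl z = ≤-trans (≤-reflexive (sym (+-identityʳ _))) (m≤n+m _ (ge k (deg (isolate G z) z) + row G z z * is k (deg G z)))
    cases (no z≢x) rewrite deg-isolate G z z≢x = ≤-trans (neighbour (deg (isolate G z) x) (adj G z x)) (m≤m+n _ _)

fewer-positive : ∀ {n} (G : Graph n) z → 1 ≤ deg G z → suc (#≥ 1 (deg (isolate G z))) ≤ #≥ 1 (deg G)
fewer-positive G z dz = ≤-trans (≤-reflexive (trans (+-comm 1 _) (cong (#≥ 1 (deg (isolate G z)) +_) (sym (∑-δ z))))) (∑-+≤ pt)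
  where
  mono : ∀ m r → ge 1 m ≤ ge 1 (m + r)
  mono zero r = z≤n
  mono (suc m) r = ≤-refl
  pt : ∀ x → ge 1 (deg (isolate G z) x) + δ z x ≤ ge 1 (deg G x)
  pt x = cases (z ≟ x)
    where
    cases : Dec (z ≡ x) → ge 1 (deg (isolate G z) x) + δ z x ≤ ge 1 (deg G x)
    cases (yes refl) rewrite deg-isolate-self G z | ≤⇒ge dz | δ-refl z = ≤-refl
    cases (no z≢x) rewrite deg-isolate G z z≢x | δ-≢ z≢x = ≤-trans (≤-reflexive (+-identityʳ _)) (mono (deg (isolate G z) x) (row G z x))

-- A neighbour of degree k forces every vertex of larger degree into the neighbourhood of z.
crowded : ∀ {n} k (G : Graph n) z → TopClosed G z → deg G z ≤ k → #-nbrs k G z ≡ 0 ⊎ #-nbrs k G z + #≥ (suc k) (deg G) ≤ deg G z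
crowded k G z top dz with #-nbrs k G z in e
... | zero = inj₁ refl
... | suc m with ∑>0⇒∃ (λ x → row G z x * is k (deg G x)) (subst (1 ≤_) (sym e) (s≤s z≤n))
...   | b , h = inj₂ (subst (λ c → c + #≥ (suc k) (deg G) ≤ deg G z) e (∑-+≤ pt))
  where
  both-factors : ∀ {β m} → 1 ≤ 𝟙 β * m → β ≡ true × 1 ≤ m
  both-factors {true} {suc m} _ = refl , s≤s z≤n
  zb = proj₁ (both-factors {adj G z b} h)
  db = is⇒≡ k (deg G b) (proj₂ (both-factors {adj G z b} h))
  pt : ∀ x → row G z x * is k (deg G x) + ge (suc k) (deg G x) ≤ row G z x
  pt x with adj G z x in zx
  ... | true = ≤-trans (≤-reflexive (trans (cong (_+ ge (suc k) (deg G x)) (+-identityʳ _)) (sym (ge-split k (deg G x))))) (ge≤1 k (deg G x))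
  ... | false with z ≟ x
  ...   | yes refl = ≤-reflexive (<⇒ge≡0 (s≤s dz))
  ...   | no z≢x = ≤-reflexive (<⇒ge≡0 (s≤s (≤-trans (top x b zb zx z≢x) (≤-reflexive db))))

no-nbrs : ∀ {n} k (G : Graph n) z → #≡ k (deg G) ≡ 0 → #-nbrs k G z ≡ 0
no-nbrs k G z e = ∑-0 λ x → trans (cong (row G z x *_) (∑≡0⇒ (λ y → is k (deg G y)) e x)) (*-zeroʳ (row G z x))

-- `p` and `q` count the degrees at least 3 and at least 4, `c` the neighbours of `z` of degree 3,
-- `g` is 1 if `z` is among the `p`, and `p′` counts the survivors. Either no neighbour drops, or
-- `crowded` gives `c + q ≤ δ`; the two numerical hypotheses settle these cases.
three-left : ∀ {p′ p c g δ q} → p ≤ p′ + c + g → c ≡ 0 ⊎ c + q ≤ δ → 3 + g ≤ p → 3 + δ + g ≤ p + q → 3 ≤ p′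
three-left {p′} {p} {_} {g} h (inj₁ refl) h₁ _ = lin 0 (h ⊹ h₁) (solve (p′ ∷ p ∷ g ∷ []))
three-left {p′} {p} {c} {g} {δ} {q} h (inj₂ i) _ h₂ = lin 0 (h ⊹ i ⊹ h₂) (solve (p′ ∷ p ∷ c ∷ g ∷ δ ∷ q ∷ []))

five-left : ∀ {a c g s} → 6 ≤ s → s ≤ a + c + g → c ≡ 0 → g ≤ 1 → 5 ≤ a
five-left {a} {_} {g} {s} h i refl j = lin 0 (h ⊹ i ⊹ j) (solve (a ∷ g ∷ s ∷ []))

#-cong : ∀ {n} {d d′ : Fin n → ℕ} → (∀ x → d′ x ≡ d x) → ∀ (f : ℕ → ℕ) → ∑ (f ∘ d′) ≡ ∑ (f ∘ d)
#-cong e f = sum-cong-≗ λ x → cong f (e x)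

Rich : ∀ {n} → Graph n → Set
Rich G = 3 ≤ #≥ 3 (deg G) × 5 ≤ #≥ 2 (deg G)

module Step {n} k (smaller : (G : Graph n) → #≥ 1 (deg G) ≤ k → Rich G → Housed false (deg G)) where

  delete : (G : Graph n) → ∀ z → #≥ 1 (deg G) ≤ suc k → 1 ≤ deg G z → 3 ≤ #≥ 3 (deg (isolate G z)) → 5 ≤ #≥ 2 (deg (isolate G z)) → Housed false (deg G)
  delete G z N dz left₃ left₅ = rejoin G z dz (smaller (isolate G z) (≤-pred (≤-trans (fewer-positive G z dz) N)) (left₃ , left₅))

  -- All positive degrees are at least 4, so every other non-isolated vertex keeps degree at least
  -- 3.
  delete-4 : (G : Graph n) → ∀ z → #≥ 1 (deg G) ≤ suc k → 4 ≤ deg G z → #≡ 1 (deg G) ≡ 0 → #≡ 2 (deg G) ≡ 0 → #≡ 3 (deg G) ≡ 0 → 6 ≤ #≥ 1 (deg G) → Housed false (deg G)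
  delete-4 G z small dz e₁ e₂ e₃ N = delete G z small (≤-trans (s≤s z≤n) dz) (left 3 p e₃) left₅
    where
    w : 6 ≤ #≥ 2 (deg G)
    w = ≤-trans N (≤-reflexive (trans (#≥-split 1 (deg G)) (cong (_+ #≥ 2 (deg G)) e₁)))
    p : 6 ≤ #≥ 3 (deg G)
    p = ≤-trans w (≤-reflexive (trans (#≥-split 2 (deg G)) (cong (_+ #≥ 3 (deg G)) e₂)))
    left₅ : 5 ≤ #≥ 2 (deg (isolate G z))
    left₅ = five-left w (survivors 2 G z) (no-nbrs 2 G z e₂) (ge≤1 2 (deg G z))
    left : ∀ k → 6 ≤ #≥ k (deg G) → #≡ k (deg G) ≡ 0 → 3 ≤ #≥ k (deg (isolate G z))
    left k h e = ≤-trans (s≤s (s≤s (s≤s z≤n))) (five-left h (survivors k G z) (no-nbrs k G z e) (ge≤1 k (deg G z)))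

  delete-1 : (G : Graph n) → ∀ z → #≥ 1 (deg G) ≤ suc k → TopClosed G z → deg G z ≡ 1 → Rich G → 4 ≤ #≥ 3 (deg G) + #≥ 4 (deg G) → Housed false (deg G)
  delete-1 G z small top dz (p , w) pq = delete G z small (≤-reflexive (sym dz)) left₃ left₅
    where
    c₂ : #-nbrs 2 G z ≡ 0
    -- A neighbour of degree 2 would force all vertices of degree at least 3, of which there are at
    -- least three, into a neighbourhood of size 1.
    c₂ with crowded 2 G z top (≤-trans (≤-reflexive dz) (s≤s z≤n))
    ... | inj₁ e = e
    ... | inj₂ h = contradiction (≤-trans (≤-trans p (m≤n+m _ (#-nbrs 2 G z))) (≤-trans h (≤-reflexive dz))) λ { (s≤s ()) }
    -- `z` has degree 1 and is not counted by `#≥ 2`, so five vertices suffice; for larger degrees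
    -- of `z` a sixth makes up for it.
    left₅ : 5 ≤ #≥ 2 (deg (isolate G z))
    left₅ = arith _ _ _ _ w (survivors 2 G z) c₂ (trans (cong (ge 2) dz) refl)
      where
      arith : ∀ a c g s → 5 ≤ s → s ≤ a + c + g → c ≡ 0 → g ≡ 0 → 5 ≤ a
      arith a _ _ s h i refl refl = lin 0 (h ⊹ i) (solve (a ∷ s ∷ []))
    left₃ : 3 ≤ #≥ 3 (deg (isolate G z))
    left₃ = three-left {δ = 1} (subst (λ m → #≥ 3 (deg G) ≤ #≥ 3 (deg (isolate G z)) + #-nbrs 3 G z + ge 3 m) dz (survivors 3 G z))
      (subst (λ m → #-nbrs 3 G z ≡ 0 ⊎ #-nbrs 3 G z + #≥ 4 (deg G) ≤ m) dz (crowded 3 G z top (≤-trans (≤-reflexive dz) (s≤s z≤n)))) p pq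

  delete-2 : (G : Graph n) → ∀ z → #≥ 1 (deg G) ≤ suc k → TopClosed G z → deg G z ≡ 2 → Rich G → 6 ≤ #≥ 2 (deg G) → 5 ≤ #≥ 3 (deg G) + #≥ 4 (deg G) → Housed false (deg G)
  delete-2 G z small top dz (p , _) w pq = delete G z small (≤-trans (s≤s z≤n) (≤-reflexive (sym dz))) left₃ left₅
    where
    c₂ : #-nbrs 2 G z ≡ 0
    c₂ with crowded 2 G z top (≤-reflexive dz)
    ... | inj₁ e = e
    ... | inj₂ h = contradiction (≤-trans (≤-trans p (m≤n+m _ (#-nbrs 2 G z))) (≤-trans h (≤-reflexive dz))) λ { (s≤s (s≤s ())) }
    left₅ : 5 ≤ #≥ 2 (deg (isolate G z))
    left₅ = five-left w (survivors 2 G z) c₂ (ge≤1 2 (deg G z))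
    left₃ : 3 ≤ #≥ 3 (deg (isolate G z))
    left₃ = three-left {δ = 2} (subst (λ m → #≥ 3 (deg G) ≤ #≥ 3 (deg (isolate G z)) + #-nbrs 3 G z + ge 3 m) dz (survivors 3 G z))
      (subst (λ m → #-nbrs 3 G z ≡ 0 ⊎ #-nbrs 3 G z + #≥ 4 (deg G) ≤ m) dz (crowded 3 G z top (≤-trans (≤-reflexive dz) (s≤s (s≤s z≤n))))) p pq

  delete-3 : (G : Graph n) → ∀ z → #≥ 1 (deg G) ≤ suc k → TopClosed G z → deg G z ≡ 3 → #≡ 2 (deg G) ≡ 0 → 6 ≤ #≥ 3 (deg G) → 7 ≤ #≥ 3 (deg G) + #≥ 4 (deg G) → Housed false (deg G)
  delete-3 G z small top dz e₂ p pq = delete G z small (≤-trans (s≤s z≤n) (≤-reflexive (sym dz))) left₃ left₅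
    where
    w : 6 ≤ #≥ 2 (deg G)
    w = ≤-trans p (≤-reflexive (sym (trans (#≥-split 2 (deg G)) (cong (_+ #≥ 3 (deg G)) e₂))))
    left₅ : 5 ≤ #≥ 2 (deg (isolate G z))
    left₅ = five-left w (survivors 2 G z) (no-nbrs 2 G z e₂) (ge≤1 2 (deg G z))
    left₃ : 3 ≤ #≥ 3 (deg (isolate G z))
    left₃ = three-left {δ = 3} (subst (λ m → #≥ 3 (deg G) ≤ #≥ 3 (deg (isolate G z)) + #-nbrs 3 G z + ge 3 m) dz (survivors 3 G z))
      (subst (λ m → #-nbrs 3 G z ≡ 0 ⊎ #-nbrs 3 G z + #≥ 4 (deg G) ≤ m) dz (crowded 3 G z top (≤-reflexive dz))) (≤-trans (s≤s (s≤s (s≤s (s≤s z≤n)))) p) pq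

attained : ∀ {n} k (d : Fin n → ℕ) {m} → #≡ k d ≡ suc m → ∃ λ z → d z ≡ k
attained k d e with ∑>0⇒∃ (λ x → is k (d x)) (subst (1 ≤_) (sym e) (s≤s z≤n))
... | z , h = z , is⇒≡ k (d z) h

module Cases {n} k (smaller : (G : Graph n) → #≥ 1 (deg G) ≤ k → Rich G → Housed false (deg G))
  (G : Graph n) (small : #≥ 1 (deg G) ≤ suc k) (rich : Rich G) (six : 6 ≤ #≥ 1 (deg G)) where
  open Step k smaller

  private
    d = deg G
    p = #≥ 3 d
    q = #≥ 4 d

  module Closed (z : Fin n) where
    private closed = topClosed-realization G z
    G′ = proj₁ closed
    same = proj₁ (proj₂ closed)
    top = proj₂ (proj₂ closed)

    carry≥ : ∀ {a} j → a ≤ #≥ j d → a ≤ #≥ j (deg G′)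
    carry≥ j h = ≤-trans h (≤-reflexive (sym (#-cong same (ge j))))

    small′ : #≥ 1 (deg G′) ≤ suc k
    small′ = ≤-trans (≤-reflexive (#-cong same (ge 1))) small

    rich′ : Rich G′
    rich′ = carry≥ 3 (proj₁ rich) , carry≥ 2 (proj₂ rich)

    carry+ : ∀ {a} → a ≤ p + q → a ≤ #≥ 3 (deg G′) + #≥ 4 (deg G′)
    carry+ h = ≤-trans h (≤-reflexive (sym (cong₂ _+_ (#-cong same (ge 3)) (#-cong same (ge 4)))))

  with-1 : ∀ {m} → #≡ 1 d ≡ suc m → Housed false d
  with-1 e with 4 ≤? p + q | attained 1 d e
  ... | yes h | z , dz = resp same (delete-1 G′ z small′ top (trans (same z) dz) rich′ (carry+ h))
    where open Closed z
  ... | no ¬h | _ = three-3s (n≤0⇒n≡0 (q-bound p q (proj₁ rich) (≰⇒> ¬h))) (≤-antisym (p-bound p q (≰⇒> ¬h)) (proj₁ rich)) (proj₂ rich)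
    where
    open Families G
    q-bound : ∀ p q → 3 ≤ p → suc (p + q) ≤ 4 → q ≤ 0
    q-bound p q a b = lin 0 (a ⊹ b) (solve (p ∷ q ∷ []))
    p-bound : ∀ p q → suc (p + q) ≤ 4 → p ≤ 3
    p-bound p q a = lin q a (solve (p ∷ q ∷ []))

  at-least-2 : #≡ 1 d ≡ 0 → 6 ≤ #≥ 2 d
  at-least-2 e₁ = ≤-trans six (≤-reflexive (trans (#≥-split 1 d) (cong (_+ #≥ 2 d) e₁)))

  with-2 : #≡ 1 d ≡ 0 → ∀ {m} → #≡ 2 d ≡ suc m → Housed false d
  with-2 e₁ e with 5 ≤? p + q | attained 2 d e
  ... | yes h | z , dz = resp same (delete-2 G′ z small′ top (trans (same z) dz) rich′ (carry≥ 2 (at-least-2 e₁)) (carry+ h))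
    where open Closed z
  ... | no ¬h | _ with classify p q (proj₁ rich) (≰⇒> ¬h)
    where
    classify : ∀ p q → 3 ≤ p → suc (p + q) ≤ 5 → (q ≡ 0 × p ≡ 3) ⊎ (q ≡ 1 × p ≡ 3) ⊎ (q ≡ 0 × p ≡ 4)
    classify 3 0 _ _ = inj₁ (refl , refl)
    classify 3 1 _ _ = inj₂ (inj₁ (refl , refl))
    classify 4 0 _ _ = inj₂ (inj₂ (refl , refl))
    classify 0 _ () _
    classify 1 _ (s≤s ()) _
    classify 2 _ (s≤s (s≤s ())) _
    classify 3 (suc (suc _)) _ (s≤s (s≤s (s≤s (s≤s (s≤s ())))))
    classify 4 (suc _) _ (s≤s (s≤s (s≤s (s≤s (s≤s ())))))
    classify (suc (suc (suc (suc (suc _))))) _ _ (s≤s (s≤s (s≤s (s≤s (s≤s ())))))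
  ...   | inj₁ (q0 , p3) = Families.three-3s G q0 p3 (proj₂ rich)
  ...   | inj₂ (inj₁ (q1 , p3)) = Families₂.big-and-two-3s G e₁ q1 p3 (proj₂ rich)
  ...   | inj₂ (inj₂ (q0 , p4)) = Families₂.four-3s G e₁ q0 p4 (proj₂ rich)

  at-least-3 : #≡ 1 d ≡ 0 → #≡ 2 d ≡ 0 → 6 ≤ p
  at-least-3 e₁ e₂ = ≤-trans (at-least-2 e₁) (≤-reflexive (trans (#≥-split 2 d) (cong (_+ p) e₂)))

  with-3 : #≡ 1 d ≡ 0 → #≡ 2 d ≡ 0 → ∀ {m} → #≡ 3 d ≡ suc m → Housed false d
  with-3 e₁ e₂ e with 7 ≤? p + q | attained 3 d e
  ... | yes h | z , dz = resp same (delete-3 G′ z small′ top (trans (same z) dz) (trans (#-cong same (is 2)) e₂) (carry≥ 3 (at-least-3 e₁ e₂)) (carry+ h))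
    where open Closed z
  ... | no ¬h | _ = Families₂.six-3s G e₁ (n≤0⇒n≡0 (q-bound p q (at-least-3 e₁ e₂) (≰⇒> ¬h))) p6
      (trans (#≥-split 1 d) (trans (cong₂ _+_ e₁ (trans (#≥-split 2 d) (cong (_+ p) e₂))) p6))
    where
    q-bound : ∀ p q → 6 ≤ p → suc (p + q) ≤ 7 → q ≤ 0
    q-bound p q a b = lin 0 (a ⊹ b) (solve (p ∷ q ∷ []))
    p-bound : ∀ p q → suc (p + q) ≤ 7 → p ≤ 6
    p-bound p q a = lin q a (solve (p ∷ q ∷ []))
    p6 = ≤-antisym (p-bound p q (≰⇒> ¬h)) (at-least-3 e₁ e₂)

  all-4 : #≡ 1 d ≡ 0 → #≡ 2 d ≡ 0 → #≡ 3 d ≡ 0 → Housed false d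
  all-4 e₁ e₂ e₃ with ∑>0⇒∃ (λ x → ge 4 (d x)) (≤-trans (s≤s z≤n) (≤-trans (at-least-3 e₁ e₂) (≤-reflexive (trans (#≥-split 3 d) (cong (_+ q) e₃)))))
  ... | z , h = delete-4 G z small (ge⇒≤ 4 (d z) h) e₁ e₂ e₃ six

  -- The first nonzero count among the degrees 1, 2, 3 belongs to the minimum positive degree.
  conclusion : Housed false d
  conclusion with #≡ 1 d in e₁
  ... | suc _ = with-1 e₁
  ... | zero with #≡ 2 d in e₂
  ...   | suc _ = with-2 e₁ e₂
  ...   | zero with #≡ 3 d in e₃
  ...     | suc _ = with-3 e₁ e₂ e₃
  ...     | zero = all-4 e₁ e₂ e₃

-- `k` bounds the number of non-isolated vertices; if there are fewer than six, the second half of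
-- `Rich` makes them exactly five.
rich⇒housed : ∀ {n} k (G : Graph n) → #≥ 1 (deg G) ≤ k → Rich G → Housed false (deg G)
rich⇒housed zero G small (_ , w) = contradiction (≤-trans w (≤-trans (∑-mono λ x → ge-anti 1 (deg G x)) small)) λ ()
rich⇒housed (suc k) G small rich with 6 ≤? #≥ 1 (deg G)
... | yes six = Cases.conclusion k (rich⇒housed k) G small rich six
... | no ¬six = housed G (λ _ → refl) (five-positive G (≤-antisym (≤-pred (≰⇒> ¬six)) (≤-trans (proj₂ rich) (∑-mono λ x → ge-anti 1 (deg G x)))) (proj₁ rich) (proj₂ rich)) λ ()

-- Sequences with exactly two terms ≥ 3

All≢⇒cnt≡0 : ∀ {n} {l : Fin n} {L} → All (l ≢_) L → cnt L l ≡ 0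
All≢⇒cnt≡0 All.[] = refl
All≢⇒cnt≡0 (l≢k All.∷ h) rewrite δ-≢ (l≢k ∘ sym) = All≢⇒cnt≡0 h

Unique⇒cnt≤1 : ∀ {n} {L : List (Fin n)} → Unique L → ∀ x → cnt L x ≤ 1
Unique⇒cnt≤1 AllPairs.[] x = z≤n
Unique⇒cnt≤1 {L = l ∷ L} (h AllPairs.∷ U) x with l ≟ x
... | yes refl = ≤-reflexive (cong suc (All≢⇒cnt≡0 h))
... | no _ = Unique⇒cnt≤1 U x

distinct-nbrs : ∀ {n} (G : Graph n) z {L} → Unique L → sum (map (row G z) L) ≤ deg G z
distinct-nbrs G z {L} U = ≤-trans (≤-reflexive (sym (∑-cnt* (row G z) L)))
  (∑-mono λ x → ≤-trans (*-monoˡ-≤ (row G z x) (Unique⇒cnt≤1 U x)) (≤-reflexive (+-identityʳ _)))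

distinct-nbrs₂ : ∀ {n} (G : Graph n) z {u v} → u ≢ v → row G z u + row G z v ≤ deg G z
distinct-nbrs₂ G z {u} {v} u≢v = ≤-trans (≤-reflexive (cong (row G z u +_) (sym (+-identityʳ (row G z v)))))
  (distinct-nbrs G z {u ∷ v ∷ []} ((u≢v All.∷ All.[]) AllPairs.∷ All.[] AllPairs.∷ AllPairs.[]))

distinct-nbrs₃ : ∀ {n} (G : Graph n) z {u v w} → u ≢ v → u ≢ w → v ≢ w → row G z u + row G z v + row G z w ≤ deg G z
distinct-nbrs₃ G z {u} {v} {w} u≢v u≢w v≢w =
  ≤-trans (≤-reflexive (trans (+-assoc (row G z u) _ _) (cong (λ k → row G z u + (row G z v + k)) (sym (+-identityʳ (row G z w))))))
  (distinct-nbrs G z {u ∷ v ∷ w ∷ []} ((u≢v All.∷ u≢w All.∷ All.[]) AllPairs.∷ (v≢w All.∷ All.[]) AllPairs.∷ All.[] AllPairs.∷ AllPairs.[]))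

-- Equals the degree up to 2 and vanishes on the hubs, so its sum is the degree sum of the remaining
-- vertices.
upTo2 : ℕ → ℕ
upTo2 m = 2 * is 2 m + is 1 m

low-small : ∀ {m} → m ≤ 2 → m ≡ upTo2 m
low-small {0} _ = refl
low-small {1} _ = refl
low-small {2} _ = refl
low-small {suc (suc (suc _))} (s≤s (s≤s ()))

low-exclusive : ∀ m → is 2 m + is 1 m ≤ 1
low-exclusive 0 = z≤n
low-exclusive 1 = ≤-refl
low-exclusive 2 = ≤-refl
low-exclusive (suc (suc (suc m))) = z≤n

low-hub : ∀ {m} → 3 ≤ m → is 2 m ≡ 0 × is 1 m ≡ 0
low-hub {suc (suc (suc m))} _ = refl , refl
low-hub {0} ()
low-hub {1} (s≤s ())
low-hub {2} (s≤s (s≤s ()))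

∑-low : ∀ {n} (d : Fin n → ℕ) → ∑ (upTo2 ∘ d) ≡ 2 * #≡ 2 d + #≡ 1 d
∑-low d = trans (∑-≡+ {f = λ j → 2 * is 2 (d j)} λ _ → refl) (cong (_+ #≡ 1 d) (∑-*ˡ 2 (is 2 ∘ d)))

module TwoHubs {n} (G : Graph n) {u v : Fin n} (u≢v : u ≢ v) (3≤u : 3 ≤ deg G u) (3≤v : 3 ≤ deg G v)
  (others : ∀ x → u ≢ x → v ≢ x → deg G x ≤ 2) where

  private
    d : Fin n → ℕ
    d = deg G

  hub-form : ∀ x → d x ≡ d u * δ u x + d v * δ v x + upTo2 (d x)
  hub-form x = cases (u ≟ x) (v ≟ x)
    where
    cases : Dec (u ≡ x) → Dec (v ≡ x) → d x ≡ d u * δ u x + d v * δ v x + upTo2 (d x)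
    cases (yes refl) _ rewrite δ-refl u | δ-≢ (u≢v ∘ sym) | proj₁ (low-hub 3≤u) | proj₂ (low-hub 3≤u) = tidy (d u) (d v)
      where
      tidy : ∀ a b → a ≡ a * 1 + b * 0 + 0
      tidy = solve-∀
    cases (no u≢x) (yes refl) rewrite δ-refl v | δ-≢ u≢x | proj₁ (low-hub 3≤v) | proj₂ (low-hub 3≤v) = tidy (d u) (d v)
      where
      tidy : ∀ a b → b ≡ a * 0 + b * 1 + 0
      tidy = solve-∀
    cases (no u≢x) (no v≢x) rewrite δ-≢ u≢x | δ-≢ v≢x | *-zeroʳ (d u) | *-zeroʳ (d v) = low-small (others x u≢x v≢x)

  degree-sum : ∑ d ≡ d u + d v + (2 * #≡ 2 d + #≡ 1 d)
  degree-sum = trans (∑-≡+ {f = λ x → d u * δ u x + d v * δ v x} hub-form) (cong₂ _+_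
    (trans (∑-distrib-+ (λ x → d u * δ u x) (λ x → d v * δ v x)) (cong₂ _+_ (weigh (d u) u) (weigh (d v) v))) (∑-low d))
    where
    weigh : ∀ c x → ∑ (λ y → c * δ x y) ≡ c
    weigh c x = trans (∑-*ˡ c (δ x)) (trans (cong (c *_) (∑-δ x)) (*-identityʳ c))

  -- Edges at the hubs are counted from the other end: a non-hub receives at most its degree, and
  -- each hub at most one edge from the other hub, whence the final 2.
  hub-bound : d u + d v ≤ 2 * #≡ 2 d + #≡ 1 d + 2
  hub-bound = ≤-trans (∑-+≤ pt) (≤-reflexive (trans (∑-≡+ {f = upTo2 ∘ d} {g = λ x → δ u x + δ v x} λ _ → refl)
    (cong₂ _+_ (∑-low d) (trans (∑-distrib-+ (δ u) (δ v)) (cong₂ _+_ (∑-δ u) (∑-δ v))))))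
    where
    pt : ∀ x → row G u x + row G v x ≤ upTo2 (d x) + (δ u x + δ v x)
    pt x = cases (u ≟ x) (v ≟ x)
      where
      cases : Dec (u ≡ x) → Dec (v ≡ x) → row G u x + row G v x ≤ upTo2 (d x) + (δ u x + δ v x)
      cases (yes refl) _ rewrite irrefl G u | δ-refl u = ≤-trans (𝟙≤1 (adj G v u)) (≤-trans (m≤m+n 1 (δ v u)) (m≤n+m _ (upTo2 (d u))))
      cases (no _) (yes refl) rewrite irrefl G v | δ-refl v | +-identityʳ (row G u v) =
        ≤-trans (𝟙≤1 (adj G u v)) (≤-trans (m≤n+m 1 (δ u v)) (m≤n+m _ (upTo2 (d v))))
      cases (no u≢x) (no v≢x) = ≤-trans (≤-reflexive (cong₂ _+_ (row-sym G u x) (row-sym G v x)))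
        (≤-trans (distinct-nbrs₂ G x u≢v) (≤-trans (≤-reflexive (low-small (others x u≢x v≢x))) (m≤m+n _ _)))

  -- `x` and `y` each spend one edge on the other, so two fewer are left for the hubs; this cancels
  -- the 2 of `hub-bound`.
  hub-bound-with-edge : ∀ {x y} → adj G x y ≡ true → u ≢ x → v ≢ x → u ≢ y → v ≢ y → d u + d v ≤ 2 * #≡ 2 d + #≡ 1 d
  hub-bound-with-edge {x} {y} xy u≢x v≢x u≢y v≢y = +-cancelʳ-≤ 2 _ _ (≤-trans
    (≤-reflexive (sym (cong₂ _+_ (∑-distrib-+ (row G u) (row G v)) (trans (∑-distrib-+ (δ x) (δ y)) (cong₂ _+_ (∑-δ x) (∑-δ y))))))
    (≤-trans (∑-+≤ pt) (≤-reflexive (trans (∑-≡+ {f = upTo2 ∘ d} {g = λ x → δ u x + δ v x} λ _ → refl)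
    (cong₂ _+_ (∑-low d) (trans (∑-distrib-+ (δ u) (δ v)) (cong₂ _+_ (∑-δ u) (∑-δ v))))))))
    where
    third : ∀ z w → adj G z w ≡ true → u ≢ w → v ≢ w → u ≢ z → v ≢ z → row G u z + row G v z + 1 ≤ upTo2 (d z) + (δ u z + δ v z)
    third z w zw u≢w v≢w u≢z v≢z = ≤-trans (≤-reflexive (cong₂ _+_ (cong₂ _+_ (row-sym G u z) (row-sym G v z)) (sym (cong 𝟙 zw))))
      (≤-trans (distinct-nbrs₃ G z u≢v u≢w v≢w) (≤-trans (≤-reflexive (low-small (others z u≢z v≢z))) (m≤m+n _ _)))
    x≢y = adj⇒≢ G xy
    pt : ∀ z → row G u z + row G v z + (δ x z + δ y z) ≤ upTo2 (d z) + (δ u z + δ v z)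
    pt z = cases (u ≟ z) (v ≟ z) (x ≟ z) (y ≟ z)
      where
      cases : Dec (u ≡ z) → Dec (v ≡ z) → Dec (x ≡ z) → Dec (y ≡ z) → row G u z + row G v z + (δ x z + δ y z) ≤ upTo2 (d z) + (δ u z + δ v z)
      cases (yes refl) _ _ _ rewrite irrefl G u | δ-refl u | δ-≢ (u≢x ∘ sym) | δ-≢ (u≢y ∘ sym) | +-identityʳ (row G v u) =
        ≤-trans (𝟙≤1 (adj G v u)) (≤-trans (m≤m+n 1 (δ v u)) (m≤n+m _ (upTo2 (d u))))
      cases (no _) (yes refl) _ _ rewrite irrefl G v | δ-refl v | δ-≢ (v≢x ∘ sym) | δ-≢ (v≢y ∘ sym) | +-identityʳ (row G u v) | +-identityʳ (row G u v) =
        ≤-trans (𝟙≤1 (adj G u v)) (≤-trans (m≤n+m 1 (δ u v)) (m≤n+m _ (upTo2 (d v))))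
      cases (no u≢z) (no v≢z) (yes refl) _ rewrite δ-refl x | δ-≢ (x≢y ∘ sym) = third x y xy u≢y v≢y u≢z v≢z
      cases (no u≢z) (no v≢z) (no x≢z) (yes refl) rewrite δ-refl y | δ-≢ x≢z = third y x (trans (adj-sym G y x) xy) u≢x v≢x u≢z v≢z
      cases (no u≢z) (no v≢z) (no x≢z) (no y≢z) rewrite δ-≢ x≢z | δ-≢ y≢z | +-identityʳ (row G u z + row G v z) =
        ≤-trans (≤-reflexive (cong₂ _+_ (row-sym G u z) (row-sym G v z)))
          (≤-trans (distinct-nbrs₂ G z u≢v) (≤-trans (≤-reflexive (low-small (others z u≢z v≢z))) (m≤m+n _ _)))

  -- The base house takes both hubs and three vertices of degree 2; the derivation handles what
  -- remains.
  hubs-housed : ∀ {e A B S R} → d u ≡ 3 + A → d v ≡ 3 + B → #≡ 2 d ≡ 3 + S → #≡ 1 d ≡ R → Deriv e A B S R → Housed false d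
  hubs-housed {A = A} {B} {S} {R} du dv n2 n1 D with listing (is 2 ∘ d) | listing (is 1 ∘ d)
  ... | L₂ , c₂ , l₂ | L₁ , c₁ , l₁ = build L₂ c₂ (trans l₂ n2)
    where
    build : ∀ L₂ → (∀ j → cnt L₂ j ≡ is 2 (d j)) → length L₂ ≡ 3 + S → Housed false d
    build (w ∷ x ∷ y ∷ L₂) c₂ refl = forget (resp eq (R.realize D L₂ L₁ refl (trans l₁ n1) fresh-lists))
      where
      open Five u v w x y
      counted : ∀ j → δ u j + δ v j + cnt (w ∷ x ∷ y ∷ L₂) j + cnt L₁ j ≤ 1
      counted j rewrite c₂ j | c₁ j = cases (u ≟ j) (v ≟ j)
        where
        cases : Dec (u ≡ j) → Dec (v ≡ j) → δ u j + δ v j + is 2 (d j) + is 1 (d j) ≤ 1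
        cases (yes refl) _ rewrite δ-refl u | δ-≢ (u≢v ∘ sym) | proj₁ (low-hub 3≤u) | proj₂ (low-hub 3≤u) = ≤-refl
        cases (no u≢j) (yes refl) rewrite δ-refl v | δ-≢ u≢j | proj₁ (low-hub 3≤v) | proj₂ (low-hub 3≤v) = ≤-refl
        cases (no u≢j) (no v≢j) rewrite δ-≢ u≢j | δ-≢ v≢j = low-exclusive (d j)
      fresh-lists : ∀ j → cnt five j + cnt L₂ j + cnt L₁ j ≤ 1
      fresh-lists j = ≤-trans (≤-reflexive (perm (δ u j) (δ v j) (δ w j) (δ x j) (δ y j) (cnt L₂ j) (cnt L₁ j))) (counted j)
        where
        perm : ∀ u v w x y s t → u + (v + (w + (x + (y + 0)))) + s + t ≡ u + v + (w + (x + (y + s))) + t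
        perm = solve-∀
      distinct : Unique₅ u v w x y
      distinct = cnt≤1⇒Unique five λ j → ≤-trans (≤-trans (m≤m+n _ (cnt L₂ j)) (m≤m+n _ (cnt L₁ j))) (fresh-lists j)
      module R = Realize {u = u} {v} u≢v _ (cnt five) (bareHouse distinct) (cnt-self u (v ∷ w ∷ x ∷ y ∷ []))
        (≤-trans (cnt-self v (w ∷ x ∷ y ∷ [])) (m≤n+m _ (δ u v))) (five-support _ 3 3 2 2 2 λ _ → refl)
      eq : ∀ j → R.target A B L₂ L₁ j ≡ d j
      eq j = trans (collect (δ u j) (δ v j) (δ w j) (δ x j) (δ y j) (cnt L₂ j) (cnt L₁ j) A B)
        (trans (cong₂ (λ s t → (3 + A) * δ u j + (3 + B) * δ v j + (2 * s + t)) (c₂ j) (c₁ j))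
          (trans (cong₂ (λ s t → s * δ u j + t * δ v j + upTo2 (d j)) (sym du) (sym dv)) (sym (hub-form j))))
        where
        collect : ∀ u v w x y s t A B → 3 * u + 3 * v + 2 * w + 2 * x + 2 * y + A * u + B * v + 2 * s + t ≡
          (3 + A) * u + (3 + B) * v + (2 * (w + (x + (y + s))) + t)
        collect = solve-∀
    build [] _ ()
    build (_ ∷ []) _ ()
    build (_ ∷ _ ∷ []) _ ()

-- Graphs that contain a house

∑-1 : ∀ n → ∑ {n} (λ _ → 1) ≡ n
∑-1 zero = refl
∑-1 (suc n) = cong suc (∑-1 n)

-- If `x` were missed, the neighbours of `u` together with `u` and `x` would be `n + 1` distinct
-- vertices.
dominating : ∀ {n} (G : Graph n) {u x} → suc (deg G u) ≡ n → u ≢ x → adj G x u ≡ true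
dominating {n} G {u} {x} du u≢x with adj G x u in xu
... | true = refl
... | false = contradiction (≤-trans (≤-reflexive (cong₂ _+_ (sym du) (sym (∑-δ x)))) (≤-trans (≤-reflexive (cong (_+ ∑ (δ x)) (+-comm 1 (deg G u))))
    (≤-trans (≤-reflexive (cong (_+ ∑ (δ x)) (trans (cong (deg G u +_) (sym (∑-δ u))) (sym (∑-distrib-+ (row G u) (δ u))))))
      (≤-trans (∑-+≤ pt) (≤-reflexive (∑-1 n)))))) (<⇒≱ (≤-reflexive (+-comm 1 n)))
  where
  pt : ∀ y → row G u y + δ u y + δ x y ≤ 1
  pt y with u ≟ y | x ≟ y
  ... | yes refl | yes refl = contradiction refl u≢x
  ... | yes refl | no _ rewrite irrefl G u = ≤-refl
  ... | no _ | yes refl rewrite adj-sym G u x | xu = ≤-refl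
  ... | no _ | no _ rewrite +-identityʳ (row G u y) | +-identityʳ (row G u y) = 𝟙≤1 (adj G u y)

no-injection : ∀ {k n} (g : Fin (suc k) → Fin n) → (∀ {i j} → g i ≡ g j → i ≡ j) → (∀ i → toℕ (g i) < k) → ⊥
no-injection {k} g inj small with pigeonhole (n<1+n k) (λ i → fromℕ< (small i))
... | i , j , i<j , e = <⇒≢ i<j (cong toℕ (inj (toℕ-injective (fromℕ<-injective _ _ (small i) (small j) e))))

module Necessity {m} (G : Graph (5 + m)) (H : K5-P4 ⊆G G) where
  private
    f = proj₁ H
    f-inj = proj₁ (proj₂ H)
    edge = proj₂ (proj₂ H)

    d : Fin (5 + m) → ℕ
    d = deg G

    h₀ h₁ h₂ h₃ h₄ : Fin (5 + m)
    h₀ = f (# 0)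
    h₁ = f (# 1)
    h₂ = f (# 2)
    h₃ = f (# 3)
    h₄ = f (# 4)

    apart : ∀ {i j} → i ≢ j → f i ≢ f j
    apart i≢j e = i≢j (f-inj e)

    pair-nbrs : ∀ i j k → j ≢ k → adj K5-P4 i j ≡ true → adj K5-P4 i k ≡ true → 2 ≤ d (f i)
    pair-nbrs i j k j≢k ij ik = ≤-trans (≤-reflexive (sym (cong₂ _+_ (cong 𝟙 (edge i j ij)) (cong 𝟙 (edge i k ik)))))
      (distinct-nbrs₂ G (f i) (apart j≢k))

    triple-nbrs : ∀ i {a b c} → a ≢ b → a ≢ c → b ≢ c → adj G (f i) a ≡ true → adj G (f i) b ≡ true → adj G (f i) c ≡ true → 3 ≤ d (f i)
    triple-nbrs i a≢b a≢c b≢c ia ib ic = ≤-trans (≤-reflexive (sym (cong₂ _+_ (cong₂ _+_ (cong 𝟙 ia) (cong 𝟙 ib)) (cong 𝟙 ic))))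
      (distinct-nbrs₃ G (f i) a≢b a≢c b≢c)

  house-deg₂ : ∀ i → 2 ≤ d (f i)
  house-deg₂ zero = pair-nbrs _ (# 2) (# 3) (λ ()) refl refl
  house-deg₂ (suc zero) = pair-nbrs _ (# 3) (# 4) (λ ()) refl refl
  house-deg₂ (suc (suc zero)) = pair-nbrs _ (# 0) (# 4) (λ ()) refl refl
  house-deg₂ (suc (suc (suc zero))) = pair-nbrs _ (# 0) (# 1) (λ ()) refl refl
  house-deg₂ (suc (suc (suc (suc zero)))) = pair-nbrs _ (# 0) (# 1) (λ ()) refl refl

  house-deg₃ˡ : 3 ≤ d h₀
  house-deg₃ˡ = triple-nbrs (# 0) (apart {# 2} {# 3} λ ()) (apart {# 2} {# 4} λ ()) (apart {# 3} {# 4} λ ()) (edge _ _ refl) (edge _ _ refl) (edge _ _ refl)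

  house-deg₃ʳ : 3 ≤ d h₄
  house-deg₃ʳ = triple-nbrs (# 4) (apart {# 0} {# 1} λ ()) (apart {# 0} {# 2} λ ()) (apart {# 1} {# 2} λ ()) (edge _ _ refl) (edge _ _ refl) (edge _ _ refl)

  -- Otherwise both house vertices of degree 3 would be the first vertex.
  second≥3 : (∀ j → d (suc j) ≤ d (# 1)) → 3 ≤ d (# 1)
  second≥3 mono with 3 ≤? d (# 1)
  ... | yes h = h
  ... | no ¬h = contradiction (f-inj (trans (first h₀ house-deg₃ˡ) (sym (first h₄ house-deg₃ʳ)))) λ ()
    where
    first : ∀ x → 3 ≤ d x → x ≡ zero
    first zero _ = refl
    first (suc j) h = contradiction (≤-trans h (mono j)) ¬h

  -- Otherwise the five house vertices, all of degree at least 2, would lie among the first four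
  -- vertices.
  fifth≥2 : (∀ j → d (suc (suc (suc (suc j)))) ≤ d (# 4)) → 2 ≤ d (# 4)
  fifth≥2 mono = cases (2 ≤? d (# 4))
    where
    cases : Dec (2 ≤ d (# 4)) → 2 ≤ d (# 4)
    cases (yes h) = h
    cases (no ¬h) = ⊥-elim (no-injection f f-inj λ i → early (f i) (house-deg₂ i))
      where
      early : ∀ x → 2 ≤ d x → toℕ x < 4
      early zero _ = s≤s z≤n
      early (suc zero) _ = s≤s (s≤s z≤n)
      early (suc (suc zero)) _ = s≤s (s≤s (s≤s z≤n))
      early (suc (suc (suc zero))) _ = s≤s (s≤s (s≤s (s≤s z≤n)))
      early (suc (suc (suc (suc j)))) h = ⊥-elim (¬h (≤-trans h (mono j)))

  module LowTail (low-tail : ∀ j → d (suc (suc j)) ≤ 2) where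
    private
      u v : Fin (5 + m)
      u = # 0
      v = # 1

      hub : ∀ x → 3 ≤ d x → x ≡ u ⊎ x ≡ v
      hub zero _ = inj₁ refl
      hub (suc zero) _ = inj₂ refl
      hub (suc (suc j)) h = contradiction h (<⇒≱ (s≤s (low-tail j)))

      -- Only the first two vertices can have degree 3, so they are `h₀` and `h₄` in one order or
      -- the other.
      roles : (h₀ ≡ u × h₄ ≡ v) ⊎ (h₀ ≡ v × h₄ ≡ u)
      roles = combine (hub h₀ house-deg₃ˡ) (hub h₄ house-deg₃ʳ)
        where
        combine : h₀ ≡ u ⊎ h₀ ≡ v → h₄ ≡ u ⊎ h₄ ≡ v → (h₀ ≡ u × h₄ ≡ v) ⊎ (h₀ ≡ v × h₄ ≡ u)
        combine (inj₁ e) (inj₂ e′) = inj₁ (e , e′)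
        combine (inj₂ e) (inj₁ e′) = inj₂ (e , e′)
        combine (inj₁ e) (inj₁ e′) = ⊥-elim (apart {# 0} {# 4} (λ ()) (trans e (sym e′)))
        combine (inj₂ e) (inj₂ e′) = ⊥-elim (apart {# 0} {# 4} (λ ()) (trans e (sym e′)))

    not-hub : ∀ i → # 0 ≢ i → # 4 ≢ i → u ≢ f i × v ≢ f i
    not-hub i i≢0 i≢4 = cases roles
      where
      cases : (h₀ ≡ u × h₄ ≡ v) ⊎ (h₀ ≡ v × h₄ ≡ u) → u ≢ f i × v ≢ f i
      cases (inj₁ (e , e′)) = (λ p → i≢0 (f-inj (trans e p))) , λ p → i≢4 (f-inj (trans e′ p))
      cases (inj₂ (e , e′)) = (λ p → i≢4 (f-inj (trans e′ p))) , λ p → i≢0 (f-inj (trans e p))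

    others : ∀ x → u ≢ x → v ≢ x → d x ≤ 2
    others zero u≢ _ = contradiction refl u≢
    others (suc zero) _ v≢ = contradiction refl v≢
    others (suc (suc j)) _ _ = low-tail j

    private
      low-vertex : ∀ i → # 0 ≢ i → # 4 ≢ i → d (f i) ≤ 2
      low-vertex i i≢0 i≢4 = others (f i) (proj₁ (not-hub i i≢0 i≢4)) (proj₂ (not-hub i i≢0 i≢4))

    -- Of the edge `h₁h₃`, the end missed by `h₀` in the house is `h₁`, and the end missed by `h₄`
    -- is `h₃`; that end would become adjacent to the dominating vertex.
    first-not-dominating : d u ≢ 4 + m
    first-not-dominating du = cases roles
      where
      cases : (h₀ ≡ u × h₄ ≡ v) ⊎ (h₀ ≡ v × h₄ ≡ u) → ⊥
      cases (inj₁ (e , _)) = <⇒≱ (s≤s (low-vertex (# 1) (λ ()) λ ()))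
        (triple-nbrs (# 1) (apart {# 3} {# 4} λ ()) (apart {# 3} {# 0} λ ()) (apart {# 4} {# 0} λ ()) (edge _ _ refl) (edge _ _ refl)
          (subst (λ x → adj G h₁ x ≡ true) (sym e) (dominating G (cong suc du) (proj₁ (not-hub (# 1) (λ ()) λ ())))))
      cases (inj₂ (_ , e)) = <⇒≱ (s≤s (low-vertex (# 3) (λ ()) λ ()))
        (triple-nbrs (# 3) (apart {# 0} {# 1} λ ()) (apart {# 0} {# 4} λ ()) (apart {# 1} {# 4} λ ()) (edge _ _ refl) (edge _ _ refl)
          (subst (λ x → adj G h₃ x ≡ true) (sym e) (dominating G (cong suc du) (proj₁ (not-hub (# 3) (λ ()) λ ())))))

    hubs-not-saturated : 3 ≤ d u → 3 ≤ d v → d u + d v ≤ 2 * #≡ 2 d + #≡ 1 d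
    hubs-not-saturated 3≤u 3≤v = TwoHubs.hub-bound-with-edge G {u} {v} (λ ()) 3≤u 3≤v others
      (edge (# 1) (# 3) refl) (proj₁ n₁) (proj₂ n₁) (proj₁ n₃) (proj₂ n₃)
      where
      n₁ = not-hub (# 1) (λ ()) λ ()
      n₃ = not-hub (# 3) (λ ()) λ ()

    -- With degrees (3², 2ⁿ⁻²) the house is a component, and the vertices outside it still need degree 2.
    eight-vertices : d u ≤ 3 → d v ≤ 3 → (∀ j → 2 ≤ d (suc (suc j))) → 1 ≤ m → 3 ≤ m
    eight-vertices u≤3 v≤3 ≥2 1≤m = conclude (any? (λ z → cnt hs z ℕ.≟ 0))
      where
      hs = h₀ ∷ h₁ ∷ h₂ ∷ h₃ ∷ h₄ ∷ []
      total : ∑ (cnt hs) ≡ 5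
      total = trans (sum-cong-≗ λ x → sym (*-identityʳ (cnt hs x))) (∑-cnt* (λ _ → 1) hs)
      hs-unique : Unique hs
      hs-unique =
        (apart {# 0} {# 1} (λ ()) All.∷ apart {# 0} {# 2} (λ ()) All.∷ apart {# 0} {# 3} (λ ()) All.∷ apart {# 0} {# 4} (λ ()) All.∷ All.[]) AllPairs.∷
        (apart {# 1} {# 2} (λ ()) All.∷ apart {# 1} {# 3} (λ ()) All.∷ apart {# 1} {# 4} (λ ()) All.∷ All.[]) AllPairs.∷
        (apart {# 2} {# 3} (λ ()) All.∷ apart {# 2} {# 4} (λ ()) All.∷ All.[]) AllPairs.∷
        (apart {# 3} {# 4} (λ ()) All.∷ All.[]) AllPairs.∷ All.[] AllPairs.∷ AllPairs.[]
      ≤3 : ∀ x → d x ≤ 3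
      ≤3 zero = u≤3
      ≤3 (suc zero) = v≤3
      ≤3 (suc (suc j)) = ≤-trans (low-tail j) (n≤1+n 2)
      quadruple : ∀ i {a b c e} → Unique (a ∷ b ∷ c ∷ e ∷ []) → adj G (f i) a ≡ true → adj G (f i) b ≡ true → adj G (f i) c ≡ true → adj G (f i) e ≡ true → 4 ≤ d (f i)
      quadruple i U ia ib ic ie = ≤-trans (≤-reflexive (sym (cong₂ _+_ (cong 𝟙 ia) (cong₂ _+_ (cong 𝟙 ib) (cong₂ _+_ (cong 𝟙 ic) (cong (_+ 0) (cong 𝟙 ie)))))))
        (distinct-nbrs G (f i) U)
      -- Every house vertex already has its full degree inside the house: 3 at the two hubs, 2
      -- elsewhere.
      outside : ∀ {z} → All (z ≢_) hs → ∀ i → adj G (f i) z ≢ true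
      outside (_ All.∷ _ All.∷ z≢2 All.∷ z≢3 All.∷ z≢4 All.∷ _) zero a = contradiction (≤3 h₀) (<⇒≱ (quadruple (# 0)
        ((z≢2 All.∷ z≢3 All.∷ z≢4 All.∷ All.[]) AllPairs.∷ (apart {# 2} {# 3} (λ ()) All.∷ apart {# 2} {# 4} (λ ()) All.∷ All.[]) AllPairs.∷
          (apart {# 3} {# 4} (λ ()) All.∷ All.[]) AllPairs.∷ All.[] AllPairs.∷ AllPairs.[]) a (edge _ _ refl) (edge _ _ refl) (edge _ _ refl)))
      outside (_ All.∷ _ All.∷ _ All.∷ z≢3 All.∷ z≢4 All.∷ _) (suc zero) a = contradiction (low-vertex (# 1) (λ ()) λ ())
        (<⇒≱ (triple-nbrs (# 1) z≢3 z≢4 (apart {# 3} {# 4} λ ()) a (edge _ _ refl) (edge _ _ refl)))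
      outside (z≢0 All.∷ _ All.∷ _ All.∷ _ All.∷ z≢4 All.∷ _) (suc (suc zero)) a = contradiction (low-vertex (# 2) (λ ()) λ ())
        (<⇒≱ (triple-nbrs (# 2) z≢0 z≢4 (apart {# 0} {# 4} λ ()) a (edge _ _ refl) (edge _ _ refl)))
      outside (z≢0 All.∷ z≢1 All.∷ _) (suc (suc (suc zero))) a = contradiction (low-vertex (# 3) (λ ()) λ ())
        (<⇒≱ (triple-nbrs (# 3) z≢0 z≢1 (apart {# 0} {# 1} λ ()) a (edge _ _ refl) (edge _ _ refl)))
      outside (z≢0 All.∷ z≢1 All.∷ z≢2 All.∷ _) (suc (suc (suc (suc zero)))) a = contradiction (≤3 h₄) (<⇒≱ (quadruple (# 4)
        ((z≢0 All.∷ z≢1 All.∷ z≢2 All.∷ All.[]) AllPairs.∷ (apart {# 0} {# 1} (λ ()) All.∷ apart {# 0} {# 2} (λ ()) All.∷ All.[]) AllPairs.∷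
          (apart {# 1} {# 2} (λ ()) All.∷ All.[]) AllPairs.∷ All.[] AllPairs.∷ AllPairs.[]) a (edge _ _ refl) (edge _ _ refl) (edge _ _ refl)))
      -- `z`, its neighbours and the house are disjoint; summing gives deg z + 1 + 5 ≤ n.
      component : ∀ {z} → All (z ≢_) hs → ∀ y → row G z y + δ z y + cnt hs y ≤ 1
      component {z} z∉ y with adj G z y in zy
      ... | false with z ≟ y
      ...   | yes refl rewrite All≢⇒cnt≡0 z∉ = ≤-refl
      ...   | no _ = Unique⇒cnt≤1 hs-unique y
      component {z} z∉ y | true rewrite δ-≢ (adj⇒≢ G zy) = ≤-reflexive (cong suc (All≢⇒cnt≡0
        (away (# 0) All.∷ away (# 1) All.∷ away (# 2) All.∷ away (# 3) All.∷ away (# 4) All.∷ All.[])))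
        where
        away : ∀ i → y ≢ f i
        away i refl = outside z∉ i (trans (adj-sym G (f i) z) zy)
      outside-deg : ∀ x → All (x ≢_) hs → 2 ≤ d x
      outside-deg zero (≢0 All.∷ _ All.∷ _ All.∷ _ All.∷ ≢4 All.∷ _) = ⊥-elim (cases roles)
        where
        cases : (h₀ ≡ u × h₄ ≡ v) ⊎ (h₀ ≡ v × h₄ ≡ u) → ⊥
        cases (inj₁ (e , _)) = ≢0 (sym e)
        cases (inj₂ (_ , e)) = ≢4 (sym e)
      outside-deg (suc zero) (≢0 All.∷ _ All.∷ _ All.∷ _ All.∷ ≢4 All.∷ _) = ⊥-elim (cases roles)
        where
        cases : (h₀ ≡ u × h₄ ≡ v) ⊎ (h₀ ≡ v × h₄ ≡ u) → ⊥
        cases (inj₁ (_ , e)) = ≢4 (sym e)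
        cases (inj₂ (e , _)) = ≢0 (sym e)
      outside-deg (suc (suc j)) _ = ≥2 j
      conclude : Dec (∃ λ z → cnt hs z ≡ 0) → 3 ≤ m
      -- With no vertex outside the house n would be at most 5, against `1 ≤ m`.
      conclude (no none) = contradiction (≤-trans (≤-reflexive (sym (∑-1 (5 + m)))) (≤-trans (∑-mono λ z → n≢0⇒n>0 λ e → none (z , e)) (≤-reflexive total)))
        (<⇒≱ (+-monoʳ-≤ 5 1≤m))
      conclude (yes (z , e)) = arith (d z) m (outside-deg z z∉) (≤-trans (≤-reflexive (cong₂ _+_ (cong (d z +_) (sym (∑-δ z))) (sym total)))
        (≤-trans (≤-reflexive (cong (_+ ∑ (cnt hs)) (sym (∑-distrib-+ (row G z) (δ z))))) (≤-trans (∑-+≤ {f = λ y → row G z y + δ z y} {g = cnt hs} (component z∉)) (≤-reflexive (∑-1 (5 + m))))))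
        where
        z∉ = cnt≡0⇒All≢ hs e
        arith : ∀ x m → 2 ≤ x → x + 1 + 5 ≤ 5 + m → 3 ≤ m
        arith x m g h = lin 0 (g ⊹ h) (solve (x ∷ m ∷ []))

-- Degree sequences as lists, and their counts

toList-low : ∀ {l} (ρ : Vec ℕ l) → Nonincreasing ρ → (∀ i → 1 ≤ lookup ρ i) → (∀ i → lookup ρ i ≤ 2) →
  toList ρ ≡ replicate (#≡ 2 (lookup ρ)) 2 ++ replicate (#≡ 1 (lookup ρ)) 1
toList-low Vec.[] _ _ _ = refl
toList-low (a Vec.∷ ρ) mono pos low with a | mono zero | pos zero | low zero
... | 2 | _ | _ | _ = cong (2 ∷_) (toList-low ρ (λ i j h → mono (suc i) (suc j) (s≤s h)) (pos ∘ suc) (low ∘ suc))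
... | 1 | ≤1 | _ | _ = ones (1 Vec.∷ ρ) λ { zero → refl ; (suc i) → ≤-antisym (≤1 (suc i) z≤n) (pos (suc i)) }
  where
  ones : ∀ {l} (ρ : Vec ℕ l) → (∀ i → lookup ρ i ≡ 1) → toList ρ ≡ replicate (#≡ 2 (lookup ρ)) 2 ++ replicate (#≡ 1 (lookup ρ)) 1
  ones Vec.[] _ = refl
  ones (a Vec.∷ ρ) h with a | h zero | ∑-0 {f = is 2 ∘ lookup ρ} (λ i → cong (is 2) (h (suc i))) | ones ρ (h ∘ suc)
  ... | _ | refl | z | ih rewrite z = cong (1 ∷_) ih
... | 0 | _ | () | _
... | suc (suc (suc _)) | _ | _ | s≤s (s≤s ())

counts-low : ∀ {l} (ρ : Vec ℕ l) t r → toList ρ ≡ replicate t 2 ++ replicate r 1 →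
  (∀ i → lookup ρ i ≤ 2) × (∀ i → 1 ≤ lookup ρ i) × #≡ 2 (lookup ρ) ≡ t × #≡ 1 (lookup ρ) ≡ r
counts-low Vec.[] zero zero _ = (λ ()) , (λ ()) , refl , refl
counts-low (a Vec.∷ ρ) (suc t) r e with ∷-injective e
... | refl , e′ with counts-low ρ t r e′
...   | low , pos , c₂ , c₁ = (λ { zero → ≤-refl ; (suc i) → low i }) , (λ { zero → s≤s z≤n ; (suc i) → pos i }) , cong suc c₂ , c₁
counts-low (a Vec.∷ ρ) zero (suc r) e with ∷-injective e
... | refl , e′ with counts-low ρ zero r e′
...   | low , pos , c₂ , c₁ = (λ { zero → s≤s z≤n ; (suc i) → low i }) , (λ { zero → s≤s z≤n ; (suc i) → pos i }) , c₂ , cong suc c₁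

counts-total : ∀ {l} (ρ : Vec ℕ l) → (∀ i → 1 ≤ lookup ρ i) → (∀ i → lookup ρ i ≤ 2) → #≡ 2 (lookup ρ) + #≡ 1 (lookup ρ) ≡ l
counts-total {l} ρ pos low = trans (sym (∑-distrib-+ (is 2 ∘ lookup ρ) (is 1 ∘ lookup ρ))) (trans (sum-cong-≗ λ i → one (lookup ρ i) (pos i) (low i)) (∑-1 l))
  where
  one : ∀ m → 1 ≤ m → m ≤ 2 → is 2 m + is 1 m ≡ 1
  one 1 _ _ = refl
  one 2 _ _ = refl
  one 0 () _
  one (suc (suc (suc _))) _ (s≤s (s≤s ()))

-- Since `i` is positive, the subtraction is not truncated and can be moved to the other side.
∸-positive : ∀ {i} n c → 1 ≤ i → i ≤ n ∸ c → i + c ≤ n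
∸-positive n zero _ h = ≤-trans (≤-reflexive (+-identityʳ _)) h
∸-positive zero (suc c) p h = contradiction (≤-trans p h) λ ()
∸-positive {i} (suc n) (suc c) p h = ≤-trans (≤-reflexive (+-suc i c)) (s≤s (∸-positive n c p h))

even-same-parity : ∀ b s → b % 2 ≡ s % 2 → Even (b + s)
even-same-parity b s e = even-≡ (even-dbl (b % 2 + (b / 2 + s / 2))) (sym (trans
  (cong₂ _+_ (m≡m%n+[m/n]*n b 2) (trans (m≡m%n+[m/n]*n s 2) (cong (_+ s / 2 * 2) (sym e)))) (regroup (b % 2) (b / 2) (s / 2))))
  where
  regroup : ∀ r p q → r + p * 2 + (r + q * 2) ≡ r + (p + q) + (r + (p + q))
  regroup = solve-∀

potentially : ∀ {n} (π : Vec ℕ n) {d} → Housed false d → (∀ i → d i ≡ lookup π i) → PotentiallyGraphic K5-P4 π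
potentially π (housed G D H _) e = G , (λ i → trans (degree≡deg G i) (trans (D i) (e i))) , H

-- The conditions and their necessity

Conditions : (m : ℕ) → Vec ℕ (5 + m) → Set
Conditions m π =
  (3 ≤ lookup π (suc zero))
  × (2 ≤ lookup π (suc (suc (suc (suc zero)))))
  × (∀ (k t : ℕ) → 3 ≤ k → k ≤ (5 + m) ∸ 2 → 3 ≤ t → t ≤ (5 + m) ∸ 2 → k % 2 ≢ t % 2 →
      toList π ≢ ((5 + m) ∸ 1) ∷ k ∷ (replicate t 2 ++ replicate ((5 + m) ∸ 2 ∸ t) 1))
  × (∀ (i k : ℕ) → 1 ≤ k → k ≤ ((5 + m) ∸ 1) / 2 ∸ 1 → 3 ≤ i → i ≤ (5 + m) ∸ 2 * k →
      toList π ≢ ((5 + m) ∸ k) ∷ (k + i) ∷ (replicate i 2 ++ replicate ((5 + m) ∸ i ∸ 2) 1))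
  × ((5 + m ≡ 6 ⊎ 5 + m ≡ 7) → toList π ≢ 3 ∷ 3 ∷ replicate ((5 + m) ∸ 2) 2)

toList-constant : ∀ {l} (ρ : Vec ℕ l) k {c} → toList ρ ≡ replicate k c → ∀ i → lookup ρ i ≡ c
toList-constant (a Vec.∷ ρ) (suc k) e zero = proj₁ (∷-injective e)
toList-constant (a Vec.∷ ρ) (suc k) e (suc i) = toList-constant ρ k (proj₂ (∷-injective e)) i

module _ (m : ℕ) (a b : ℕ) (ρ : Vec ℕ (3 + m)) (mono : Nonincreasing (a Vec.∷ b Vec.∷ ρ)) where
  private
    π : Vec ℕ (5 + m)
    π = a Vec.∷ b Vec.∷ ρ

  necessary : PotentiallyGraphic K5-P4 π → Conditions m π
  necessary (G , real , H) = second , fifth , not-3 , not-4 , not-5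
    where
    module N = Necessity G H
    degs : ∀ i → deg G i ≡ lookup π i
    degs i = trans (sym (degree≡deg G i)) (real i)
    descend : ∀ i j → i Fin.≤ j → deg G j ≤ deg G i
    descend i j h = subst₂ _≤_ (sym (degs j)) (sym (degs i)) (mono i j h)
    second : 3 ≤ b
    second = subst (3 ≤_) (degs (# 1)) (N.second≥3 λ j → descend (# 1) (suc j) (s≤s z≤n))
    first : 3 ≤ a
    first = ≤-trans second (mono (# 0) (# 1) z≤n)
    fifth : 2 ≤ lookup π (# 4)
    fifth = subst (2 ≤_) (degs (# 4)) (N.fifth≥2 λ j → descend (# 4) (suc (suc (suc (suc j)))) (s≤s (s≤s (s≤s (s≤s z≤n)))))
    count : ∀ k → is k a ≡ 0 → is k b ≡ 0 → #≡ k (deg G) ≡ #≡ k (lookup ρ)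
    count k e₁ e₂ = trans (#-cong degs (is k)) (cong₂ (λ s t → s + (t + #≡ k (lookup ρ))) e₁ e₂)
    not-3 : ∀ (k t : ℕ) → 3 ≤ k → k ≤ (5 + m) ∸ 2 → 3 ≤ t → t ≤ (5 + m) ∸ 2 → k % 2 ≢ t % 2 →
      toList π ≢ ((5 + m) ∸ 1) ∷ k ∷ (replicate t 2 ++ replicate ((5 + m) ∸ 2 ∸ t) 1)
    not-3 k t _ _ _ _ _ e = N.LowTail.first-not-dominating (λ j → subst (_≤ 2) (sym (degs (suc (suc j)))) (proj₁ low j))
      (trans (degs (# 0)) (proj₁ (∷-injective e)))
      where low = counts-low ρ t _ (proj₂ (∷-injective (proj₂ (∷-injective e))))
    not-4 : ∀ (i k : ℕ) → 1 ≤ k → k ≤ ((5 + m) ∸ 1) / 2 ∸ 1 → 3 ≤ i → i ≤ (5 + m) ∸ 2 * k →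
      toList π ≢ ((5 + m) ∸ k) ∷ (k + i) ∷ (replicate i 2 ++ replicate ((5 + m) ∸ i ∸ 2) 1)
    -- In (4) the two large terms sum to n + i, while 2i + r with r = n - i - 2 is only n + i - 2.
    not-4 i k 1≤k _ 3≤i i≤ e = contradiction (arith a b i k m ((5 + m) ∸ i ∸ 2) saturated a+k b≡ r+) λ ()
      where
      a≡ = proj₁ (∷-injective e)
      b≡ = proj₁ (∷-injective (proj₂ (∷-injective e)))
      low = counts-low ρ i ((5 + m) ∸ i ∸ 2) (proj₂ (∷-injective (proj₂ (∷-injective e))))
      room : i + 2 * k ≤ 5 + m
      room = ∸-positive (5 + m) (2 * k) (≤-trans (s≤s z≤n) 3≤i) i≤
      k≤ : k ≤ 5 + m
      k≤ = ≤-trans (≤-trans (m≤m+n k (k + 0)) (m≤n+m (2 * k) i)) room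
      i+2≤ : i + 2 ≤ 5 + m
      i+2≤ = ≤-trans (+-monoʳ-≤ i (*-monoʳ-≤ 2 1≤k)) room
      a+k : a + k ≡ 5 + m
      a+k = trans (cong (_+ k) a≡) (m∸n+n≡m k≤)
      r+ : (5 + m) ∸ i ∸ 2 + (i + 2) ≡ 5 + m
      r+ = trans (cong (_+ (i + 2)) (∸-+-assoc (5 + m) i 2)) (m∸n+n≡m i+2≤)
      saturated : a + b ≤ 2 * i + ((5 + m) ∸ i ∸ 2)
      saturated = subst₂ _≤_ (cong₂ _+_ (degs (# 0)) (degs (# 1)))
        (cong₂ (λ s t → 2 * s + t)
          (trans (count 2 (proj₁ (low-hub first)) (proj₁ (low-hub second))) (proj₁ (proj₂ (proj₂ low))))
          (trans (count 1 (proj₂ (low-hub first)) (proj₂ (low-hub second))) (proj₂ (proj₂ (proj₂ low)))))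
        (N.LowTail.hubs-not-saturated (λ j → subst (_≤ 2) (sym (degs (suc (suc j)))) (proj₁ low j))
          (subst (3 ≤_) (sym (degs (# 0))) first) (subst (3 ≤_) (sym (degs (# 1))) second))
      arith : ∀ a b i k m r → a + b ≤ 2 * i + r → a + k ≡ 5 + m → b ≡ k + i → r + (i + 2) ≡ 5 + m → 1 ≤ 0
      arith a b i k m r h e₁ e₂ e₃ = lin 1 (h ⊹ ≤-reflexive (sym e₁) ⊹ ≤-reflexive (sym e₂) ⊹ ≤-reflexive e₃)
        (solve (a ∷ b ∷ i ∷ k ∷ m ∷ r ∷ []))
    not-5 : (5 + m ≡ 6 ⊎ 5 + m ≡ 7) → toList π ≢ 3 ∷ 3 ∷ replicate ((5 + m) ∸ 2) 2
    not-5 n≡ e = small m n≡ λ 1≤m → N.LowTail.eight-vertices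
        (λ j → ≤-reflexive (trans (degs (suc (suc j))) (twos j)))
        (≤-reflexive (trans (degs (# 0)) (proj₁ (∷-injective e))))
        (≤-reflexive (trans (degs (# 1)) (proj₁ (∷-injective (proj₂ (∷-injective e))))))
        (λ j → ≤-reflexive (sym (trans (degs (suc (suc j))) (twos j)))) 1≤m
      where
      twos = toList-constant ρ (3 + m) (proj₂ (∷-injective (proj₂ (∷-injective e))))
      small : ∀ m → 5 + m ≡ 6 ⊎ 5 + m ≡ 7 → (1 ≤ m → 3 ≤ m) → ⊥
      small _ (inj₁ refl) h = contradiction (h ≤-refl) λ { (s≤s ()) }
      small _ (inj₂ refl) h = contradiction (h (s≤s z≤n)) λ { (s≤s (s≤s ())) }

-- Sufficiency when only two terms exceed 2

private
  arith-sum : ∀ A B S R → 3 + A + (3 + B) + (2 * (3 + S) + R) ≡ 6 + S + (6 + S) + (A + B + R)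
  arith-sum = solve-∀

-- The sequence (3 + A, 3 + B, 2³⁺ˢ, 1ᴿ): A, B, S, R are what is left after a house on its five largest terms.
module TwoLarge (A B S R : ℕ) (ρ : Vec ℕ (3 + (S + R))) (B≤A : B ≤ A)
  (n2 : #≡ 2 (lookup ρ) ≡ 3 + S) (n1 : #≡ 1 (lookup ρ) ≡ R)
  (tail-list : toList ρ ≡ replicate (3 + S) 2 ++ replicate R 1)
  (G : Graph (5 + (S + R))) (degs : ∀ i → deg G i ≡ lookup (3 + A Vec.∷ 3 + B Vec.∷ ρ) i) (low : ∀ j → lookup ρ j ≤ 2) where

  π : Vec ℕ (5 + (S + R))
  π = 3 + A Vec.∷ 3 + B Vec.∷ ρ

  private
    m = S + R

    list-form : toList π ≡ 3 + A ∷ 3 + B ∷ (replicate (3 + S) 2 ++ replicate R 1)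
    list-form = cong (λ l → 3 + A ∷ 3 + B ∷ l) tail-list

    u v : Fin (5 + m)
    u = # 0
    v = # 1

    others : ∀ x → u ≢ x → v ≢ x → deg G x ≤ 2
    others zero u≢ _ = contradiction refl u≢
    others (suc zero) _ v≢ = contradiction refl v≢
    others (suc (suc j)) _ _ = subst (_≤ 2) (sym (degs (suc (suc j)))) (low j)

    3≤u : 3 ≤ deg G u
    3≤u = subst (3 ≤_) (sym (degs u)) (m≤m+n 3 A)

    3≤v : 3 ≤ deg G v
    3≤v = subst (3 ≤_) (sym (degs v)) (m≤m+n 3 B)

    module T = TwoHubs G {u} {v} (λ ()) 3≤u 3≤v others

    twos : #≡ 2 (deg G) ≡ 3 + S
    twos = trans (#-cong degs (is 2)) n2

    ones : #≡ 1 (deg G) ≡ R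
    ones = trans (#-cong degs (is 1)) n1

    parity : Even (A + B + R)
    parity = even-cancel (6 + S) (even-≡ (handshake G) (trans T.degree-sum
      (trans (cong₂ _+_ (cong₂ _+_ (degs u) (degs v)) (cong₂ (λ s t → 2 * s + t) twos ones)) (arith-sum A B S R))))

    bound : 3 + A + (3 + B) ≤ 2 * (3 + S) + R + 2
    bound = subst₂ _≤_ (cong₂ _+_ (degs u) (degs v)) (cong₂ (λ s t → 2 * s + t + 2) twos ones) T.hub-bound

    below-n : 3 + A ≤ 4 + m
    below-n = ≤-pred (subst (λ k → suc k ≤ 5 + m) (degs u) (≤-trans (deg<#≥1 G u (≤-trans (s≤s z≤n) 3≤u))
      (≤-trans (∑-mono λ x → ge≤1 1 (deg G x)) (≤-reflexive (∑-1 (5 + m))))))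

  -- The witness is n - d₁, positive because d₁ ≤ n - 1. Parity excludes d₁ + d₂ = 2s + r + 1, so
  -- `bound` is attained, which makes d₂ the witness plus s. The upper limits in (4) follow from d₂
  -- ≤ d₁ and s ≥ 3.
  saturated : ¬ (3 + A + (3 + B) ≤ 2 * (3 + S) + R) → ∃ λ k → 1 ≤ k × k ≤ ((5 + m) ∸ 1) / 2 ∸ 1 × 3 + S ≤ (5 + m) ∸ 2 * k ×
    toList π ≡ ((5 + m) ∸ k) ∷ (k + (3 + S)) ∷ (replicate (3 + S) 2 ++ replicate ((5 + m) ∸ (3 + S) ∸ 2) 1)
  saturated ¬h with m≤n⇒∃[o]m+o≡n below-n
  ... | k , k≡ = suc k , s≤s z≤n , k-bound , S-bound , trans list-form (cong₂ _∷_ first (cong₂ _∷_ second (cong (λ r → replicate (3 + S) 2 ++ replicate r 1) rest)))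
    where
    odd-gap : suc (2 * (3 + S) + R) ≢ 3 + A + (3 + B)
    odd-gap e = ¬even-suc (even-dbl (3 + S + R)) (even-≡ (even-+ (even-dbl 3) parity) (sym (shift A B S R e)))
      where
      shift : ∀ A B S R → suc (2 * (3 + S) + R) ≡ 3 + A + (3 + B) → suc (3 + S + R + (3 + S + R)) ≡ 6 + (A + B + R)
      shift A B S R e = trans (l S R) (trans (cong (_+ R) e) (r A B R))
        where
        l : ∀ S R → suc (3 + S + R + (3 + S + R)) ≡ suc (2 * (3 + S) + R) + R
        l = solve-∀
        r : ∀ A B R → 3 + A + (3 + B) + R ≡ 6 + (A + B + R)
        r = solve-∀
    full : suc (suc (2 * (3 + S) + R)) ≤ 3 + A + (3 + B)
    full = ≤∧≢⇒< (≰⇒> ¬h) odd-gap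
    first : 3 + A ≡ (5 + m) ∸ suc k
    first = sym (trans (cong (_∸ k) (sym k≡)) (m+n∸n≡m (3 + A) k))
    second : 3 + B ≡ suc k + (3 + S)
    second = ≤-antisym (up A B S R k k≡ bound) (down A B S R k k≡ full)
      where
      up : ∀ A B S R k → 3 + A + k ≡ 4 + (S + R) → 3 + A + (3 + B) ≤ 2 * (3 + S) + R + 2 → 3 + B ≤ suc k + (3 + S)
      up A B S R k e h = lin 0 (h ⊹ ≤-reflexive (sym e)) (solve (A ∷ B ∷ S ∷ R ∷ k ∷ []))
      down : ∀ A B S R k → 3 + A + k ≡ 4 + (S + R) → suc (suc (2 * (3 + S) + R)) ≤ 3 + A + (3 + B) → suc k + (3 + S) ≤ 3 + B
      down A B S R k e h = lin 0 (h ⊹ ≤-reflexive e) (solve (A ∷ B ∷ S ∷ R ∷ k ∷ []))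
    rest : R ≡ (5 + m) ∸ (3 + S) ∸ 2
    rest = sym (trans (cong (_∸ 2) (trans (cong (_∸ (3 + S)) (move S R)) (m+n∸n≡m (2 + R) (3 + S)))) refl)
      where
      move : ∀ S R → 5 + (S + R) ≡ 2 + R + (3 + S)
      move = solve-∀
    room : 3 + S + 2 * suc k ≤ 5 + m
    room = arith A B S R k k≡ bound B≤A (≤-reflexive (sym second))
      where
      arith : ∀ A B S R k → 3 + A + k ≡ 4 + (S + R) → 3 + A + (3 + B) ≤ 2 * (3 + S) + R + 2 → B ≤ A → suc k + (3 + S) ≤ 3 + B → 3 + S + 2 * suc k ≤ 5 + (S + R)
      arith A B S R k e _ h i = lin 0 (h ⊹ i ⊹ ≤-reflexive e) (solve (A ∷ B ∷ S ∷ R ∷ k ∷ []))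
    S-bound : 3 + S ≤ (5 + m) ∸ 2 * suc k
    S-bound = m+n≤o⇒m≤o∸n (3 + S) room
    -- By `room`, where the number of 2s is at least 3, twice `2 + k` is at most n - 1; halving is
    -- monotone.
    k-bound : suc k ≤ (4 + m) / 2 ∸ 1
    k-bound = ∸-monoˡ-≤ 1 (≤-trans (≤-reflexive (sym (m*n/n≡m (2 + k) 2))) (/-monoˡ-≤ 2 (arith S R k room)))
      where
      arith : ∀ S R k → 3 + S + 2 * suc k ≤ 5 + (S + R) → (2 + k) * 2 ≤ 4 + (S + R)
      arith S R k h = lin S h (solve (S ∷ R ∷ k ∷ []))

  -- Here d₁ = n - 1 with n = s + r + 2, and since d₁ + d₂ + r is even, d₂ + s is odd: the sequence
  -- is one of (3).
  dominating-hub : 3 + A + (3 + B) ≤ 2 * (3 + S) + R → ¬ (3 + A ≤ 3 + S + R) → 3 + B ≤ 3 + m × (3 + B) % 2 ≢ (3 + S) % 2 ×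
    toList π ≡ ((5 + m) ∸ 1) ∷ 3 + B ∷ (replicate (3 + S) 2 ++ replicate ((5 + m) ∸ 2 ∸ (3 + S)) 1)
  dominating-hub h ¬h = B-bound A B S R h (≰⇒> ¬h) , odd , trans list-form (cong₂ _∷_ A≡ (cong (λ r → 3 + B ∷ (replicate (3 + S) 2 ++ replicate r 1)) (sym (m+n∸m≡n S R))))
    where
    A≡ : 3 + A ≡ 4 + m
    A≡ = ≤-antisym below-n (≰⇒> ¬h)
    B-bound : ∀ A B S R → 3 + A + (3 + B) ≤ 2 * (3 + S) + R → suc (3 + S + R) ≤ 3 + A → 3 + B ≤ 3 + (S + R)
    B-bound A B S R h i = lin (1 + R) (h ⊹ i) (solve (A ∷ B ∷ S ∷ R ∷ []))
    odd : (3 + B) % 2 ≢ (3 + S) % 2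
    odd e = ¬even-suc parity (even-cancel 2 (even-≡ (even-+ (even-same-parity (3 + B) (3 + S) e) (even-dbl R)) (shift A B S R A≡)))
      where
      shift : ∀ A B S R → 3 + A ≡ 4 + (S + R) → 3 + B + (3 + S) + (R + R) ≡ 2 + 2 + (1 + (A + B + R))
      shift A B S R e = trans (l B S R) (trans (cong (λ k → 2 + k + B + R) (sym e)) (r A B R))
        where
        l : ∀ B S R → 3 + B + (3 + S) + (R + R) ≡ 2 + (4 + (S + R)) + B + R
        l = solve-∀
        r : ∀ A B R → 2 + (3 + A) + B + R ≡ 2 + 2 + (1 + (A + B + R))
        r = solve-∀

  -- The bound d₁ ≤ n - 2 becomes `A ≤ S + R`: outside the house there are `S + R` vertices, each
  -- adjacent to the first hub at most once.
  realizable : 3 + A + (3 + B) ≤ 2 * (3 + S) + R → 3 + A ≤ 3 + S + R → PotentiallyGraphic K5-P4 π ⊎ Stuck A B S R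
  realizable h a = finish (derive A B S R A≤ (≤-trans B≤A A≤) (arith A B S R h) parity)
    where
    A≤ : A ≤ S + R
    A≤ = ≤-pred (≤-pred (≤-pred a))
    arith : ∀ A B S R → 3 + A + (3 + B) ≤ 2 * (3 + S) + R → A + B ≤ S + S + R
    arith A B S R h = lin 0 h (solve (A ∷ B ∷ S ∷ R ∷ []))
    finish : Derivable A B S R → PotentiallyGraphic K5-P4 π ⊎ Stuck A B S R
    finish (inj₁ (_ , D)) = inj₁ (potentially π (T.hubs-housed (degs u) (degs v) twos ones D) degs)
    finish (inj₂ s) = inj₂ s

-- Sufficiency: the case split on the third term

three-≥3 : ∀ {l a b c} (ρ : Vec ℕ l) → 3 ≤ a → 3 ≤ b → 3 ≤ c → 3 ≤ #≥ 3 (lookup (a Vec.∷ b Vec.∷ c Vec.∷ ρ))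
three-≥3 ρ ha hb hc rewrite ≤⇒ge ha | ≤⇒ge hb | ≤⇒ge hc = m≤m+n 3 (#≥ 3 (lookup ρ))

five-≥2 : ∀ {l a b c e f} (ρ : Vec ℕ l) → 2 ≤ a → 2 ≤ b → 2 ≤ c → 2 ≤ e → 2 ≤ f → 5 ≤ #≥ 2 (lookup (a Vec.∷ b Vec.∷ c Vec.∷ e Vec.∷ f Vec.∷ ρ))
five-≥2 ρ ha hb hc he hf rewrite ≤⇒ge ha | ≤⇒ge hb | ≤⇒ge hc | ≤⇒ge he | ≤⇒ge hf = m≤m+n 5 (#≥ 2 (lookup ρ))

three-2s : ∀ {l c e f} (ρ : Vec ℕ l) → c ≡ 2 → e ≡ 2 → f ≡ 2 → 3 ≤ #≡ 2 (lookup (c Vec.∷ e Vec.∷ f Vec.∷ ρ))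
three-2s ρ refl refl refl = m≤m+n 3 (#≡ 2 (lookup ρ))

-- The two stuck quadruples are the sequences of (5), for n = 6 and n = 7.
stuck-excluded : ∀ {A B S R l} → Stuck A B S R → l ≡ replicate (3 + S) 2 ++ replicate R 1 →
  ¬ ((5 + (S + R) ≡ 6 ⊎ 5 + (S + R) ≡ 7) → 3 + A ∷ 3 + B ∷ l ≢ 3 ∷ 3 ∷ replicate (3 + (S + R)) 2)
stuck-excluded stuck₁ refl not-5 = not-5 (inj₁ refl) refl
stuck-excluded stuck₂ refl not-5 = not-5 (inj₂ refl) refl

-- Matching the equation `S + R ≡ m` gives the length the form `5 + (S + R)` that `TwoLarge` is
-- stated for.
two-large : ∀ m A B S R → S + R ≡ m → (τ : Vec ℕ (3 + m)) → B ≤ A → (G : Graph (5 + m)) →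
  (∀ i → deg G i ≡ lookup (3 + A Vec.∷ 3 + B Vec.∷ τ) i) → (∀ j → lookup τ j ≤ 2) → #≡ 2 (lookup τ) ≡ 3 + S → #≡ 1 (lookup τ) ≡ R →
  toList τ ≡ replicate (3 + S) 2 ++ replicate R 1 → Conditions m (3 + A Vec.∷ 3 + B Vec.∷ τ) →
  PotentiallyGraphic K5-P4 (3 + A Vec.∷ 3 + B Vec.∷ τ)
two-large _ A B S R refl τ B≤A G degs low n2 n1 form (_ , _ , not-3 , not-4 , not-5) =
  choose (3 + A + (3 + B) ≤? 2 * (3 + S) + R) (3 + A ≤? 3 + S + R)
  where
  module L = TwoLarge A B S R τ B≤A n2 n1 form G degs low
  choose : Dec (3 + A + (3 + B) ≤ 2 * (3 + S) + R) → Dec (3 + A ≤ 3 + S + R) → PotentiallyGraphic K5-P4 L.π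
  choose (no ¬h) _ = ⊥-elim (refute (L.saturated ¬h))
    where
    refute : (∃ λ k → 1 ≤ k × k ≤ ((5 + (S + R)) ∸ 1) / 2 ∸ 1 × 3 + S ≤ (5 + (S + R)) ∸ 2 * k ×
      toList L.π ≡ ((5 + (S + R)) ∸ k) ∷ (k + (3 + S)) ∷ (replicate (3 + S) 2 ++ replicate ((5 + (S + R)) ∸ (3 + S) ∸ 2) 1)) → ⊥
    refute (k , 1≤k , k≤ , S≤ , e) = not-4 (3 + S) k 1≤k k≤ (m≤m+n 3 S) S≤ e
  choose (yes h) (no ¬a) = ⊥-elim
    (not-3 (3 + B) (3 + S) (m≤m+n 3 B) (proj₁ found) (m≤m+n 3 S) (+-monoʳ-≤ 3 (m≤m+n S R)) (proj₁ (proj₂ found)) (proj₂ (proj₂ found)))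
    where
    found = L.dominating-hub h ¬a
  choose (yes h) (yes a) = finish (L.realizable h a)
    where
    finish : PotentiallyGraphic K5-P4 L.π ⊎ Stuck A B S R → PotentiallyGraphic K5-P4 L.π
    finish (inj₁ P) = P
    finish (inj₂ s) = ⊥-elim (stuck-excluded s form not-5)

sufficient : ∀ m (π : Vec ℕ (5 + m)) → Nonincreasing π → (∀ i → 1 ≤ lookup π i) → Graphic π → Conditions m π → PotentiallyGraphic K5-P4 π
sufficient m (a Vec.∷ b Vec.∷ c Vec.∷ e Vec.∷ f Vec.∷ ρ) mono pos (G , real) conditions@(3≤b , 2≤f , _) = split (3 ≤? c)
  where
  π : Vec ℕ (5 + m)
  π = a Vec.∷ b Vec.∷ c Vec.∷ e Vec.∷ f Vec.∷ ρ

  tail : Vec ℕ (3 + m)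
  tail = c Vec.∷ e Vec.∷ f Vec.∷ ρ

  degs : ∀ i → deg G i ≡ lookup π i
  degs i = trans (sym (degree≡deg G i)) (real i)

  b≤a : b ≤ a
  b≤a = mono (# 0) (# 1) z≤n

  2≤e : 2 ≤ e
  2≤e = ≤-trans 2≤f (mono (# 3) (# 4) (s≤s (s≤s (s≤s z≤n))))

  2≤c : 2 ≤ c
  2≤c = ≤-trans 2≤e (mono (# 2) (# 3) (s≤s (s≤s z≤n)))

  3≤a : 3 ≤ a
  3≤a = ≤-trans 3≤b b≤a

  split : Dec (3 ≤ c) → PotentiallyGraphic K5-P4 π
  split (yes 3≤c) = potentially π (rich⇒housed (#≥ 1 (deg G)) G ≤-refl
    (≤-trans (three-≥3 (e Vec.∷ f Vec.∷ ρ) 3≤a 3≤b 3≤c) (≤-reflexive (sym (#-cong degs (ge 3)))) ,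
     ≤-trans (five-≥2 ρ (≤-trans (n≤1+n 2) 3≤a) (≤-trans (n≤1+n 2) 3≤b) 2≤c 2≤e 2≤f) (≤-reflexive (sym (#-cong degs (ge 2)))))) degs
  split (no c≱3) = low-tail (m≤n⇒∃[o]m+o≡n 3≤a) (m≤n⇒∃[o]m+o≡n 3≤b)
    (m≤n⇒∃[o]m+o≡n (three-2s ρ (≤-antisym (low (# 0)) 2≤c) (≤-antisym (low (# 1)) 2≤e) (≤-antisym (low (# 2)) 2≤f)))
    where
    low : ∀ j → lookup tail j ≤ 2
    low j = ≤-trans (mono (# 2) (suc (suc j)) (s≤s (s≤s z≤n))) (≤-pred (≰⇒> c≱3))
    low-tail : (∃ λ A → 3 + A ≡ a) → (∃ λ B → 3 + B ≡ b) → (∃ λ S → 3 + S ≡ #≡ 2 (lookup tail)) → PotentiallyGraphic K5-P4 π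
    low-tail (A , refl) (B , refl) (S , S≡) = two-large m A B S (#≡ 1 (lookup tail)) total tail (≤-pred (≤-pred (≤-pred b≤a))) G degs low (sym S≡) refl form conditions
      where
      total : S + #≡ 1 (lookup tail) ≡ m
      total = +-cancelˡ-≡ 3 _ m (trans (cong (_+ #≡ 1 (lookup tail)) S≡) (counts-total tail (λ i → pos (suc (suc i))) low))
      form : toList tail ≡ replicate (3 + S) 2 ++ replicate (#≡ 1 (lookup tail)) 1
      form = trans (toList-low tail (λ i j h → mono (suc (suc i)) (suc (suc j)) (s≤s (s≤s h))) (λ i → pos (suc (suc i))) low)
        (cong (λ s → replicate s 2 ++ replicate (#≡ 1 (lookup tail)) 1) (sym S≡))

theorem2p1 : (m : ℕ) → (π : Vec ℕ (5 + m)) →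
    Nonincreasing π → (∀ i → 1 ≤ lookup π i) → Graphic π →
    (PotentiallyGraphic K5-P4 π ⇔
    ((3 ≤ lookup π (suc zero))
    × (2 ≤ lookup π (suc (suc (suc (suc zero)))))
    × (∀ (k t : ℕ) → 3 ≤ k → k ≤ (5 + m) ∸ 2 → 3 ≤ t → t ≤ (5 + m) ∸ 2 →
    k % 2 ≢ t % 2 →
    toList π ≢ ((5 + m) ∸ 1) ∷ k ∷ (replicate t 2 ++ replicate ((5 + m) ∸ 2 ∸ t) 1))
    × (∀ (i k : ℕ) → 1 ≤ k → k ≤ ((5 + m) ∸ 1) / 2 ∸ 1 → 3 ≤ i → i ≤ (5 + m) ∸ 2 * k →
    toList π ≢ ((5 + m) ∸ k) ∷ (k + i) ∷ (replicate i 2 ++ replicate ((5 + m) ∸ i ∸ 2) 1))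
    × ((5 + m ≡ 6 ⊎ 5 + m ≡ 7) →
    toList π ≢ 3 ∷ 3 ∷ replicate ((5 + m) ∸ 2) 2)))
theorem2p1 m π@(a Vec.∷ b Vec.∷ ρ) mono pos graphic = mk⇔ (necessary m a b ρ mono) (sufficient m π mono pos graphic)
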